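{- Let $n\geq1$, $w=e^{2\pi i/n}$ and $F=(w^{ij}/\sqrt n)_{i,j=0}^{n-1}$. Let $\Phi$ be the map on $n\times n$ circulant complex matrices defined by $\Phi\big((x_{j-i})_{i,j}\big)=\big((Fx)_{j-i}\big)_{i,j}$, where $x=(x_0,\ldots,x_{n-1})^t$ is the first row. Then $\Phi$ restricts to a bijection from $C^{circ}_n(\infty)$ onto $C^{circ}_n(\infty)$, and this bijection maps $C^{circ}_n(2)$ onto $C^{circ,sa}_n(\infty)$. More precisely, for a circulant $H$: $H\in\sqrt n\,U(n)$ iff all entries of $\Phi(H)$ have modulus one, and $H\in\sqrt n\,O(n)$ (real orthogonal times $\sqrt n$) iff $\Phi(H)$ is self-adjoint with all entries of modulus one.
   Context: A complex Hadamard matrix of order $n$ is a matrix $H$ with $|H_{ij}|=1$ and $H/\sqrt n$ unitary. $C^{circ}_n(\infty)$ is the set of $n\times n$ circulant complex Hadamard matrices ($H_{ij}$ depends only on $j-i$ mod $n$); $C^{circ}_n(2)$ is the subset of those with entries in $\{\pm1\}$; $C^{circ,sa}_n(\infty)$ is the subset of self-adjoint (Hermitian) ones. -}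

module Defs where

open import Algebra.Bundles.Raw using (RawRing)
import Algebra.Definitions.RawSemiring as RawSemiringDefinitions
open import Data.Bool.Base using (if_then_else_)
open import Data.Fin.Base using (Fin; toℕ)
import Data.Fin.Properties as Fin
open import Data.Integer.Base as ℤ using (-[1+_]; +[1+_]; +0)
import Data.Integer.Properties as ℤ
open import Data.Nat.Base as ℕ using (ℕ; zero; suc; _!)
open import Data.Nat.Coprimality using (1-coprimeTo)
import Data.Nat.Coprimality as Coprime
open import Data.Nat.DivMod using (_mod_)
import Data.Nat.Properties as ℕ
open import Data.Nat.Properties using (_!≢0)
open import Data.Product.Base using (∃; _×_; _,_; proj₁; proj₂)
open import Data.Rational.Base
open import Data.Rational.Properties
open import Data.Rational.Solver using (module +-*-Solver)
import Data.Rational.Unnormalised.Base as ℚᵘ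
import Data.Rational.Unnormalised.Properties as ℚᵘ
open import Data.Sum.Base as Sum using (_⊎_; inj₁; inj₂)
open import Data.Vec.Functional using (Vector)
open import Level using (0ℓ)
open import Relation.Binary.Bundles using (Setoid)
import Relation.Binary.Construct.On as On
open import Relation.Binary.PropositionalEquality
open import Relation.Nullary using (¬_; Dec; does; yes; no; contradiction)
open import Relation.Unary using (Pred)
open +-*-Solver using (solve; _:=_; _:+_; _:*_; _:-_; :-_; con)

fromℕ : ℕ → ℚ
fromℕ n = mkℚ (ℤ.+ n) 0 (Coprime.sym (1-coprimeTo n))

recip : ℕ → ℚ
recip k = mkℚ (ℤ.+ 1) k (1-coprimeTo (suc k))

fromℕ-mono : ∀ {m n} → m ℕ.≤ n → fromℕ m ≤ fromℕ n
fromℕ-mono m≤n = (*≤* (ℤ.*-monoʳ-≤-nonNeg (ℤ.+ 1) (ℤ.+≤+ m≤n)))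

0≤fromℕ : ∀ n → 0ℚ ≤ fromℕ n
0≤fromℕ n = fromℕ-mono {0} {n} ℕ.z≤n

fromℕ-suc : ∀ n → fromℕ (suc n) ≡ 1ℚ + fromℕ n
fromℕ-suc n = toℚᵘ-injective (ℚᵘ.≃-trans (ℚᵘ.*≡* eq) (ℚᵘ.≃-sym (toℚᵘ-homo-+ 1ℚ (fromℕ n))))
  where
  eq : ℤ.+ suc n ℤ.* (ℤ.+ 1 ℤ.* ℤ.+ 1) ≡ (ℤ.+ 1 ℤ.* ℤ.+ 1 ℤ.+ ℤ.+ n ℤ.* ℤ.+ 1) ℤ.* ℤ.+ 1
  eq = trans (ℤ.*-identityʳ (ℤ.+ suc n))
         (sym (trans (ℤ.*-identityʳ _) (cong (ℤ._+_ (ℤ.+ 1)) (ℤ.*-identityʳ (ℤ.+ n)))))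

fromℕ-* : ∀ m n → fromℕ (m ℕ.* n) ≡ fromℕ m * fromℕ n
fromℕ-* zero    n = sym (*-zeroˡ (fromℕ n))
fromℕ-* (suc m) n = begin
  fromℕ (n ℕ.+ m ℕ.* n)       ≡⟨ fromℕ-+ n (m ℕ.* n) ⟩
  fromℕ n + fromℕ (m ℕ.* n)   ≡⟨ cong (fromℕ n +_) (fromℕ-* m n) ⟩
  fromℕ n + fromℕ m * fromℕ n ≡⟨ solve 2 (λ m n → n :+ m :* n := (con 1ℚ :+ m) :* n) refl (fromℕ m) (fromℕ n) ⟩
  (1ℚ + fromℕ m) * fromℕ n    ≡⟨ cong (_* fromℕ n) (fromℕ-suc m) ⟨
  fromℕ (suc m) * fromℕ n     ∎
  where
  open ≡-Reasoning
  fromℕ-+ : ∀ m n → fromℕ (m ℕ.+ n) ≡ fromℕ m + fromℕ n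
  fromℕ-+ zero n = sym (+-identityˡ (fromℕ n))
  fromℕ-+ (suc m) n = trans (fromℕ-suc (m ℕ.+ n)) (trans (cong (_+_ 1ℚ) (fromℕ-+ m n))
    (trans (sym (+-assoc 1ℚ (fromℕ m) (fromℕ n))) (cong (_+ fromℕ n) (sym (fromℕ-suc m)))))

fromℕ*recip : ∀ k → fromℕ (suc k) * recip k ≡ 1ℚ
fromℕ*recip k = *-inverseʳ (fromℕ (suc k))

0<recip : ∀ k → 0ℚ < recip k
0<recip k = positive⁻¹ (recip k)

archimedean-ub : ∀ q → q ≤ fromℕ ℤ.∣ ↥ q ∣
archimedean-ub (mkℚ (ℤ.+ n) d c) = *≤* (ℤ.*-monoˡ-≤-nonNeg (ℤ.+ n) (ℤ.+≤+ (ℕ.s≤s ℕ.z≤n)))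
archimedean-ub (mkℚ -[1+ n ] d c) = ≤-trans (<⇒≤ (negative⁻¹ (mkℚ -[1+ n ] d c))) (0≤fromℕ (suc n))

archimedean-lb : ∀ {q} → 0ℚ < q → ∃ λ k → recip k ≤ q
archimedean-lb {mkℚ +[1+ n ] d c} _ =
  d , *≤* (ℤ.*-monoʳ-≤-nonNeg (ℤ.+ suc d) (ℤ.+≤+ (ℕ.s≤s (ℕ.z≤n {n}))))
archimedean-lb {mkℚ +0 d c} (*<* (ℤ.+<+ ()))
archimedean-lb {mkℚ -[1+ n ] d c} (*<* ())

0≤* : ∀ {p q} → 0ℚ ≤ p → 0ℚ ≤ q → 0ℚ ≤ p * q
0≤* {p} {q} 0≤p 0≤q =
  nonNegative⁻¹ (p * q) {{nonNeg*nonNeg⇒nonNeg p {{nonNegative 0≤p}} q {{nonNegative 0≤q}}}}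

0<* : ∀ {p q} → 0ℚ < p → 0ℚ < q → 0ℚ < p * q
0<* {p} {q} 0<p 0<q =
  positive⁻¹ (p * q) {{pos*pos⇒pos p {{positive 0<p}} q {{positive 0<q}}}}

*-mono-≤-0≤ : ∀ {p q r s} → 0ℚ ≤ p → p ≤ q → 0ℚ ≤ r → r ≤ s → p * r ≤ q * s
*-mono-≤-0≤ {p} {q} {r} {s} 0≤p p≤q 0≤r r≤s = ≤-trans
  (*-monoʳ-≤-nonNeg r {{nonNegative 0≤r}} p≤q)
  (*-monoˡ-≤-nonNeg q {{nonNegative (≤-trans 0≤p p≤q)}} r≤s)

0<½* : ∀ {ε} → 0ℚ < ε → 0ℚ < ½ * ε
0<½* = 0<* (positive⁻¹ ½)

p≤p+q : ∀ {p q} → 0ℚ ≤ q → p ≤ p + q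
p≤p+q {p} {q} 0≤q = subst (_≤ p + q) (+-identityʳ p) (+-monoʳ-≤ p 0≤q)

∣-∣-sym : ∀ p q → ∣ p - q ∣ ≡ ∣ q - p ∣
∣-∣-sym p q = trans (sym (∣-p∣≡∣p∣ (p - q)))
  (cong ∣_∣ (solve 2 (λ p q → :- (p :- q) := q :- p) refl p q))

∣-∣-triangle : ∀ p q r → ∣ p - r ∣ ≤ ∣ p - q ∣ + ∣ q - r ∣
∣-∣-triangle p q r = subst (λ t → ∣ t ∣ ≤ ∣ p - q ∣ + ∣ q - r ∣)
  (solve 3 (λ p q r → (p :- q) :+ (q :- r) := p :- r) refl p q r)
  (∣p+q∣≤∣p∣+∣q∣ (p - q) (q - r))

p≤∣p∣ : ∀ p → p ≤ ∣ p ∣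
p≤∣p∣ p with ≤-total 0ℚ p
... | inj₁ 0≤p = ≤-reflexive (sym (0≤p⇒∣p∣≡p 0≤p))
... | inj₂ p≤0 = ≤-trans p≤0 (0≤∣p∣ p)

∣-∣≤⇒≤+ : ∀ {p q ε} → ∣ p - q ∣ ≤ ε → p ≤ q + ε
∣-∣≤⇒≤+ {p} {q} {ε} h = subst (_≤ q + ε) (solve 2 (λ p q → q :+ (p :- q) := p) refl p q)
  (+-monoʳ-≤ q (≤-trans (p≤∣p∣ (p - q)) h))

≤+⇒∣-∣≤ : ∀ {p q ε} → p ≤ q + ε → q ≤ p + ε → ∣ p - q ∣ ≤ ε
≤+⇒∣-∣≤ {p} {q} {ε} h k with ∣p∣≡p∨∣p∣≡-p (p - q)
... | inj₁ eq = subst₂ _≤_ (trans (+-comm (- q) p) (sym eq))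
  (solve 2 (λ q ε → :- q :+ (q :+ ε) := ε) refl q ε) (+-monoʳ-≤ (- q) h)
... | inj₂ eq = subst₂ _≤_ (trans (solve 2 (λ p q → :- p :+ q := :- (p :- q)) refl p q) (sym eq))
  (solve 2 (λ p ε → :- p :+ (p :+ ε) := ε) refl p ε) (+-monoʳ-≤ (- p) k)

∣p∣≤∣q∣+∣p-q∣ : ∀ p q → ∣ p ∣ ≤ ∣ q ∣ + ∣ p - q ∣
∣p∣≤∣q∣+∣p-q∣ p q = subst (λ t → ∣ t ∣ ≤ ∣ q ∣ + ∣ p - q ∣)
  (solve 2 (λ p q → q :+ (p :- q) := p) refl p q) (∣p+q∣≤∣p∣+∣q∣ q (p - q))

½+½ : ∀ ε → ½ * ε + ½ * ε ≡ ε
½+½ ε = trans (sym (*-distribʳ-+ ε ½ ½)) (*-identityˡ ε)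

recip-scale : ∀ b ε → fromℕ (suc b) * (recip b * ε) ≡ ε
recip-scale b ε = trans (sym (*-assoc (fromℕ (suc b)) (recip b) ε)) (trans (cong (_* ε) (fromℕ*recip (b))) (*-identityˡ ε))

p≤fromℕ-suc : ∀ p → p ≤ fromℕ (suc ℤ.∣ ↥ p ∣)
p≤fromℕ-suc p = ≤-trans (archimedean-ub p) (fromℕ-mono (ℕ.n≤1+n _))

recip-antitone : ∀ {j k} → j ℕ.≤ k → recip k ≤ recip j
recip-antitone {j} {k} j≤k = *-cancelˡ-≤-pos (fromℕ (suc k)) 
  (subst₂ _≤_ (sym (fromℕ*recip (k))) refl
   (subst (_≤ fromℕ (suc k) * recip j) (fromℕ*recip (j))
     (*-monoʳ-≤-nonNeg (recip j) {{nonNegative (<⇒≤ (0<recip j))}} (fromℕ-mono (ℕ.s≤s j≤k)))))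

-- ℝ is the set of Cauchy sequences of rationals, with equality _≈ℝ_ given by
-- differences that tend to 0.
Cauchy : (ℕ → ℚ) → Set
Cauchy x = ∀ ε → 0ℚ < ε → ∃ λ N → ∀ m n → N ℕ.≤ m → N ℕ.≤ n → ∣ x m - x n ∣ ≤ ε

record ℝ : Set where
  constructor mkℝ
  field
    seq    : ℕ → ℚ
    cauchy : Cauchy seq
open ℝ public

infix 4 _≈[_]_ _≈ℝ_ _<ℝ_
infixl 6 _+ℝ_ _-ℝ_
infixl 7 _*ℝ_
infix 8 -ℝ_

_≈[_]_ : ℝ → ℚ → ℝ → Set
x ≈[ ε ] y = ∃ λ N → ∀ n → N ℕ.≤ n → ∣ seq x n - seq y n ∣ ≤ ε

_≈ℝ_ : ℝ → ℝ → Set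
x ≈ℝ y = ∀ ε → 0ℚ < ε → x ≈[ ε ] y

_<ℝ_ : ℝ → ℝ → Set
x <ℝ y = ∃ λ δ → 0ℚ < δ × ∃ λ N → ∀ n → N ℕ.≤ n → seq x n + δ ≤ seq y n

≈ℝ-setoid : Setoid _ _
≈ℝ-setoid = record
  { Carrier = ℝ
  ; _≈_ = _≈ℝ_
  ; isEquivalence = record
    { refl  = λ {x} ε 0<ε → 0 , λ n _ →
        subst (λ t → ∣ t ∣ ≤ ε) (sym (+-inverseʳ (seq x n))) (<⇒≤ 0<ε)
    ; sym   = λ {x} {y} x≈y ε 0<ε → proj₁ (x≈y ε 0<ε) , λ n N≤n →
        subst (_≤ ε) (∣-∣-sym (seq x n) (seq y n)) (proj₂ (x≈y ε 0<ε) n N≤n)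
    ; trans = λ {x} {y} {z} x≈y y≈z ε 0<ε →
        let (N , p) = x≈y (½ * ε) (0<½* 0<ε)
            (M , q) = y≈z (½ * ε) (0<½* 0<ε)
        in N ℕ.⊔ M , λ n N⊔M≤n → ≤-trans (∣-∣-triangle (seq x n) (seq y n) (seq z n))
             (≤-trans (+-mono-≤ (p n (ℕ.m⊔n≤o⇒m≤o N M N⊔M≤n)) (q n (ℕ.m⊔n≤o⇒n≤o N M N⊔M≤n)))
                      (≤-reflexive (½+½ ε)))
    }
  }

fromℚ : ℚ → ℝ
fromℚ q .seq _ = q
fromℚ q .cauchy ε 0<ε = 0 , λ _ _ _ _ →
  subst (λ t → ∣ t ∣ ≤ ε) (sym (+-inverseʳ q)) (<⇒≤ 0<ε)

_+ℝ_ : ℝ → ℝ → ℝ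
(x +ℝ y) .seq n = seq x n + seq y n
(x +ℝ y) .cauchy ε 0<ε =
  let (N , p) = cauchy x (½ * ε) (0<½* 0<ε)
      (M , q) = cauchy y (½ * ε) (0<½* 0<ε)
  in N ℕ.⊔ M , λ m n lm ln →
    let a = seq x m ; b = seq x n ; c = seq y m ; d = seq y n in
    begin
      ∣ (a + c) - (b + d) ∣     ≡⟨ cong ∣_∣ (solve 4 (λ a b c d → (a :+ c) :- (b :+ d) := (a :- b) :+ (c :- d)) refl a b c d) ⟩
      ∣ (a - b) + (c - d) ∣     ≤⟨ ∣p+q∣≤∣p∣+∣q∣ (a - b) (c - d) ⟩
      ∣ a - b ∣ + ∣ c - d ∣     ≤⟨ +-mono-≤ (p m n (ℕ.m⊔n≤o⇒m≤o N M lm) (ℕ.m⊔n≤o⇒m≤o N M ln))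
                                           (q m n (ℕ.m⊔n≤o⇒n≤o N M lm) (ℕ.m⊔n≤o⇒n≤o N M ln)) ⟩
      ½ * ε + ½ * ε             ≡⟨ ½+½ ε ⟩
      ε                         ∎
  where open ≤-Reasoning

-ℝ_ : ℝ → ℝ
(-ℝ x) .seq n = - seq x n
(-ℝ x) .cauchy ε 0<ε = proj₁ (cauchy x ε 0<ε) , λ m n lm ln → subst (_≤ ε)
  (trans (sym (∣-p∣≡∣p∣ (seq x m - seq x n)))
         (cong ∣_∣ (neg-distrib-+ (seq x m) (- seq x n))))
  (proj₂ (cauchy x ε 0<ε) m n lm ln)

_-ℝ_ : ℝ → ℝ → ℝ
x -ℝ y = x +ℝ (-ℝ y)

bounded : ∀ x → ∃ λ b → ∃ λ N → ∀ n → N ℕ.≤ n → ∣ seq x n ∣ ≤ fromℕ (suc b)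
bounded x =
  let (N , p) = cauchy x 1ℚ (positive⁻¹ 1ℚ)
      B = ∣ seq x N ∣ + 1ℚ
  in ℤ.∣ ↥ B ∣ , N , λ n N≤n → begin
    ∣ seq x n ∣                           ≤⟨ ∣p∣≤∣q∣+∣p-q∣ (seq x n) (seq x N) ⟩
    ∣ seq x N ∣ + ∣ seq x n - seq x N ∣   ≤⟨ +-monoʳ-≤ ∣ seq x N ∣ (p n N N≤n ℕ.≤-refl) ⟩
    B                                     ≤⟨ p≤fromℕ-suc B ⟩
    fromℕ (suc ℤ.∣ ↥ B ∣)                 ∎
  where open ≤-Reasoning

_*ℝ_ : ℝ → ℝ → ℝ
(x *ℝ y) .seq n = seq x n * seq y n
(x *ℝ y) .cauchy ε 0<ε =
  let (bx , X , px) = bounded x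
      (by , Y , py) = bounded y
      h = ½ * ε
      (N , p) = cauchy x (recip by * h) (0<* (0<recip by) (0<½* 0<ε))
      (M , q) = cauchy y (recip bx * h) (0<* (0<recip bx) (0<½* 0<ε))
      K = X ℕ.⊔ Y ; L = N ℕ.⊔ M
  in K ℕ.⊔ L , λ m n lm ln →
    let a = seq x m ; b = seq x n ; c = seq y m ; d = seq y n
        Km = ℕ.m⊔n≤o⇒m≤o K L lm ; Lm = ℕ.m⊔n≤o⇒n≤o K L lm
        Kn = ℕ.m⊔n≤o⇒m≤o K L ln ; Ln = ℕ.m⊔n≤o⇒n≤o K L ln
    in begin
      ∣ a * c - b * d ∣               ≡⟨ cong ∣_∣ (solve 4 (λ a b c d → a :* c :- b :* d := a :* (c :- d) :+ d :* (a :- b)) refl a b c d) ⟩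
      ∣ a * (c - d) + d * (a - b) ∣   ≤⟨ ∣p+q∣≤∣p∣+∣q∣ (a * (c - d)) (d * (a - b)) ⟩
      ∣ a * (c - d) ∣ + ∣ d * (a - b) ∣ ≡⟨ cong₂ _+_ (∣p*q∣≡∣p∣*∣q∣ a (c - d)) (∣p*q∣≡∣p∣*∣q∣ d (a - b)) ⟩
      ∣ a ∣ * ∣ c - d ∣ + ∣ d ∣ * ∣ a - b ∣
        ≤⟨ +-mono-≤
             (*-mono-≤-0≤ (0≤∣p∣ a) (px m (ℕ.m⊔n≤o⇒m≤o X Y Km)) (0≤∣p∣ (c - d)) (q m n (ℕ.m⊔n≤o⇒n≤o N M Lm) (ℕ.m⊔n≤o⇒n≤o N M Ln)))
             (*-mono-≤-0≤ (0≤∣p∣ d) (py n (ℕ.m⊔n≤o⇒n≤o X Y Kn)) (0≤∣p∣ (a - b)) (p m n (ℕ.m⊔n≤o⇒m≤o N M Lm) (ℕ.m⊔n≤o⇒m≤o N M Ln))) ⟩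
      fromℕ (suc bx) * (recip bx * h) + fromℕ (suc by) * (recip by * h)
        ≡⟨ cong₂ _+_ (recip-scale bx h) (recip-scale by h) ⟩
      h + h  ≡⟨ ½+½ ε ⟩
      ε      ∎
  where open ≤-Reasoning

-- Reciprocal extended by 1/₀ 0 = 0.
1/₀_ : ℚ → ℚ
1/₀ q with q ≟ 0ℚ
... | yes _  = 0ℚ
... | no q≢0 = (1/ q) {{≢-nonZero q≢0}}

1/₀-inverse : ∀ q → 0ℚ < q → q * 1/₀ q ≡ 1ℚ
1/₀-inverse q 0<q with q ≟ 0ℚ
... | yes q≡0 = contradiction (sym q≡0) (<⇒≢ 0<q)
... | no q≢0  = *-inverseʳ q {{≢-nonZero q≢0}}

0≤1/₀ : ∀ q → 0ℚ < q → 0ℚ ≤ 1/₀ q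
0≤1/₀ q 0<q with q ≟ 0ℚ
... | yes _  = ≤-refl
... | no q≢0 = <⇒≤ (positive⁻¹ _ {{1/pos⇒pos q {{positive 0<q}}}})

1/₀-antitone : ∀ p q → 0ℚ < p → p ≤ q → 1/₀ q ≤ 1/₀ p
1/₀-antitone p q 0<p p≤q = begin
  v            ≡⟨ *-identityʳ v ⟨
  v * 1ℚ       ≡⟨ cong (v *_) (1/₀-inverse p 0<p) ⟨
  v * (p * u)  ≤⟨ *-monoˡ-≤-nonNeg v {{nonNegative (0≤1/₀ q 0<q)}} (*-monoʳ-≤-nonNeg u {{nonNegative (0≤1/₀ p 0<p)}} p≤q) ⟩
  v * (q * u)  ≡⟨ solve 3 (λ v q u → v :* (q :* u) := q :* v :* u) refl v q u ⟩
  q * v * u    ≡⟨ cong (_* u) (1/₀-inverse q 0<q) ⟩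
  1ℚ * u       ≡⟨ *-identityˡ u ⟩
  u            ∎
  where
  open ≤-Reasoning
  u = 1/₀ p
  v = 1/₀ q
  0<q = <-≤-trans 0<p p≤q

0ℝ 1ℝ : ℝ
0ℝ = fromℚ 0ℚ
1ℝ = fromℚ 1ℚ

inverse : (x : ℝ) → 0ℝ <ℝ x → ℝ
inverse x _ .seq n = 1/₀ seq x n
inverse x (δ , 0<δ , K , δ≤x) .cauchy ε 0<ε =
  let (N , p) = cauchy x (δ * δ * ε) (0<* (0<* 0<δ 0<δ) 0<ε)
  in K ℕ.⊔ N , λ m n lm ln →
    let a = seq x m ; b = seq x n ; u = 1/₀ a ; v = 1/₀ b ; w = 1/₀ δ
        δ≤a = subst (_≤ a) (+-identityˡ δ) (δ≤x m (ℕ.m⊔n≤o⇒m≤o K N lm))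
        δ≤b = subst (_≤ b) (+-identityˡ δ) (δ≤x n (ℕ.m⊔n≤o⇒m≤o K N ln))
        0<a = <-≤-trans 0<δ δ≤a ; 0<b = <-≤-trans 0<δ δ≤b
        0≤u = 0≤1/₀ a 0<a ; 0≤v = 0≤1/₀ b 0<b
    in begin
      ∣ u - v ∣
        ≡⟨ cong ∣_∣ (cong₂ _-_ (sym (trans (cong (u *_) (1/₀-inverse b 0<b)) (*-identityʳ u)))
                               (sym (trans (cong (v *_) (1/₀-inverse a 0<a)) (*-identityʳ v)))) ⟩
      ∣ u * (b * v) - v * (a * u) ∣
        ≡⟨ cong ∣_∣ (solve 4 (λ a b u v → u :* (b :* v) :- v :* (a :* u) := (u :* v) :* (b :- a)) refl a b u v) ⟩
      ∣ (u * v) * (b - a) ∣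
        ≡⟨ trans (∣p*q∣≡∣p∣*∣q∣ (u * v) (b - a)) (cong₂ _*_ (0≤p⇒∣p∣≡p (0≤* 0≤u 0≤v)) (∣-∣-sym b a)) ⟩
      u * v * ∣ a - b ∣
        ≤⟨ *-mono-≤-0≤ (0≤* 0≤u 0≤v)
             (*-mono-≤-0≤ 0≤u (1/₀-antitone δ a 0<δ δ≤a) 0≤v (1/₀-antitone δ b 0<δ δ≤b))
             (0≤∣p∣ (a - b)) (p m n (ℕ.m⊔n≤o⇒n≤o K N lm) (ℕ.m⊔n≤o⇒n≤o K N ln)) ⟩
      w * w * (δ * δ * ε)
        ≡⟨ solve 3 (λ w δ ε → w :* w :* (δ :* δ :* ε) := (δ :* w) :* ((δ :* w) :* ε)) refl w δ ε ⟩
      (δ * w) * ((δ * w) * ε)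
        ≡⟨ cong (λ t → t * (t * ε)) (1/₀-inverse δ 0<δ) ⟩
      1ℚ * (1ℚ * ε)
        ≡⟨ trans (*-identityˡ _) (*-identityˡ ε) ⟩
      ε ∎
  where open ≤-Reasoning

grid : ℕ → ℕ → ℚ
grid k r = fromℕ r * recip k

-- The largest r ≤ bound with (r / (k + 1))² ≤ q, or 0.
sqrtSearch : ℚ → ℕ → ℕ → ℕ
sqrtSearch q k zero = 0
sqrtSearch q k (suc r) =
  if does (grid k (suc r) * grid k (suc r) ≤? q) then suc r else sqrtSearch q k r

-- For q ≥ 0 this is ⌊ (k + 1) √ q ⌋ / (k + 1).
sqrtApprox : ℚ → ℕ → ℚ
sqrtApprox q k = grid k (sqrtSearch q k (suc k ℕ.* suc ℤ.∣ ↥ q ∣))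

0≤grid : ∀ k r → 0ℚ ≤ grid k r
0≤grid k r = 0≤* (0≤fromℕ r) (<⇒≤ (0<recip k))

0≤sqrtApprox : ∀ q k → 0ℚ ≤ sqrtApprox q k
0≤sqrtApprox q k = 0≤grid k (sqrtSearch q k (suc k ℕ.* suc ℤ.∣ ↥ q ∣))

sqrtSearch-lower : ∀ q k r → let s = sqrtSearch q k r in s ≡ 0 ⊎ grid k s * grid k s ≤ q
sqrtSearch-lower q k zero = inj₁ refl
sqrtSearch-lower q k (suc r) = go (grid k (suc r) * grid k (suc r) ≤? q)
  where
  go : (d : Dec (grid k (suc r) * grid k (suc r) ≤ q)) →
       let s = if does d then suc r else sqrtSearch q k r in s ≡ 0 ⊎ grid k s * grid k s ≤ q
  go (yes p) = inj₂ p
  go (no _)  = sqrtSearch-lower q k r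

sqrtSearch-upper : ∀ q k r → q < grid k (suc r) * grid k (suc r) →
                   let s = suc (sqrtSearch q k r) in q < grid k s * grid k s
sqrtSearch-upper q k zero h = h
sqrtSearch-upper q k (suc r) h = go (grid k (suc r) * grid k (suc r) ≤? q)
  where
  go : (d : Dec (grid k (suc r) * grid k (suc r) ≤ q)) →
       let s = suc (if does d then suc r else sqrtSearch q k r) in q < grid k s * grid k s
  go (yes _) = h
  go (no ¬p) = sqrtSearch-upper q k r (≰⇒> ¬p)

sqrtApprox-lower : ∀ q k → sqrtApprox q k ≡ 0ℚ ⊎ sqrtApprox q k * sqrtApprox q k ≤ q
sqrtApprox-lower q k = Sum.map₁ (λ s≡0 → trans (cong (grid k) s≡0) (*-zeroˡ (recip k)))
  (sqrtSearch-lower q k (suc k ℕ.* suc ℤ.∣ ↥ q ∣))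

square-mono : ∀ {p q} → 0ℚ ≤ p → p ≤ q → p * p ≤ q * q
square-mono 0≤p p≤q = *-mono-≤-0≤ 0≤p p≤q 0≤p p≤q

sqrtApprox-upper : ∀ q k → q < (sqrtApprox q k + recip k) * (sqrtApprox q k + recip k)
sqrtApprox-upper q k = subst (λ s → q < s * s) (step (sqrtSearch q k F)) (sqrtSearch-upper q k F start)
  where
  A = ℤ.∣ ↥ q ∣
  F = suc k ℕ.* suc A

  step : ∀ r → grid k (suc r) ≡ grid k r + recip k
  step r = trans (cong (_* recip k) (fromℕ-suc r))
    (solve 2 (λ r e → (con 1ℚ :+ r) :* e := r :* e :+ e) refl (fromℕ r) (recip k))

  F/k : grid k F ≡ fromℕ (suc A)
  F/k = trans (cong (_* recip k) (fromℕ-* (suc k) (suc A)))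
    (trans (solve 3 (λ a b c → a :* b :* c := b :* (a :* c)) refl (fromℕ (suc k)) (fromℕ (suc A)) (recip k))
    (trans (cong (fromℕ (suc A) *_) (fromℕ*recip k)) (*-identityʳ _)))

  start : q < grid k (suc F) * grid k (suc F)
  start = begin-strict
    q                                                 ≤⟨ archimedean-ub q ⟩
    fromℕ A                                           ≤⟨ p≤p+q {fromℕ A} {0ℚ} ≤-refl ⟩
    fromℕ A + 0ℚ                                      ≡⟨ +-comm (fromℕ A) 0ℚ ⟩
    0ℚ + fromℕ A                                      <⟨ +-monoˡ-< (fromℕ A) (positive⁻¹ 1ℚ) ⟩
    1ℚ + fromℕ A                                      ≡⟨ fromℕ-suc A ⟨
    fromℕ (suc A)                                     ≡⟨ *-identityˡ (fromℕ (suc A)) ⟨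
    1ℚ * fromℕ (suc A)                                ≤⟨ *-monoʳ-≤-nonNeg (fromℕ (suc A)) (fromℕ-mono {1} {suc A} (ℕ.s≤s ℕ.z≤n)) ⟩
    fromℕ (suc A) * fromℕ (suc A)                     ≤⟨ square-mono (0≤fromℕ (suc A)) (subst (fromℕ (suc A) ≤_) (sym (trans (step F) (cong (_+ recip k) F/k))) (p≤p+q (<⇒≤ (0<recip k)))) ⟩
    grid k (suc F) * grid k (suc F) ∎
    where open ≤-Reasoning

sqrtApprox-close : ∀ h q r m n → 0ℚ < h → q ≤ r + h * h → recip n ≤ h →
                   sqrtApprox q m ≤ sqrtApprox r n + (h + h)
sqrtApprox-close h q r m n 0<h q≤r+h² 1/n≤h = ≮⇒≥ (absurd (sqrtApprox-lower q m))
  where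
  open ≤-Reasoning
  a = sqrtApprox q m
  b = sqrtApprox r n
  0≤h = <⇒≤ 0<h
  0≤b = 0≤sqrtApprox r n
  0≤b+h = +-mono-≤ 0≤b 0≤h
  0≤b+2h : 0ℚ ≤ b + (h + h)
  0≤b+2h = +-mono-≤ 0≤b (+-mono-≤ 0≤h 0≤h)
  absurd : a ≡ 0ℚ ⊎ a * a ≤ q → ¬ (b + (h + h) < a)
  absurd (inj₁ a≡0) lt = <-irrefl refl (<-≤-trans (subst (b + (h + h) <_) a≡0 lt) 0≤b+2h)
  absurd (inj₂ a²≤q) lt = <-irrefl refl (begin-strict
    (b + (h + h)) * (b + (h + h))         ≤⟨ square-mono 0≤b+2h (<⇒≤ lt) ⟩
    a * a                                 ≤⟨ a²≤q ⟩
    q                                     ≤⟨ q≤r+h² ⟩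
    r + h * h                             <⟨ +-monoˡ-< (h * h) (sqrtApprox-upper r n) ⟩
    (b + recip n) * (b + recip n) + h * h ≤⟨ +-monoˡ-≤ (h * h) (square-mono (+-mono-≤ 0≤b (<⇒≤ (0<recip n))) (+-monoʳ-≤ b 1/n≤h)) ⟩
    (b + h) * (b + h) + h * h             ≤⟨ p≤p+q (0≤* 0≤b+h (+-mono-≤ 0≤h 0≤h)) ⟩
    (b + h) * (b + h) + h * h + (b + h) * (h + h)
      ≡⟨ solve 2 (λ b h → (b :+ h) :* (b :+ h) :+ h :* h :+ (b :+ h) :* (h :+ h) := (b :+ (h :+ h)) :* (b :+ (h :+ h))) refl b h ⟩
    (b + (h + h)) * (b + (h + h))         ∎)

-- √ x for x ≥ 0; negative approximations of x are treated as 0.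
sqrt : ℝ → ℝ
sqrt x .seq n = sqrtApprox (seq x n) n
sqrt x .cauchy ε 0<ε =
  let h = ½ * ε
      0<h = 0<½* 0<ε
      (N , p) = cauchy x (h * h) (0<* 0<h 0<h)
      (K , q) = archimedean-lb 0<h
      one-sided : ∀ m n → N ℕ.⊔ K ℕ.≤ m → N ℕ.⊔ K ℕ.≤ n →
                  sqrtApprox (seq x m) m ≤ sqrtApprox (seq x n) n + ε
      one-sided m n lm ln = subst (λ e → sqrtApprox (seq x m) m ≤ sqrtApprox (seq x n) n + e) (½+½ ε)
        (sqrtApprox-close h (seq x m) (seq x n) m n 0<h
          (∣-∣≤⇒≤+ (p m n (ℕ.m⊔n≤o⇒m≤o N K lm) (ℕ.m⊔n≤o⇒m≤o N K ln)))
          (≤-trans (recip-antitone (ℕ.m⊔n≤o⇒n≤o N K ln)) q))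
  in N ℕ.⊔ K , λ m n lm ln → ≤+⇒∣-∣≤ (one-sided m n lm ln) (one-sided n m ln lm)

√ℕ : ℕ → ℝ
√ℕ n = sqrt (fromℚ (fromℕ n))

0<√ℕ : ∀ n → .{{ℕ.NonZero n}} → 0ℝ <ℝ √ℕ n
0<√ℕ n = ½ , positive⁻¹ ½ , 1 , λ k 1≤k → subst (_≤ s k) (sym (+-identityˡ ½)) (lower k 1≤k)
  where
  s = sqrtApprox (fromℕ n)
  lower : ∀ k → 1 ℕ.≤ k → ½ ≤ s k
  lower k 1≤k = ≮⇒≥ λ s<½ → <-irrefl refl (begin-strict
    1ℚ                                ≤⟨ fromℕ-mono (ℕ.>-nonZero⁻¹ n) ⟩
    fromℕ n                           <⟨ sqrtApprox-upper (fromℕ n) k ⟩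
    (s k + recip k) * (s k + recip k) ≤⟨ square-mono (+-mono-≤ (0≤sqrtApprox (fromℕ n) k) (<⇒≤ (0<recip k)))
                                           (+-mono-≤ (<⇒≤ s<½) (recip-antitone 1≤k)) ⟩
    1ℚ                                ∎)
    where open ≤-Reasoning

CauchySeq : (ℕ → ℝ) → Set
CauchySeq a = ∀ ε → 0ℚ < ε → ∃ λ N → ∀ m n → N ℕ.≤ m → N ℕ.≤ n → a m ≈[ ε ] a n

-- The k-th approximation is an entry of a k which lies within 1/(k+1) of
-- all later entries of a k.
lim : (a : ℕ → ℝ) → CauchySeq a → ℝ
lim a _ .seq k = seq (a k) (proj₁ (cauchy (a k) (recip k) (0<recip k)))
lim a c .cauchy ε 0<ε =
  let h = ½ * ε ; g = ½ * h
      0<h = 0<½* 0<ε ; 0<g = 0<½* 0<h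
      (N , p) = c h 0<h
      (K , q) = archimedean-lb 0<g
  in N ℕ.⊔ K , λ m n lm ln →
    let (M , pm) = cauchy (a m) (recip m) (0<recip m)
        (L , pn) = cauchy (a n) (recip n) (0<recip n)
        (J , r) = p m n (ℕ.m⊔n≤o⇒m≤o N K lm) (ℕ.m⊔n≤o⇒m≤o N K ln)
        i = M ℕ.⊔ L ℕ.⊔ J
        M≤i = ℕ.≤-trans (ℕ.m≤m⊔n M L) (ℕ.m≤m⊔n (M ℕ.⊔ L) J)
        L≤i = ℕ.≤-trans (ℕ.m≤n⊔m M L) (ℕ.m≤m⊔n (M ℕ.⊔ L) J)
        x = seq (a m) M ; x′ = seq (a m) i ; y = seq (a n) L ; y′ = seq (a n) i
    in begin
      ∣ x - y ∣                             ≤⟨ ∣-∣-triangle x x′ y ⟩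
      ∣ x - x′ ∣ + ∣ x′ - y ∣               ≤⟨ +-monoʳ-≤ ∣ x - x′ ∣ (∣-∣-triangle x′ y′ y) ⟩
      ∣ x - x′ ∣ + (∣ x′ - y′ ∣ + ∣ y′ - y ∣)
        ≤⟨ +-mono-≤ (≤-trans (pm M i ℕ.≤-refl M≤i) (≤-trans (recip-antitone (ℕ.m⊔n≤o⇒n≤o N K lm)) q))
             (+-mono-≤ (r i (ℕ.m≤n⊔m (M ℕ.⊔ L) J))
               (≤-trans (pn i L L≤i ℕ.≤-refl) (≤-trans (recip-antitone (ℕ.m⊔n≤o⇒n≤o N K ln)) q))) ⟩
      g + (h + g)                           ≡⟨ solve 2 (λ g h → g :+ (h :+ g) := (g :+ g) :+ h) refl g h ⟩
      (g + g) + h                           ≡⟨ cong (_+ h) (½+½ h) ⟩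
      h + h                                 ≡⟨ ½+½ ε ⟩
      ε                                     ∎
  where open ≤-Reasoning

record ℂ : Set where
  constructor _+i_
  field
    re im : ℝ
open ℂ public

infix 4 _≈ℂ_
infixl 6 _+ℂ_
infixl 7 _*ℂ_ _·ℂ_
infix 8 -ℂ_
infix 5 _+i_

_≈ℂ_ : ℂ → ℂ → Set
z ≈ℂ w = re z ≈ℝ re w × im z ≈ℝ im w

0ℂ 1ℂ : ℂ
0ℂ = 0ℝ +i 0ℝ
1ℂ = 1ℝ +i 0ℝ

_+ℂ_ _*ℂ_ : ℂ → ℂ → ℂ
z +ℂ w = (re z +ℝ re w) +i (im z +ℝ im w)
z *ℂ w = (re z *ℝ re w -ℝ im z *ℝ im w) +i (re z *ℝ im w +ℝ im z *ℝ re w)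

-ℂ_ conj : ℂ → ℂ
-ℂ z = (-ℝ re z) +i (-ℝ im z)
conj z = re z +i (-ℝ im z)

_·ℂ_ : ℝ → ℂ → ℂ
r ·ℂ z = (r *ℝ re z) +i (r *ℝ im z)

modulus : ℂ → ℝ
modulus z = sqrt (re z *ℝ re z +ℝ im z *ℝ im z)

ℂ-rawRing : RawRing 0ℓ 0ℓ
ℂ-rawRing = record
  { Carrier = ℂ ; _≈_ = _≈ℂ_ ; _+_ = _+ℂ_ ; _*_ = _*ℂ_ ; -_ = -ℂ_ ; 0# = 0ℂ ; 1# = 1ℂ }

open RawSemiringDefinitions (RawRing.rawSemiring ℂ-rawRing) public
  using () renaming (sum to ∑; _^_ to _^ℂ_)

1/ℕ_ : (n : ℕ) → .{{ℕ.NonZero n}} → ℚ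
1/ℕ n = ℤ.+ 1 / n

invFactorial : ℕ → ℚ
invFactorial n = (1/ℕ (n !)) {{n !≢0}}

-- Σ_{j<n} z^j / j!
expSum : ℂ → ℕ → ℂ
expSum z zero    = 0ℂ
expSum z (suc n) = expSum z n +ℂ fromℚ (invFactorial n) ·ℂ (z ^ℂ n)

fromℕ*1/ℕ : ∀ n .{{_ : ℕ.NonZero n}} → fromℕ n * 1/ℕ n ≡ 1ℚ
fromℕ*1/ℕ (suc k) = trans (cong (fromℕ (suc k) *_) (normalize-coprime (1-coprimeTo (suc k)))) (fromℕ*recip k)

0≤invFactorial : ∀ n → 0ℚ ≤ invFactorial n
0≤invFactorial n = nonNegative⁻¹ (invFactorial n) {{normalize-nonNeg 1 (n !) {{n !≢0}}}}

invFactorial-suc : ∀ n → invFactorial (suc n) ≡ recip n * invFactorial n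
invFactorial-suc n = begin
  u                                              ≡⟨ *-identityʳ u ⟨
  u * (1ℚ * 1ℚ)                                  ≡⟨ cong₂ (λ s t → u * (s * t)) (fromℕ*1/ℕ (n !) {{n !≢0}}) (fromℕ*recip n) ⟨
  u * (fromℕ (n !) * v * (fromℕ (suc n) * r))    ≡⟨ solve 5 (λ u a v b r → u :* (a :* v :* (b :* r)) := b :* a :* u :* (r :* v)) refl u (fromℕ (n !)) v (fromℕ (suc n)) r ⟩
  fromℕ (suc n) * fromℕ (n !) * u * (r * v)      ≡⟨ cong (λ t → t * u * (r * v)) (fromℕ-* (suc n) (n !)) ⟨
  fromℕ (suc n !) * u * (r * v)                  ≡⟨ cong (_* (r * v)) (fromℕ*1/ℕ (suc n !) {{suc n !≢0}}) ⟩
  1ℚ * (r * v)                                   ≡⟨ *-identityˡ (r * v) ⟩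
  r * v                                          ∎
  where
  open ≡-Reasoning
  u = invFactorial (suc n)
  v = invFactorial n
  r = recip n

pow : ℚ → ℕ → ℚ
pow q zero    = 1ℚ
pow q (suc n) = q * pow q n

0≤pow : ∀ {q} → 0ℚ ≤ q → ∀ n → 0ℚ ≤ pow q n
0≤pow 0≤q zero    = <⇒≤ (positive⁻¹ 1ℚ)
0≤pow 0≤q (suc n) = 0≤* 0≤q (0≤pow 0≤q n)

expTerm : ℕ → ℕ → ℚ
expTerm c n = invFactorial n * pow (fromℕ c) n

0≤expTerm : ∀ c n → 0ℚ ≤ expTerm c n
0≤expTerm c n = 0≤* (0≤invFactorial n) (0≤pow (0≤fromℕ c) n)

expTerm-halves : ∀ c n → 2 ℕ.* c ℕ.≤ n → expTerm c (suc n) + expTerm c (suc n) ≤ expTerm c n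
expTerm-halves c n 2c≤n = begin
  u′ * (C * p) + u′ * (C * p)        ≡⟨ cong (λ u → u * (C * p) + u * (C * p)) (invFactorial-suc n) ⟩
  r * u * (C * p) + r * u * (C * p)  ≡⟨ solve 4 (λ r u C p → r :* u :* (C :* p) :+ r :* u :* (C :* p) := (u :* p) :* (((con 1ℚ :+ con 1ℚ) :* C) :* r)) refl r u C p ⟩
  (u * p) * ((fromℕ 2 * C) * r)      ≡⟨ cong (λ t → (u * p) * (t * r)) (fromℕ-* 2 c) ⟨
  (u * p) * (fromℕ (2 ℕ.* c) * r)    ≤⟨ *-monoˡ-≤-nonNeg (u * p) {{nonNegative (0≤expTerm c n)}}
                                          (*-monoʳ-≤-nonNeg r {{nonNegative (<⇒≤ (0<recip n))}}
                                            (fromℕ-mono (ℕ.≤-trans 2c≤n (ℕ.n≤1+n n)))) ⟩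
  (u * p) * (fromℕ (suc n) * r)      ≡⟨ cong ((u * p) *_) (fromℕ*recip n) ⟩
  (u * p) * 1ℚ                       ≡⟨ *-identityʳ (u * p) ⟩
  u * p                              ∎
  where
  open ≤-Reasoning
  C = fromℕ c
  p = pow C n
  u = invFactorial n
  u′ = invFactorial (suc n)
  r = recip n

module _ (t : ℕ → ℚ) (0≤t : ∀ n → 0ℚ ≤ t n)
         (n₀ : ℕ) (halves : ∀ n → n₀ ℕ.≤ n → t (suc n) + t (suc n) ≤ t n) where

  open ≤-Reasoning

  halving-decay : ∀ d → t (d ℕ.+ n₀) * fromℕ (suc d) ≤ t n₀
  halving-decay zero    = ≤-reflexive (*-identityʳ (t n₀))
  halving-decay (suc d) = begin
    s * fromℕ (suc (suc d))         ≡⟨ cong (s *_) (fromℕ-suc (suc d)) ⟩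
    s * (1ℚ + D)                    ≤⟨ *-monoˡ-≤-nonNeg s {{nonNegative (0≤t (suc d ℕ.+ n₀))}}
                                         (+-monoˡ-≤ D (fromℕ-mono {1} {suc d} (ℕ.s≤s ℕ.z≤n))) ⟩
    s * (D + D)                     ≡⟨ solve 2 (λ s D → s :* (D :+ D) := (s :+ s) :* D) refl s D ⟩
    (s + s) * D                     ≤⟨ *-monoʳ-≤-nonNeg D {{nonNegative (0≤fromℕ (suc d))}}
                                         (halves (d ℕ.+ n₀) (ℕ.m≤n+m n₀ d)) ⟩
    t (d ℕ.+ n₀) * D                ≤⟨ halving-decay d ⟩
    t n₀                            ∎
    where
    s = t (suc d ℕ.+ n₀)
    D = fromℕ (suc d)

  halving-vanishes : ∀ ε → 0ℚ < ε → ∃ λ N → n₀ ℕ.≤ N × t N ≤ ε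
  halving-vanishes ε 0<ε =
    let b = ℤ.∣ ↥ t n₀ ∣
        (d , p) = archimedean-lb (0<* (0<recip b) 0<ε)
        s = t (d ℕ.+ n₀)
    in d ℕ.+ n₀ , ℕ.m≤n+m n₀ d , (begin
      s                              ≡⟨ *-identityʳ s ⟨
      s * 1ℚ                         ≡⟨ cong (s *_) (fromℕ*recip d) ⟨
      s * (fromℕ (suc d) * recip d)  ≡⟨ *-assoc s (fromℕ (suc d)) (recip d) ⟨
      s * fromℕ (suc d) * recip d    ≤⟨ *-mono-≤-0≤ (0≤* (0≤t (d ℕ.+ n₀)) (0≤fromℕ (suc d)))
                                          (≤-trans (halving-decay d) (p≤fromℕ-suc (t n₀)))
                                          (<⇒≤ (0<recip d)) p ⟩
      fromℕ (suc b) * (recip b * ε)  ≡⟨ recip-scale b ε ⟩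
      ε                              ∎)

  halving-tail : (s : ℕ → ℚ) → (∀ n → ∣ s (suc n) - s n ∣ ≤ t n) →
                 ∀ d n → n₀ ℕ.≤ n → ∣ s (d ℕ.+ n) - s n ∣ + (t (d ℕ.+ n) + t (d ℕ.+ n)) ≤ t n + t n
  halving-tail s step zero n n₀≤n = ≤-reflexive
    (trans (cong (λ q → ∣ q ∣ + (t n + t n)) (+-inverseʳ (s n))) (+-identityˡ (t n + t n)))
  halving-tail s step (suc d) n n₀≤n = begin
    ∣ s (suc m) - s n ∣ + (t (suc m) + t (suc m))
      ≤⟨ +-mono-≤ (∣-∣-triangle (s (suc m)) (s m) (s n)) (halves m (ℕ.≤-trans n₀≤n (ℕ.m≤n+m n d))) ⟩
    ∣ s (suc m) - s m ∣ + ∣ s m - s n ∣ + t m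
      ≤⟨ +-monoˡ-≤ (t m) (+-monoˡ-≤ ∣ s m - s n ∣ (step m)) ⟩
    t m + ∣ s m - s n ∣ + t m
      ≡⟨ solve 2 (λ x y → x :+ y :+ x := y :+ (x :+ x)) refl (t m) ∣ s m - s n ∣ ⟩
    ∣ s m - s n ∣ + (t m + t m)
      ≤⟨ halving-tail s step d n n₀≤n ⟩
    t n + t n ∎
    where m = d ℕ.+ n

  -- One threshold serves all sequences whose increments are bounded by t.
  halving-cauchy : ∀ ε → 0ℚ < ε → ∃ λ N → ∀ m n → N ℕ.≤ m → N ℕ.≤ n →
                   (s : ℕ → ℚ) → (∀ n → ∣ s (suc n) - s n ∣ ≤ t n) → ∣ s m - s n ∣ ≤ ε
  halving-cauchy ε 0<ε =
    let h = ½ * ε ; g = ½ * h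
        (N , n₀≤N , tN≤g) = halving-vanishes g (0<½* (0<½* 0<ε))
    in N , λ m n N≤m N≤n s step →
      let near : ∀ k → N ℕ.≤ k → ∣ s k - s N ∣ ≤ h
          near k N≤k = begin
            ∣ s k - s N ∣                            ≡⟨ cong (λ j → ∣ s j - s N ∣) (ℕ.m∸n+n≡m N≤k) ⟨
            ∣ s (k ℕ.∸ N ℕ.+ N) - s N ∣              ≤⟨ p≤p+q (+-mono-≤ (0≤t (k ℕ.∸ N ℕ.+ N)) (0≤t (k ℕ.∸ N ℕ.+ N))) ⟩
            ∣ s (k ℕ.∸ N ℕ.+ N) - s N ∣ + (t (k ℕ.∸ N ℕ.+ N) + t (k ℕ.∸ N ℕ.+ N))
                                                     ≤⟨ halving-tail s step (k ℕ.∸ N) N n₀≤N ⟩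
            t N + t N                                ≤⟨ +-mono-≤ tN≤g tN≤g ⟩
            g + g                                    ≡⟨ ½+½ h ⟩
            h                                        ∎
      in begin
        ∣ s m - s n ∣                  ≤⟨ ∣-∣-triangle (s m) (s N) (s n) ⟩
        ∣ s m - s N ∣ + ∣ s N - s n ∣  ≤⟨ +-mono-≤ (near m N≤m) (subst (_≤ h) (∣-∣-sym (s n) (s N)) (near n N≤n)) ⟩
        h + h                          ≡⟨ ½+½ ε ⟩
        ε                              ∎

-- Σ_{j<n} z^j / j! is Cauchy in n, with a modulus uniform in the
-- approximations of z.
^ℂ-bound : ∀ z k b → ∣ seq (re z) k ∣ ≤ fromℕ b → ∣ seq (im z) k ∣ ≤ fromℕ b → ∀ n →
  ∣ seq (re (z ^ℂ n)) k ∣ ≤ pow (fromℕ (2 ℕ.* b)) n ×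
  ∣ seq (im (z ^ℂ n)) k ∣ ≤ pow (fromℕ (2 ℕ.* b)) n
^ℂ-bound z k b ha hb zero    = ≤-refl , <⇒≤ (positive⁻¹ 1ℚ)
^ℂ-bound z k b ha hb (suc n) =
  let (hx , hy) = ^ℂ-bound z k b ha hb n in
  (begin
    ∣ a * x - c * y ∣             ≤⟨ ∣p-q∣≤∣p∣+∣q∣ (a * x) (c * y) ⟩
    ∣ a * x ∣ + ∣ c * y ∣         ≤⟨ +-mono-≤ (product a x ha hx) (product c y hb hy) ⟩
    B * p + B * p                 ≡⟨ double ⟩
    fromℕ (2 ℕ.* b) * p           ∎) ,
  (begin
    ∣ a * y + c * x ∣             ≤⟨ ∣p+q∣≤∣p∣+∣q∣ (a * y) (c * x) ⟩
    ∣ a * y ∣ + ∣ c * x ∣         ≤⟨ +-mono-≤ (product a y ha hy) (product c x hb hx) ⟩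
    B * p + B * p                 ≡⟨ double ⟩
    fromℕ (2 ℕ.* b) * p           ∎)
  where
  open ≤-Reasoning
  a = seq (re z) k
  c = seq (im z) k
  x = seq (re (z ^ℂ n)) k
  y = seq (im (z ^ℂ n)) k
  B = fromℕ b
  p = pow (fromℕ (2 ℕ.* b)) n
  product : ∀ u v → ∣ u ∣ ≤ B → ∣ v ∣ ≤ p → ∣ u * v ∣ ≤ B * p
  product u v hu hv = subst (_≤ B * p) (sym (∣p*q∣≡∣p∣*∣q∣ u v)) (*-mono-≤-0≤ (0≤∣p∣ u) hu (0≤∣p∣ v) hv)
  double : B * p + B * p ≡ fromℕ (2 ℕ.* b) * p
  double = trans (solve 2 (λ B p → B :* p :+ B :* p := (con 1ℚ :+ con 1ℚ) :* B :* p) refl B p)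
                 (cong (_* p) (sym (fromℕ-* 2 b)))

module _ (z : ℂ) where
  private
    bx = bounded (re z)
    by = bounded (im z)
    X = suc (proj₁ bx)
    Y = suc (proj₁ by)
    b = X ℕ.⊔ Y
    c = 2 ℕ.* b
    K = proj₁ (proj₂ bx)
    L = proj₁ (proj₂ by)

    powers : ∀ k → K ℕ.⊔ L ℕ.≤ k → ∀ n →
      ∣ seq (re (z ^ℂ n)) k ∣ ≤ pow (fromℕ c) n × ∣ seq (im (z ^ℂ n)) k ∣ ≤ pow (fromℕ c) n
    powers k K⊔L≤k = ^ℂ-bound z k b
      (≤-trans (proj₂ (proj₂ bx) k (ℕ.m⊔n≤o⇒m≤o K L K⊔L≤k)) (fromℕ-mono (ℕ.m≤m⊔n X Y)))
      (≤-trans (proj₂ (proj₂ by) k (ℕ.m⊔n≤o⇒n≤o K L K⊔L≤k)) (fromℕ-mono (ℕ.m≤n⊔m X Y)))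

    increment : ∀ n s y → ∣ y ∣ ≤ pow (fromℕ c) n → ∣ (s + invFactorial n * y) - s ∣ ≤ expTerm c n
    increment n s y hy = begin
      ∣ s + u * y - s ∣     ≡⟨ cong ∣_∣ (solve 2 (λ s x → s :+ x :- s := x) refl s (u * y)) ⟩
      ∣ u * y ∣             ≡⟨ ∣p*q∣≡∣p∣*∣q∣ u y ⟩
      ∣ u ∣ * ∣ y ∣         ≡⟨ cong (_* ∣ y ∣) (0≤p⇒∣p∣≡p (0≤invFactorial n)) ⟩
      u * ∣ y ∣             ≤⟨ *-monoˡ-≤-nonNeg u {{nonNegative (0≤invFactorial n)}} hy ⟩
      expTerm c n           ∎
      where
      open ≤-Reasoning
      u = invFactorial n

    threshold = halving-cauchy (expTerm c) (0≤expTerm c) (2 ℕ.* c) (expTerm-halves c)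

  re-expSum-cauchy : CauchySeq (λ n → re (expSum z n))
  re-expSum-cauchy ε 0<ε = proj₁ (threshold ε 0<ε) , λ m n lm ln → K ℕ.⊔ L , λ k lk →
    proj₂ (threshold ε 0<ε) m n lm ln (λ n → seq (re (expSum z n)) k)
      (λ n → increment n (seq (re (expSum z n)) k) (seq (re (z ^ℂ n)) k) (proj₁ (powers k lk n)))

  im-expSum-cauchy : CauchySeq (λ n → im (expSum z n))
  im-expSum-cauchy ε 0<ε = proj₁ (threshold ε 0<ε) , λ m n lm ln → K ℕ.⊔ L , λ k lk →
    proj₂ (threshold ε 0<ε) m n lm ln (λ n → seq (im (expSum z n)) k)
      (λ n → increment n (seq (im (expSum z n)) k) (seq (im (z ^ℂ n)) k) (proj₂ (powers k lk n)))

exp : ℂ → ℂ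
exp z = lim (λ n → re (expSum z n)) (re-expSum-cauchy z) +i lim (λ n → im (expSum z n)) (im-expSum-cauchy z)

sin : ℝ → ℝ
sin t = im (exp (0ℝ +i t))

-- π is the least positive zero of the sine.
IsPi : ℝ → Set
IsPi π = 0ℝ <ℝ π × sin π ≈ℝ 0ℝ × (∀ t → 0ℝ <ℝ t → t <ℝ π → ¬ (sin t ≈ℝ 0ℝ))

Matrix : ℕ → Set
Matrix n = Fin n → Fin n → ℂ

infix 4 _≈ᴹ_
infixl 7 _*ᴹ_ _·ᴹ_ _*ᵛ_

_≈ᴹ_ : ∀ {n} → Matrix n → Matrix n → Set
A ≈ᴹ B = ∀ i j → A i j ≈ℂ B i j

≈ᴹ-setoid : ℕ → Setoid 0ℓ 0ℓ
≈ᴹ-setoid n = record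
  { Carrier = Matrix n
  ; _≈_ = _≈ᴹ_
  ; isEquivalence = record
    { refl  = λ {A} i j → R.refl {re (A i j)} , R.refl {im (A i j)}
    ; sym   = λ {A} {B} p i j →
        R.sym {re (A i j)} {re (B i j)} (proj₁ (p i j)) ,
        R.sym {im (A i j)} {im (B i j)} (proj₂ (p i j))
    ; trans = λ {A} {B} {C} p q i j →
        R.trans {re (A i j)} {re (B i j)} {re (C i j)} (proj₁ (p i j)) (proj₁ (q i j)) ,
        R.trans {im (A i j)} {im (B i j)} {im (C i j)} (proj₂ (p i j)) (proj₂ (q i j))
    }
  }
  where module R = Setoid ≈ℝ-setoid

_*ᴹ_ : ∀ {n} → Matrix n → Matrix n → Matrix n
(A *ᴹ B) i j = ∑ λ k → A i k *ℂ B k j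

_*ᵛ_ : ∀ {n} → Matrix n → Vector ℂ n → Vector ℂ n
(A *ᵛ x) i = ∑ λ k → A i k *ℂ x k

_·ᴹ_ : ∀ {n} → ℝ → Matrix n → Matrix n
(r ·ᴹ A) i j = r ·ℂ A i j

identity : ∀ {n} → Matrix n
identity i j = if does (i Fin.≟ j) then 1ℂ else 0ℂ

transpose adjoint : ∀ {n} → Matrix n → Matrix n
transpose A i j = A j i
adjoint A i j = conj (A j i)

IsUnitary IsOrthogonal IsSelfAdjoint : ∀ {n} → Matrix n → Set
IsUnitary U = U *ᴹ adjoint U ≈ᴹ identity × adjoint U *ᴹ U ≈ᴹ identity
IsOrthogonal U = (∀ i j → im (U i j) ≈ℝ 0ℝ)
               × U *ᴹ transpose U ≈ᴹ identity × transpose U *ᴹ U ≈ᴹ identity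
IsSelfAdjoint A = adjoint A ≈ᴹ A

HasUnimodularEntries HasSignEntries : ∀ {n} → Matrix n → Set
HasUnimodularEntries A = ∀ i j → modulus (A i j) ≈ℝ 1ℝ
HasSignEntries A = ∀ i j → A i j ≈ℂ 1ℂ ⊎ A i j ≈ℂ -ℂ 1ℂ

module _ (n : ℕ) .{{_ : ℕ.NonZero n}} where

  1/√ : ℝ
  1/√ = inverse (√ℕ n) (0<√ℕ n)

  √nU √nO : Pred (Matrix n) 0ℓ
  √nU H = ∃ λ U → IsUnitary U × H ≈ᴹ √ℕ n ·ᴹ U
  √nO H = ∃ λ U → IsOrthogonal U × H ≈ᴹ √ℕ n ·ᴹ U

  IsHadamard : Matrix n → Set
  IsHadamard H = HasUnimodularEntries H × IsUnitary (1/√ ·ᴹ H)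

  _-ₙ_ : Fin n → Fin n → Fin n
  j -ₙ i = (toℕ j ℕ.+ (n ℕ.∸ toℕ i)) mod n

  IsCirculant : Matrix n → Set
  IsCirculant H = ∀ i j i′ j′ → j -ₙ i ≡ j′ -ₙ i′ → H i j ≈ℂ H i′ j′

  C[∞] C[2] C[∞,sa] : Pred (Matrix n) 0ℓ
  C[∞]    H = IsCirculant H × IsHadamard H
  C[2]    H = C[∞] H × HasSignEntries H
  C[∞,sa] H = C[∞] H × IsSelfAdjoint H

  C[∞]-setoid : Setoid 0ℓ 0ℓ
  C[∞]-setoid = On.setoid {B = ∃ C[∞]} (≈ᴹ-setoid n) proj₁

  module _ (π : ℝ) where

    w : ℂ
    w = exp (0ℝ +i (fromℚ (fromℕ 2 * 1/ℕ n) *ℝ π))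

    F : Matrix n
    F i j = 1/√ ·ℂ (w ^ℂ (toℕ i ℕ.* toℕ j))

    Φ : Matrix n → Matrix n
    Φ H i j = (F *ᵛ H (0 mod n)) (j -ₙ i)

{-# OPTIONS --safe #-}
module Submission where

-- For a circulant matrix H with first row x put y = F x. The columns of F are
-- the characters of ℤ/n, so H / √n = F diag(y) F*, where F is unitary. Hence
-- H / √n is unitary if and only if |y_a| = 1 for all a, and x is real if and
-- only if conj y_{-a} = y_a. The inverse of Φ is the transform with the
-- conjugate of F, to which the same argument applies.
--
-- F is unitary because w is a primitive n-th root of 1. Put e = exp(iπ/n), so
-- that w = e². As eⁿ = exp(iπ) is real, wⁿ = eⁿ conj(eⁿ) = 1. If wᵈ = 1 with
-- 0 < d < n, then eᵈ = conj(eᵈ) is real, that is sin(dπ/n) = 0, which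
-- contradicts the choice of π. The geometric sums of wᵈ vanish since equality
-- of real numbers is stable under double negation. The addition theorem of exp
-- is the Cauchy product, whose error is that of the majorants.

open import Algebra.Bundles using (CommutativeRing; Semiring)
open import Algebra.Bundles.Raw using (RawRing)
import Algebra.Definitions.RawSemiring as RawSemiringDefinitions
import Algebra.Properties.CommutativeSemigroup as CommutativeSemigroupProperties
import Algebra.Properties.CommutativeSemiring.Exp as Exponentiation
import Algebra.Properties.Ring as RingProperties
import Algebra.Properties.Semiring.Sum as Summation
import Algebra.Solver.Ring.NaturalCoefficients.Default as SemiringSolver
open import Algebra.Structures using (IsCommutativeRing)
open import Data.Bool.Base using (if_then_else_)
open import Data.Fin.Base using (Fin; zero; suc; toℕ)
import Data.Fin.Properties as Fin
import Data.Integer.Base as ℤ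
open import Data.Nat.Base as ℕ using (ℕ; zero; suc; NonZero)
open import Data.Nat.DivMod using (_%_; _/_; _mod_; m≡m%n+[m/n]*n; m<n⇒m%n≡m; [m+n]%n≡m%n; n%n≡0; m%n<n)
import Data.Nat.Properties as ℕ
open import Data.Product.Base using (Σ-syntax; ∃; _×_; _,_; proj₁; proj₂)
open import Data.Rational.Base as ℚ using (ℚ; 0ℚ; 1ℚ; ½)
import Data.Rational.Properties as ℚ
open import Data.Rational.Solver using (module +-*-Solver)
open import Data.Sum.Base as Sum using (_⊎_; inj₁; inj₂)
open import Data.Vec.Functional using (Vector)
open import Defs using (_-ₙ_; 0≤*; p≤p+q)
open import Function.Base using (_∘_)
open import Function.Bundles using (Bijection; _⇔_; mk⇔)
open import Level using (_⊔_; 0ℓ) renaming (suc to lsuc)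
open import Relation.Binary.Bundles using (Setoid)
import Relation.Binary.Construct.On as On
open import Relation.Binary.Core using (Rel)
open import Relation.Binary.PropositionalEquality as ≡ using (_≡_)
import Relation.Binary.Reasoning.Setoid as SetoidReasoning
open import Relation.Binary.Structures using (IsEquivalence)
open import Relation.Nullary using (¬_; does; yes; no; contradiction)
open import Relation.Unary using (_∈_)
open Bijection using (to)

-- Matrices over rings with involution

-- The passage from w to its square root e is forced by the definition of π, which speaks of the
-- zeros of the sine below π only. The angles 2dπ/n of wᵈ run up to 2π, and the imaginary part of wᵈ
-- may vanish without wᵈ = 1; the angles dπ/n stay between 0 and π.
--
-- Real numbers are Cauchy sequences with an undecidable equality, and `modulus` contains a square
-- root. The condition |z| = 1 is therefore traded for z · conj z = 1. The argument on circulant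
-- matrices is then pure algebra and runs over any commutative ring with involution. Decisions are
-- made on rational approximations only.
--
-- The operations of ℂ act on the k-th approximations separately, so its ring laws are identities of
-- ℚ[i] for each k. The addition theorem is likewise an estimate in ℚ[i], uniform in all late k.

record StarRing c ℓ : Set (lsuc (c ⊔ ℓ)) where
  field commutativeRing : CommutativeRing c ℓ
  open CommutativeRing commutativeRing hiding (zero) public
  field
    conj      : Carrier → Carrier
    conj-cong : ∀ {x y} → x ≈ y → conj x ≈ conj y
    conj-+    : ∀ x y → conj (x + y) ≈ conj x + conj y
    conj-*    : ∀ x y → conj (x * y) ≈ conj x * conj y
    conj-conj : ∀ x → conj (conj x) ≈ x

  open SetoidReasoning setoid

  -- That constants are fixed is not an axiom of the record: it follows by evaluating the conjugate
  -- of 0 · conj 0, as `conj` is multiplicative and an involution. The same trick works for 1.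
  conj-0# : conj 0# ≈ 0#
  conj-0# = begin
    conj 0#                     ≈⟨ conj-cong (zeroˡ (conj 0#)) ⟨
    conj (0# * conj 0#)         ≈⟨ conj-* 0# (conj 0#) ⟩
    conj 0# * conj (conj 0#)    ≈⟨ *-congˡ (conj-conj 0#) ⟩
    conj 0# * 0#                ≈⟨ zeroʳ (conj 0#) ⟩
    0#                          ∎

  conj-1# : conj 1# ≈ 1#
  conj-1# = begin
    conj 1#                     ≈⟨ *-identityʳ (conj 1#) ⟨
    conj 1# * 1#                ≈⟨ *-congˡ (conj-conj 1#) ⟨
    conj 1# * conj (conj 1#)    ≈⟨ conj-* 1# (conj 1#) ⟨
    conj (1# * conj 1#)         ≈⟨ conj-cong (*-identityˡ (conj 1#)) ⟩
    conj (conj 1#)              ≈⟨ conj-conj 1# ⟩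
    1#                          ∎

  -- The inverse of z has the form conj z · v, since over ℂ only the real number |z|² is inverted.
  *-unit-cancel : ∀ {x z v} → x * z ≈ 0# → z * conj z * v ≈ 1# → x ≈ 0#
  *-unit-cancel {x} {z} {v} xz≈0 unit = begin
    x                        ≈⟨ *-identityʳ x ⟨
    x * 1#                   ≈⟨ *-congˡ unit ⟨
    x * (z * conj z * v)     ≈⟨ *-congˡ (*-assoc z (conj z) v) ⟩
    x * (z * (conj z * v))   ≈⟨ *-assoc x z (conj z * v) ⟨
    x * z * (conj z * v)     ≈⟨ *-congʳ xz≈0 ⟩
    0# * (conj z * v)        ≈⟨ zeroˡ (conj z * v) ⟩
    0#                       ∎

module Matrices {c ℓ} (R : StarRing c ℓ) where
  open StarRing R
  open SetoidReasoning setoid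
  open Summation semiring public using (sum; sum-cong-≋; sum-replicate; sum-replicate-zero; ∑-comm; *-distribˡ-sum; *-distribʳ-sum)
  open RingProperties ring using (+-cancelˡ; -1*x≈-x)
  open CommutativeSemigroupProperties *-commutativeSemigroup using (x∙yz≈y∙xz; xy∙z≈xz∙y; interchange)

  Matrix : ℕ → Set c
  Matrix n = Fin n → Fin n → Carrier

  infix 4 _≈ᴹ_
  infixl 7 _*ᴹ_ _*ᵛ_

  _≈ᴹ_ : ∀ {n} → Matrix n → Matrix n → Set ℓ
  A ≈ᴹ B = ∀ i j → A i j ≈ B i j

  _*ᴹ_ : ∀ {n} → Matrix n → Matrix n → Matrix n
  (A *ᴹ B) i j = sum λ k → A i k * B k j

  _*ᵛ_ : ∀ {n} → Matrix n → Vector Carrier n → Vector Carrier n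
  (A *ᵛ x) i = sum λ k → A i k * x k

  adjoint : ∀ {n} → Matrix n → Matrix n
  adjoint A i j = conj (A j i)

  identity : ∀ {n} → Matrix n
  identity i j = if does (i Fin.≟ j) then 1# else 0#

  diagonal : ∀ {n} → Vector Carrier n → Matrix n
  diagonal y i j = identity i j * y j

  IsUnitary : ∀ {n} → Matrix n → Set ℓ
  IsUnitary U = U *ᴹ adjoint U ≈ᴹ identity × adjoint U *ᴹ U ≈ᴹ identity

  sum-cong : ∀ {n} {f g : Vector Carrier n} → (∀ i → f i ≈ g i) → sum f ≈ sum g
  sum-cong = sum-cong-≋

  sum-zero : ∀ {n} {f : Vector Carrier n} → (∀ i → f i ≈ 0#) → sum f ≈ 0#
  sum-zero {n} h = trans (sum-cong h) (sum-replicate-zero n)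

  conj-sum : ∀ {n} (f : Vector Carrier n) → conj (sum f) ≈ sum (λ i → conj (f i))
  conj-sum {zero}  f = conj-0#
  conj-sum {suc n} f = trans (conj-+ _ _) (+-congˡ (conj-sum (λ i → f (suc i))))

  sum-identityˡ : ∀ {n} (i : Fin n) (f : Vector Carrier n) → sum (λ k → identity i k * f k) ≈ f i
  sum-identityˡ zero f = begin
    1# * f zero + sum (λ k → 0# * f (suc k))  ≈⟨ +-cong (*-identityˡ (f zero)) (sum-zero λ k → zeroˡ (f (suc k))) ⟩
    f zero + 0#                               ≈⟨ +-identityʳ (f zero) ⟩
    f zero                                    ∎
  sum-identityˡ (suc i) f = begin
    0# * f zero + sum (λ k → identity i k * f (suc k))  ≈⟨ +-cong (zeroˡ (f zero)) (sum-identityˡ i (λ k → f (suc k))) ⟩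
    0# + f (suc i)                                      ≈⟨ +-identityˡ (f (suc i)) ⟩
    f (suc i)                                           ∎

  identity-sym : ∀ {n} (i j : Fin n) → identity i j ≡ identity j i
  identity-sym zero    zero    = ≡.refl
  identity-sym zero    (suc j) = ≡.refl
  identity-sym (suc i) zero    = ≡.refl
  identity-sym (suc i) (suc j) = identity-sym i j

  identity-diagonal : ∀ {n} (i : Fin n) → identity i i ≡ 1#
  identity-diagonal zero    = ≡.refl
  identity-diagonal (suc i) = identity-diagonal i

  conj-identity : ∀ {n} (i j : Fin n) → conj (identity i j) ≈ identity i j
  conj-identity zero    zero    = conj-1#
  conj-identity zero    (suc j) = conj-0#
  conj-identity (suc i) zero    = conj-0#
  conj-identity (suc i) (suc j) = conj-identity i j

  ≈ᴹ-trans : ∀ {n} {A B C : Matrix n} → A ≈ᴹ B → B ≈ᴹ C → A ≈ᴹ C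
  ≈ᴹ-trans p q i j = trans (p i j) (q i j)

  ≈ᴹ-sym : ∀ {n} {A B : Matrix n} → A ≈ᴹ B → B ≈ᴹ A
  ≈ᴹ-sym p i j = sym (p i j)

  *ᴹ-cong : ∀ {n} {A A′ B B′ : Matrix n} → A ≈ᴹ A′ → B ≈ᴹ B′ → A *ᴹ B ≈ᴹ A′ *ᴹ B′
  *ᴹ-cong p q i j = sum-cong λ k → *-cong (p i k) (q k j)

  *ᵛ-cong : ∀ {n} {A A′ : Matrix n} {x x′} → A ≈ᴹ A′ → (∀ k → x k ≈ x′ k) → ∀ i → (A *ᵛ x) i ≈ (A′ *ᵛ x′) i
  *ᵛ-cong p q i = sum-cong λ k → *-cong (p i k) (q k)

  *ᵛ-assoc : ∀ {n} (A B : Matrix n) x i → ((A *ᴹ B) *ᵛ x) i ≈ (A *ᵛ (B *ᵛ x)) i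
  *ᵛ-assoc A B x i = begin
    sum (λ k → sum (λ l → A i l * B l k) * x k)    ≈⟨ sum-cong (λ k → *-distribʳ-sum (x k) (λ l → A i l * B l k)) ⟩
    sum (λ k → sum (λ l → A i l * B l k * x k))    ≈⟨ ∑-comm (λ k l → A i l * B l k * x k) ⟩
    sum (λ l → sum (λ k → A i l * B l k * x k))    ≈⟨ sum-cong (λ l → sum-cong λ k → *-assoc (A i l) (B l k) (x k)) ⟩
    sum (λ l → sum (λ k → A i l * (B l k * x k)))  ≈⟨ sum-cong (λ l → *-distribˡ-sum (A i l) (λ k → B l k * x k)) ⟨
    sum (λ l → A i l * sum (λ k → B l k * x k))    ∎

  *ᴹ-assoc : ∀ {n} (A B C : Matrix n) → (A *ᴹ B) *ᴹ C ≈ᴹ A *ᴹ (B *ᴹ C)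
  *ᴹ-assoc A B C i j = *ᵛ-assoc A B (λ k → C k j) i

  *ᵛ-identityˡ : ∀ {n} (x : Vector Carrier n) i → (identity *ᵛ x) i ≈ x i
  *ᵛ-identityˡ x i = sum-identityˡ i x

  *ᴹ-identityˡ : ∀ {n} (A : Matrix n) → identity *ᴹ A ≈ᴹ A
  *ᴹ-identityˡ A i j = sum-identityˡ i (λ k → A k j)

  *ᴹ-identityʳ : ∀ {n} (A : Matrix n) → A *ᴹ identity ≈ᴹ A
  *ᴹ-identityʳ A i j = trans
    (sum-cong λ k → trans (*-comm (A i k) (identity k j)) (*-congʳ (reflexive (identity-sym k j))))
    (sum-identityˡ j (A i))

  adjoint-* : ∀ {n} (A B : Matrix n) → adjoint (A *ᴹ B) ≈ᴹ adjoint B *ᴹ adjoint A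
  adjoint-* A B i j = trans (conj-sum (λ k → A j k * B k i))
    (sum-cong λ k → trans (conj-* (A j k) (B k i)) (*-comm (conj (A j k)) (conj (B k i))))

  adjoint-adjoint : ∀ {n} (A : Matrix n) → adjoint (adjoint A) ≈ᴹ A
  adjoint-adjoint A i j = conj-conj (A i j)

  IsUnitary-cong : ∀ {n} {U V : Matrix n} → U ≈ᴹ V → IsUnitary U → IsUnitary V
  IsUnitary-cong {n} {U} {V} U≈V (p , q) =
    ≈ᴹ-trans {A = V *ᴹ adjoint V} (*ᴹ-cong V≈U V*≈U*) p ,
    ≈ᴹ-trans {A = adjoint V *ᴹ V} (*ᴹ-cong V*≈U* V≈U) q
    where
    V≈U : V ≈ᴹ U
    V≈U = ≈ᴹ-sym U≈V
    V*≈U* : adjoint V ≈ᴹ adjoint U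
    V*≈U* i j = conj-cong (V≈U j i)

  IsUnitary-adjoint : ∀ {n} {U : Matrix n} → IsUnitary U → IsUnitary (adjoint U)
  IsUnitary-adjoint {n} {U} (p , q) =
    ≈ᴹ-trans {A = adjoint U *ᴹ adjoint (adjoint U)} (*ᴹ-cong {A = adjoint U} (λ _ _ → refl) (adjoint-adjoint U)) q ,
    ≈ᴹ-trans {A = adjoint (adjoint U) *ᴹ adjoint U} (*ᴹ-cong {B = adjoint U} (adjoint-adjoint U) (λ _ _ → refl)) p

  *ᴹ-cancel-middle : ∀ {n} {A B C D : Matrix n} → B *ᴹ C ≈ᴹ identity → (A *ᴹ B) *ᴹ (C *ᴹ D) ≈ᴹ A *ᴹ D
  *ᴹ-cancel-middle {n} {A} {B} {C} {D} BC≈1 i j = begin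
    ((A *ᴹ B) *ᴹ (C *ᴹ D)) i j    ≈⟨ *ᴹ-assoc A B (C *ᴹ D) i j ⟩
    (A *ᴹ (B *ᴹ (C *ᴹ D))) i j    ≈⟨ *ᴹ-cong {A = A} (λ _ _ → refl) (λ k l → sym (*ᴹ-assoc B C D k l)) i j ⟩
    (A *ᴹ ((B *ᴹ C) *ᴹ D)) i j    ≈⟨ *ᴹ-cong {A = A} (λ _ _ → refl) (*ᴹ-cong {B = D} BC≈1 (λ _ _ → refl)) i j ⟩
    (A *ᴹ (identity *ᴹ D)) i j    ≈⟨ *ᴹ-cong {A = A} (λ _ _ → refl) (*ᴹ-identityˡ D) i j ⟩
    (A *ᴹ D) i j                  ∎

  IsUnitary-* : ∀ {n} {U V : Matrix n} → IsUnitary U → IsUnitary V → IsUnitary (U *ᴹ V)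
  IsUnitary-* {n} {U} {V} (p , q) (p′ , q′) =
    (λ i j → begin
      ((U *ᴹ V) *ᴹ adjoint (U *ᴹ V)) i j           ≈⟨ *ᴹ-cong {A = U *ᴹ V} (λ _ _ → refl) (adjoint-* U V) i j ⟩
      ((U *ᴹ V) *ᴹ (adjoint V *ᴹ adjoint U)) i j   ≈⟨ *ᴹ-cancel-middle {A = U} {V} {adjoint V} {adjoint U} p′ i j ⟩
      (U *ᴹ adjoint U) i j                         ≈⟨ p i j ⟩
      identity i j                                 ∎) ,
    (λ i j → begin
      (adjoint (U *ᴹ V) *ᴹ (U *ᴹ V)) i j           ≈⟨ *ᴹ-cong {B = U *ᴹ V} (adjoint-* U V) (λ _ _ → refl) i j ⟩
      ((adjoint V *ᴹ adjoint U) *ᴹ (U *ᴹ V)) i j   ≈⟨ *ᴹ-cancel-middle {A = adjoint V} {adjoint U} {U} {V} q i j ⟩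
      (adjoint V *ᴹ V) i j                         ≈⟨ q′ i j ⟩
      identity i j                                 ∎)

  diagonal-*-adjoint : ∀ {n} (y : Vector Carrier n) i j →
    (diagonal y *ᴹ adjoint (diagonal y)) i j ≈ identity i j * (y i * conj (y i))
  diagonal-*-adjoint y i j = begin
    sum (λ k → identity i k * y k * conj (identity j k * y k))    ≈⟨ sum-cong (λ k → *-assoc (identity i k) (y k) (conj (identity j k * y k))) ⟩
    sum (λ k → identity i k * (y k * conj (identity j k * y k)))  ≈⟨ sum-identityˡ i _ ⟩
    y i * conj (identity j i * y i)            ≈⟨ *-congˡ (conj-* (identity j i) (y i)) ⟩
    y i * (conj (identity j i) * conj (y i))   ≈⟨ x∙yz≈y∙xz _ _ _ ⟩
    conj (identity j i) * (y i * conj (y i))   ≈⟨ *-congʳ (trans (conj-identity j i) (reflexive (identity-sym j i))) ⟩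
    identity i j * (y i * conj (y i))          ∎

  adjoint-diagonal : ∀ {n} (y : Vector Carrier n) → adjoint (diagonal y) ≈ᴹ diagonal (λ a → conj (y a))
  adjoint-diagonal y i j = trans (conj-* (identity j i) (y i)) (trans (*-congʳ (trans (conj-identity j i) (reflexive (identity-sym j i)))) (entry i j))
    where
    entry : ∀ i j → identity i j * conj (y i) ≈ identity i j * conj (y j)
    entry i j with i Fin.≟ j
    ... | yes ≡.refl = refl
    ... | no _       = trans (zeroˡ _) (sym (zeroˡ _))

  module _ {n} {y : Vector Carrier n} where

    unimodular⇒unitary-diagonal : (∀ a → y a * conj (y a) ≈ 1#) → IsUnitary (diagonal y)
    unimodular⇒unitary-diagonal h = p ,
      λ i j → trans (*ᴹ-cong (adjoint-diagonal y) D≈ i j) (trans (diagonal-*-adjoint ȳ i j) (scale i j (trans (*-comm _ _) (trans (*-congʳ (conj-conj (y i))) (h i)))))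
      where
      ȳ = λ a → conj (y a)
      scale : ∀ (i j : Fin n) {z} → z ≈ 1# → identity i j * z ≈ identity i j
      scale i j z≈1 = trans (*-congˡ z≈1) (*-identityʳ (identity i j))
      p : diagonal y *ᴹ adjoint (diagonal y) ≈ᴹ identity
      p i j = trans (diagonal-*-adjoint y i j) (scale i j (h i))
      D≈ : diagonal y ≈ᴹ adjoint (diagonal ȳ)
      D≈ i j = trans (sym (conj-conj _)) (conj-cong (adjoint-diagonal y j i))

    unitary-diagonal⇒unimodular : IsUnitary (diagonal y) → ∀ a → y a * conj (y a) ≈ 1#
    unitary-diagonal⇒unimodular (p , _) a = begin
      y a * conj (y a)                       ≈⟨ *-identityˡ _ ⟨
      1# * (y a * conj (y a))                ≈⟨ *-congʳ (reflexive (identity-diagonal a)) ⟨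
      identity a a * (y a * conj (y a))      ≈⟨ diagonal-*-adjoint y a a ⟨
      (diagonal y *ᴹ adjoint (diagonal y)) a a  ≈⟨ p a a ⟩
      identity a a                           ≈⟨ reflexive (identity-diagonal a) ⟩
      1#                                     ∎

  -- Circulant matrices and character tables

  module _ (n : ℕ) .{{_ : NonZero n}} where
    private
      _⊖_ : Fin n → Fin n → Fin n
      _⊖_ = _-ₙ_ n

    ⊖-identityʳ : ∀ a → a ⊖ (0 mod n) ≡ a
    ⊖-identityʳ a = Fin.toℕ-injective (≡.trans (Fin.toℕ-fromℕ< _) (≡.trans
      (≡.cong (λ t → (toℕ a ℕ.+ (n ℕ.∸ t)) % n) (≡.trans (Fin.toℕ-fromℕ< _) (m<n⇒m%n≡m (ℕ.>-nonZero⁻¹ n))))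
      (≡.trans ([m+n]%n≡m%n (toℕ a) n) (m<n⇒m%n≡m (Fin.toℕ<n a)))))

    IsCirculant : Matrix n → Set ℓ
    IsCirculant H = ∀ i j i′ j′ → j ⊖ i ≡ j′ ⊖ i′ → H i j ≈ H i′ j′

    transform : Matrix n → Matrix n → Matrix n
    transform F H i j = (F *ᵛ H (0 mod n)) (_-ₙ_ n j i)

    circulant-firstRow : ∀ {H} → IsCirculant H → ∀ i j → H i j ≈ H (0 mod n) (j ⊖ i)
    circulant-firstRow circ i j = circ i j (0 mod n) (j ⊖ i) (≡.sym (⊖-identityʳ (j ⊖ i)))

    transform-firstRow : ∀ F H a → transform F H (0 mod n) a ≈ (F *ᵛ H (0 mod n)) a
    transform-firstRow F H a = reflexive (≡.cong (F *ᵛ H (0 mod n)) (⊖-identityʳ a))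

    transform-cong : ∀ {F F′ H H′} → F ≈ᴹ F′ → H ≈ᴹ H′ → transform F H ≈ᴹ transform F′ H′
    transform-cong p q i j = *ᵛ-cong p (q (0 mod n)) (j ⊖ i)

    -- F plays the role of the normalised character table (wⁱʲ / √n) of ℤ/n,
    -- with r = 1/√n and s = √n; G is the table of the inverse characters.
    record IsCharacterTable (s r : Carrier) (F G : Matrix n) : Set (c ⊔ ℓ) where
      field
        s*r≈1      : s * r ≈ 1#
        symmetric  : ∀ i j → F i j ≈ F j i
        conjugate  : ∀ i j → conj (F i j) ≈ G i j
        unitary    : F *ᴹ adjoint F ≈ᴹ identity
        difference : ∀ i j a → F i a * G j a ≈ r * G (j ⊖ i) a

    module _ {s r : Carrier} {F G : Matrix n} (r-real : conj r ≈ r) (table : IsCharacterTable s r F G) where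
      open IsCharacterTable table

      conjugate′ : ∀ i j → conj (G i j) ≈ F i j
      conjugate′ i j = trans (conj-cong (sym (conjugate i j))) (conj-conj (F i j))

      adjoint-table : adjoint F ≈ᴹ G
      adjoint-table i j = trans (conj-cong (symmetric j i)) (conjugate i j)

      -- Conjugating all entries of F F* = 1 gives this, because F is symmetric. So the right
      -- inverse of F is seen to be a left inverse without determinants or dimension.
      G*F≈1 : G *ᴹ F ≈ᴹ identity
      G*F≈1 i j = begin
        (G *ᴹ F) i j                          ≈⟨ sum-cong (λ k → *-cong (sym (conjugate i k)) (trans (symmetric k j) (sym (conj-conj (F j k))))) ⟩
        sum (λ k → conj (F i k) * conj (conj (F j k))) ≈⟨ sum-cong (λ k → conj-* (F i k) (conj (F j k))) ⟨
        sum (λ k → conj (F i k * conj (F j k)))  ≈⟨ conj-sum (λ k → F i k * conj (F j k)) ⟨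
        conj ((F *ᴹ adjoint F) i j)           ≈⟨ conj-cong (unitary i j) ⟩
        conj (identity i j)                   ≈⟨ conj-identity i j ⟩
        identity i j                          ∎

      F-unitary : IsUnitary F
      F-unitary = unitary , λ i j → trans (*ᴹ-cong {B = F} adjoint-table (λ _ _ → refl) i j) (G*F≈1 i j)

      conj-difference : ∀ i j a → G i a * F j a ≈ r * F (j ⊖ i) a
      conj-difference i j a = begin
        G i a * F j a                  ≈⟨ *-cong (conjugate i a) (conjugate′ j a) ⟨
        conj (F i a) * conj (G j a)    ≈⟨ conj-* (F i a) (G j a) ⟨
        conj (F i a * G j a)           ≈⟨ conj-cong (difference i j a) ⟩
        conj (r * G (j ⊖ i) a)         ≈⟨ conj-* r (G (j ⊖ i) a) ⟩
        conj r * conj (G (j ⊖ i) a)    ≈⟨ *-cong r-real (conjugate′ (j ⊖ i) a) ⟩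
        r * F (j ⊖ i) a                ∎

      -- This symmetry makes every statement on the transform available for its inverse.
      swap : IsCharacterTable s r G F
      swap = record
        { s*r≈1      = s*r≈1
        ; symmetric  = λ i j → trans (sym (conjugate i j)) (trans (conj-cong (symmetric i j)) (conjugate j i))
        ; conjugate  = conjugate′
        ; unitary    = λ i j → trans (*ᴹ-cong {A = G} (λ _ _ → refl)
            (λ k l → trans (conjugate′ l k) (symmetric l k)) i j) (G*F≈1 i j)
        ; difference = conj-difference
        }

      r*-cancel : ∀ {x y} → r * x ≈ r * y → x ≈ y
      r*-cancel {x} {y} eq = trans (sym (s*[r*z]≈z x)) (trans (*-congˡ eq) (s*[r*z]≈z y))
        where
        s*[r*z]≈z : ∀ z → s * (r * z) ≈ z
        s*[r*z]≈z z = trans (sym (*-assoc s r z)) (trans (*-congʳ s*r≈1) (*-identityˡ z))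

      -- The product F j a · G i a is read by `difference` in one way and by `conj-difference` in
      -- the other. No arithmetic of `⊖` is needed to see that i ⊖ j and j ⊖ i are opposite.
      conj-table-flip : ∀ i j a → conj (F (i ⊖ j) a) ≈ F (j ⊖ i) a
      conj-table-flip i j a = r*-cancel (begin
        r * conj (F (i ⊖ j) a)   ≈⟨ *-congˡ (conjugate (i ⊖ j) a) ⟩
        r * G (i ⊖ j) a          ≈⟨ difference j i a ⟨
        F j a * G i a            ≈⟨ *-comm (F j a) (G i a) ⟩
        G i a * F j a            ≈⟨ conj-difference i j a ⟩
        r * F (j ⊖ i) a          ∎)

      *ᵛ-injective : ∀ {x x′} → (∀ a → (F *ᵛ x) a ≈ (F *ᵛ x′) a) → ∀ k → x k ≈ x′ k
      *ᵛ-injective {x} {x′} eq k = begin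
        x k                   ≈⟨ inv x ⟨
        (G *ᵛ (F *ᵛ x)) k     ≈⟨ *ᵛ-cong {A = G} (λ _ _ → refl) eq k ⟩
        (G *ᵛ (F *ᵛ x′)) k    ≈⟨ inv x′ ⟩
        x′ k                  ∎
        where
        inv : ∀ x → (G *ᵛ (F *ᵛ x)) k ≈ x k
        inv x = trans (sym (*ᵛ-assoc G F x k)) (trans (*ᵛ-cong {x = x} G*F≈1 (λ _ → refl) k) (*ᵛ-identityˡ x k))

      transform-inverse : ∀ {H} → IsCirculant H → transform G (transform F H) ≈ᴹ H
      transform-inverse {H} circ i j = begin
        (G *ᵛ transform F H (0 mod n)) (j ⊖ i)   ≈⟨ *ᵛ-cong {A = G} (λ _ _ → refl) (transform-firstRow F H) (j ⊖ i) ⟩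
        (G *ᵛ (F *ᵛ H (0 mod n))) (j ⊖ i)        ≈⟨ *ᵛ-assoc G F (H (0 mod n)) (j ⊖ i) ⟨
        ((G *ᴹ F) *ᵛ H (0 mod n)) (j ⊖ i)        ≈⟨ *ᵛ-cong {x = H (0 mod n)} G*F≈1 (λ _ → refl) (j ⊖ i) ⟩
        (identity *ᵛ H (0 mod n)) (j ⊖ i)        ≈⟨ *ᵛ-identityˡ (H (0 mod n)) (j ⊖ i) ⟩
        H (0 mod n) (j ⊖ i)                      ≈⟨ circulant-firstRow circ i j ⟨
        H i j                            ∎

      module _ {H : Matrix n} (circ : IsCirculant H) where
        private
          y : Vector Carrier n
          y = F *ᵛ H (0 mod n)
          D : Matrix n
          D = diagonal y

        -- In the entry (i , j) the characters F i a and G j a merge into r · G (j ⊖ i) a, which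
        -- leaves r times the inverse transform of y at j ⊖ i.
        diagonalisation : (F *ᴹ D) *ᴹ adjoint F ≈ᴹ λ i j → r * H i j
        diagonalisation i j = begin
          sum (λ a → (F *ᴹ D) i a * conj (F j a))  ≈⟨ sum-cong (λ a → *-cong (F*D a) (conjugate j a)) ⟩
          sum (λ a → F i a * y a * G j a)          ≈⟨ sum-cong term ⟩
          sum (λ a → r * (G (j ⊖ i) a * y a))      ≈⟨ *-distribˡ-sum r (λ a → G (j ⊖ i) a * y a) ⟨
          r * (G *ᵛ y) (j ⊖ i)                     ≈⟨ *-congˡ (*ᵛ-cong {A = G} (λ _ _ → refl) (transform-firstRow F H) (j ⊖ i)) ⟨
          r * transform G (transform F H) i j      ≈⟨ *-congˡ (transform-inverse circ i j) ⟩
          r * H i j                                ∎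
          where
          F*D : ∀ a → (F *ᴹ D) i a ≈ F i a * y a
          F*D a = begin
            sum (λ k → F i k * (identity k a * y a))  ≈⟨ sum-cong (λ k → *-assoc (F i k) (identity k a) (y a)) ⟨
            sum (λ k → F i k * identity k a * y a)    ≈⟨ *-distribʳ-sum (y a) (λ k → F i k * identity k a) ⟨
            (F *ᴹ identity) i a * y a                 ≈⟨ *-congʳ (*ᴹ-identityʳ F i a) ⟩
            F i a * y a                               ∎
          term : ∀ a → F i a * y a * G j a ≈ r * (G (j ⊖ i) a * y a)
          term a = begin
            F i a * y a * G j a        ≈⟨ xy∙z≈xz∙y (F i a) (y a) (G j a) ⟩
            F i a * G j a * y a        ≈⟨ *-congʳ (difference i j a) ⟩
            r * G (j ⊖ i) a * y a      ≈⟨ *-assoc r (G (j ⊖ i) a) (y a) ⟩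
            r * (G (j ⊖ i) a * y a)    ∎

        -- `V` is r H as the caller writes it, which may differ from the product in the ring by more
        -- than unfolding.
        unimodular⇒unitary : ∀ {V} → (∀ i j → V i j ≈ r * H i j) → (∀ a → y a * conj (y a) ≈ 1#) → IsUnitary V
        unimodular⇒unitary V≈rH h = IsUnitary-cong (≈ᴹ-trans diagonalisation (≈ᴹ-sym V≈rH))
          (IsUnitary-* (IsUnitary-* F-unitary (unimodular⇒unitary-diagonal h)) (IsUnitary-adjoint F-unitary))

        -- `diagonalisation` is solved for D, which gives the product of unitary matrices D = F* (r
        -- H) F.
        unitary⇒unimodular : ∀ {V} → (∀ i j → V i j ≈ r * H i j) → IsUnitary V → ∀ a → y a * conj (y a) ≈ 1#
        unitary⇒unimodular V≈rH V-unitary = unitary-diagonal⇒unimodular (IsUnitary-cong F*rHF≈D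
          (IsUnitary-* (IsUnitary-* (IsUnitary-adjoint F-unitary) (IsUnitary-cong V≈rH V-unitary)) F-unitary))
          where
          rH : Matrix n
          rH i j = r * H i j
          F*F≈1 = proj₂ F-unitary
          F*rHF≈D : (adjoint F *ᴹ rH) *ᴹ F ≈ᴹ D
          F*rHF≈D i j = begin
            ((adjoint F *ᴹ rH) *ᴹ F) i j
              ≈⟨ *ᴹ-cong {B = F} (*ᴹ-cong {A = adjoint F} (λ _ _ → refl) (≈ᴹ-sym diagonalisation)) (λ _ _ → refl) i j ⟩
            ((adjoint F *ᴹ ((F *ᴹ D) *ᴹ adjoint F)) *ᴹ F) i j
              ≈⟨ *ᴹ-cong {B = F} (≈ᴹ-sym (*ᴹ-assoc (adjoint F) (F *ᴹ D) (adjoint F))) (λ _ _ → refl) i j ⟩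
            (((adjoint F *ᴹ (F *ᴹ D)) *ᴹ adjoint F) *ᴹ F) i j
              ≈⟨ *ᴹ-assoc (adjoint F *ᴹ (F *ᴹ D)) (adjoint F) F i j ⟩
            ((adjoint F *ᴹ (F *ᴹ D)) *ᴹ (adjoint F *ᴹ F)) i j
              ≈⟨ *ᴹ-cong {A = adjoint F *ᴹ (F *ᴹ D)} (λ _ _ → refl) F*F≈1 i j ⟩
            ((adjoint F *ᴹ (F *ᴹ D)) *ᴹ identity) i j
              ≈⟨ *ᴹ-identityʳ (adjoint F *ᴹ (F *ᴹ D)) i j ⟩
            (adjoint F *ᴹ (F *ᴹ D)) i j
              ≈⟨ *ᴹ-assoc (adjoint F) F D i j ⟨
            ((adjoint F *ᴹ F) *ᴹ D) i j
              ≈⟨ *ᴹ-cong {B = D} F*F≈1 (λ _ _ → refl) i j ⟩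
            (identity *ᴹ D) i j
              ≈⟨ *ᴹ-identityˡ D i j ⟩
            D i j ∎

        real⇒transform-selfAdjoint : (∀ i j → conj (H i j) ≈ H i j) →
                                     adjoint (transform F H) ≈ᴹ transform F H
        real⇒transform-selfAdjoint real i j = trans (conj-sum (λ k → F (i ⊖ j) k * H (0 mod n) k))
          (sum-cong λ k → trans (conj-* (F (i ⊖ j) k) (H (0 mod n) k)) (*-cong (conj-table-flip i j k) (real (0 mod n) k)))

        -- For the first row x, self-adjointness says that x and conj x have the same image under F,
        -- and F is injective.
        transform-selfAdjoint⇒real : adjoint (transform F H) ≈ᴹ transform F H →
                                     ∀ i j → conj (H i j) ≈ H i j
        transform-selfAdjoint⇒real sa i j = begin
          conj (H i j)          ≈⟨ conj-cong (circulant-firstRow circ i j) ⟩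
          conj (H (0 mod n) (j ⊖ i))    ≈⟨ *ᵛ-injective F*conj (j ⊖ i) ⟩
          H (0 mod n) (j ⊖ i)           ≈⟨ circulant-firstRow circ i j ⟨
          H i j                 ∎
          where
          F*conj : ∀ a → (F *ᵛ λ k → conj (H (0 mod n) k)) a ≈ y a
          F*conj a = begin
            sum (λ k → F a k * conj (H (0 mod n) k))             ≈⟨ sum-cong (λ k → *-congʳ (trans (reflexive (≡.cong (λ b → F b k) (≡.sym (⊖-identityʳ a)))) (sym (conj-table-flip (0 mod n) a k)))) ⟩
            sum (λ k → conj (F ((0 mod n) ⊖ a) k) * conj (H (0 mod n) k)) ≈⟨ sum-cong (λ k → conj-* (F ((0 mod n) ⊖ a) k) (H (0 mod n) k)) ⟨
            sum (λ k → conj (F ((0 mod n) ⊖ a) k * H (0 mod n) k))       ≈⟨ conj-sum (λ k → F ((0 mod n) ⊖ a) k * H (0 mod n) k) ⟨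
            conj (y ((0 mod n) ⊖ a))                             ≈⟨ sa (0 mod n) a ⟩
            y (a ⊖ (0 mod n))                                    ≈⟨ transform-firstRow F H a ⟩
            y a                                          ∎

  -- Roots of unity and the Fourier table

  open Exponentiation commutativeSemiring using (_^_; ^-congˡ; ^-homo-*; ^-assocʳ; ^-distrib-*)
  open RawSemiringDefinitions (Semiring.rawSemiring semiring) using () renaming (_×_ to _·_)

  conj-^ : ∀ x m → conj (x ^ m) ≈ conj x ^ m
  conj-^ x zero    = conj-1#
  conj-^ x (suc m) = trans (conj-* x (x ^ m)) (*-congˡ (conj-^ x m))

  1^m≈1 : ∀ m → 1# ^ m ≈ 1#
  1^m≈1 zero    = refl
  1^m≈1 (suc m) = trans (*-identityˡ (1# ^ m)) (1^m≈1 m)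

  unimodular-^ : ∀ {x} → x * conj x ≈ 1# → ∀ m → x ^ m * conj (x ^ m) ≈ 1#
  unimodular-^ {x} h m = begin
    x ^ m * conj (x ^ m)   ≈⟨ *-congˡ (conj-^ x m) ⟩
    x ^ m * conj x ^ m     ≈⟨ ^-distrib-* x (conj x) m ⟨
    (x * conj x) ^ m       ≈⟨ ^-congˡ m h ⟩
    1# ^ m                 ≈⟨ 1^m≈1 m ⟩
    1#                     ∎

  -- Both sides are the sum of x ^ k over k ≤ m, with the last or the first term split off. This
  -- form needs neither subtraction nor division.
  geometric-sum : ∀ x m → sum {m} (λ k → x ^ toℕ k) + x ^ m ≈ 1# + x * sum {m} (λ k → x ^ toℕ k)
  geometric-sum x zero    = trans (+-identityˡ 1#) (sym (trans (+-congˡ (zeroʳ x)) (+-identityʳ 1#)))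
  geometric-sum x (suc m) = begin
    1# + sum {m} (λ k → x * x ^ toℕ k) + x * x ^ m  ≈⟨ +-congʳ (+-congˡ (*-distribˡ-sum {m} x (λ k → x ^ toℕ k))) ⟨
    1# + x * S + x * x ^ m                          ≈⟨ +-assoc 1# (x * S) (x * x ^ m) ⟩
    1# + (x * S + x * x ^ m)                        ≈⟨ +-congˡ (distribˡ x S (x ^ m)) ⟨
    1# + x * (S + x ^ m)                            ≈⟨ +-congˡ (*-congˡ (geometric-sum x m)) ⟩
    1# + x * (1# + x * S)                           ≈⟨ +-congˡ (*-congˡ (+-congˡ (*-distribˡ-sum {m} x (λ k → x ^ toℕ k)))) ⟩
    1# + x * (1# + sum {m} (λ k → x * x ^ toℕ k))   ∎
    where S = sum {m} (λ k → x ^ toℕ k)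

  module _ (n : ℕ) .{{_ : NonZero n}} {s r e ζ : Carrier}
           (s*r≈1 : s * r ≈ 1#) (s*s≈n : s * s ≈ n · 1#) (r-real : conj r ≈ r)
           (e-unimodular : e * conj e ≈ 1#) (eⁿ-real : conj (e ^ n) ≈ e ^ n)
           (eᵈ-nonreal : ∀ d → 0 ℕ.< d → d ℕ.< n → ¬ conj (e ^ d) ≈ e ^ d)
           (cancel : ∀ {x z} → x * z ≈ 0# → ¬ x ≈ 0# → z ≈ 0#)
           (ζ≈e² : ζ ≈ e * e) where
    private
      _⊖_ : Fin n → Fin n → Fin n
      _⊖_ = _-ₙ_ n

    root^ : ∀ m → ζ ^ m ≈ e ^ m * e ^ m
    root^ m = trans (^-congˡ m ζ≈e²) (^-distrib-* e e m)

    rootⁿ≈1 : ζ ^ n ≈ 1#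
    rootⁿ≈1 = trans (root^ n) (trans (*-congˡ (sym eⁿ-real)) (unimodular-^ e-unimodular n))

    root-unimodular : ζ * conj ζ ≈ 1#
    root-unimodular = begin
      ζ * conj ζ                       ≈⟨ *-cong ζ≈e² (trans (conj-cong ζ≈e²) (conj-* e e)) ⟩
      e * e * (conj e * conj e)        ≈⟨ interchange e e (conj e) (conj e) ⟩
      e * conj e * (e * conj e)        ≈⟨ *-cong e-unimodular e-unimodular ⟩
      1# * 1#                          ≈⟨ *-identityˡ 1# ⟩
      1#                               ∎

    -- From e²ᵈ = 1 = eᵈ · conj eᵈ it follows that eᵈ is real.
    root-primitive : ∀ d → 0 ℕ.< d → d ℕ.< n → ¬ ζ ^ d ≈ 1#
    root-primitive d 0<d d<n ζᵈ≈1 = eᵈ-nonreal d 0<d d<n (begin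
      conj x               ≈⟨ *-identityʳ (conj x) ⟨
      conj x * 1#          ≈⟨ *-congˡ (trans (sym (root^ d)) ζᵈ≈1) ⟨
      conj x * (x * x)     ≈⟨ *-assoc (conj x) x x ⟨
      conj x * x * x       ≈⟨ *-congʳ (trans (*-comm (conj x) x) (unimodular-^ e-unimodular d)) ⟩
      1# * x               ≈⟨ *-identityˡ x ⟩
      x                    ∎)
      where x = e ^ d

    -- For x = ζ ^ d the relation x ^ n = 1 turns `geometric-sum` into (x - 1) S = 0. Primitivity
    -- only refutes x = 1 and gives no inverse of x - 1, hence the form of the hypothesis `cancel`.
    root-sum : ∀ d → 0 ℕ.< d → d ℕ.< n → sum {n} (λ k → (ζ ^ d) ^ toℕ k) ≈ 0#
    root-sum d 0<d d<n = cancel x-1*S≈0 λ x-1≈0 → root-primitive d 0<d d<n (begin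
      x                  ≈⟨ +-identityʳ x ⟨
      x + 0#             ≈⟨ +-congˡ (-‿inverseˡ 1#) ⟨
      x + (- 1# + 1#)    ≈⟨ +-assoc x (- 1#) 1# ⟨
      x - 1# + 1#        ≈⟨ +-congʳ x-1≈0 ⟩
      0# + 1#            ≈⟨ +-identityˡ 1# ⟩
      1#                 ∎)
      where
      x = ζ ^ d
      S = sum {n} (λ k → x ^ toℕ k)
      xⁿ≈1 : x ^ n ≈ 1#
      xⁿ≈1 = begin
        (ζ ^ d) ^ n     ≈⟨ ^-assocʳ ζ d n ⟩
        ζ ^ (d ℕ.* n)   ≈⟨ reflexive (≡.cong (ζ ^_) (ℕ.*-comm d n)) ⟩
        ζ ^ (n ℕ.* d)   ≈⟨ ^-assocʳ ζ n d ⟨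
        (ζ ^ n) ^ d     ≈⟨ ^-congˡ d rootⁿ≈1 ⟩
        1# ^ d          ≈⟨ 1^m≈1 d ⟩
        1#              ∎
      S≈x*S : S ≈ x * S
      S≈x*S = +-cancelˡ 1# S (x * S) (trans (+-comm 1# S) (trans (+-congˡ (sym xⁿ≈1)) (geometric-sum x n)))
      x-1*S≈0 : (x - 1#) * S ≈ 0#
      x-1*S≈0 = begin
        (x - 1#) * S        ≈⟨ distribʳ S x (- 1#) ⟩
        x * S + - 1# * S    ≈⟨ +-cong (sym S≈x*S) (-1*x≈-x S) ⟩
        S - S               ≈⟨ -‿inverseʳ S ⟩
        0#                  ∎

    root^% : ∀ m → ζ ^ (m % n) ≈ ζ ^ m
    root^% m = sym (begin
      ζ ^ m                                   ≡⟨ ≡.cong (ζ ^_) (≡.trans (m≡m%n+[m/n]*n m n) (≡.cong (m % n ℕ.+_) (ℕ.*-comm (m / n) n))) ⟩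
      ζ ^ (m % n ℕ.+ n ℕ.* (m / n))           ≈⟨ ^-homo-* ζ (m % n) (n ℕ.* (m / n)) ⟩
      ζ ^ (m % n) * ζ ^ (n ℕ.* (m / n))       ≈⟨ *-congˡ (^-assocʳ ζ n (m / n)) ⟨
      ζ ^ (m % n) * (ζ ^ n) ^ (m / n)         ≈⟨ *-congˡ (trans (^-congˡ (m / n) rootⁿ≈1) (1^m≈1 (m / n))) ⟩
      ζ ^ (m % n) * 1#                        ≈⟨ *-identityʳ (ζ ^ (m % n)) ⟩
      ζ ^ (m % n)                             ∎)

    -- Exponents may be reduced mod n, and ζ ^ (n - i) is the conjugate of ζ ^ i, as both are
    -- inverse to it.
    root^⊖ : ∀ i j → ζ ^ toℕ (j ⊖ i) ≈ ζ ^ toℕ j * conj (ζ ^ toℕ i)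
    root^⊖ i j = begin
      ζ ^ toℕ (j ⊖ i)                        ≡⟨ ≡.cong (ζ ^_) (Fin.toℕ-fromℕ< (m%n<n (toℕ j ℕ.+ (n ℕ.∸ toℕ i)) n)) ⟩
      ζ ^ ((toℕ j ℕ.+ (n ℕ.∸ toℕ i)) % n)    ≈⟨ root^% (toℕ j ℕ.+ (n ℕ.∸ toℕ i)) ⟩
      ζ ^ (toℕ j ℕ.+ (n ℕ.∸ toℕ i))          ≈⟨ ^-homo-* ζ (toℕ j) (n ℕ.∸ toℕ i) ⟩
      ζ ^ toℕ j * ζ ^ (n ℕ.∸ toℕ i)          ≈⟨ *-congˡ inv ⟩
      ζ ^ toℕ j * conj (ζ ^ toℕ i)           ∎
      where
      x = ζ ^ toℕ i
      u = ζ ^ (n ℕ.∸ toℕ i)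
      inv : u ≈ conj x
      inv = begin
        u                    ≈⟨ *-identityʳ u ⟨
        u * 1#               ≈⟨ *-congˡ (unimodular-^ root-unimodular (toℕ i)) ⟨
        u * (x * conj x)     ≈⟨ *-assoc u x (conj x) ⟨
        u * x * conj x       ≈⟨ *-congʳ (^-homo-* ζ (n ℕ.∸ toℕ i) (toℕ i)) ⟨
        ζ ^ (n ℕ.∸ toℕ i ℕ.+ toℕ i) * conj x  ≈⟨ *-congʳ (trans (reflexive (≡.cong (ζ ^_) (ℕ.m∸n+n≡m (ℕ.<⇒≤ (Fin.toℕ<n i))))) rootⁿ≈1) ⟩
        1# * conj x          ≈⟨ *-identityˡ (conj x) ⟩
        conj x               ∎

    -- If i ≤ j, the reduced difference is j - i. If j < i, then j + (n - i) is below n already and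
    -- positive.
    ⊖-zero : ∀ i j → toℕ (j ⊖ i) ≡ 0 → i ≡ j
    ⊖-zero i j eq with ℕ.≤-<-connex (toℕ i) (toℕ j)
    ... | inj₁ i≤j = Fin.toℕ-injective (ℕ.≤-antisym i≤j (ℕ.m∸n≡0⇒m≤n (≡.trans (≡.sym j⊖i) eq)))
      where
      j⊖i : toℕ (j ⊖ i) ≡ toℕ j ℕ.∸ toℕ i
      j⊖i = ≡.trans (Fin.toℕ-fromℕ< _) (≡.trans (≡.cong (_% n) shift)
        (≡.trans ([m+n]%n≡m%n (toℕ j ℕ.∸ toℕ i) n) (m<n⇒m%n≡m (ℕ.≤-<-trans (ℕ.m∸n≤m (toℕ j) (toℕ i)) (Fin.toℕ<n j)))))
        where
        shift : toℕ j ℕ.+ (n ℕ.∸ toℕ i) ≡ toℕ j ℕ.∸ toℕ i ℕ.+ n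
        shift = ≡.trans (≡.sym (ℕ.+-∸-assoc (toℕ j) (ℕ.<⇒≤ (Fin.toℕ<n i)))) (ℕ.+-∸-comm n i≤j)
    ... | inj₂ j<i = contradiction
      (≡.trans (≡.sym (≡.trans (Fin.toℕ-fromℕ< _) (m<n⇒m%n≡m small))) eq)
      (ℕ.>⇒≢ (ℕ.<-≤-trans (ℕ.m<n⇒0<n∸m (Fin.toℕ<n i)) (ℕ.m≤n+m (n ℕ.∸ toℕ i) (toℕ j))))
      where
      small : toℕ j ℕ.+ (n ℕ.∸ toℕ i) ℕ.< n
      small = ≡.subst (toℕ j ℕ.+ (n ℕ.∸ toℕ i) ℕ.<_) (ℕ.m+[n∸m]≡n (ℕ.<⇒≤ (Fin.toℕ<n i)))
        (ℕ.+-monoˡ-< (n ℕ.∸ toℕ i) j<i)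

    ⊖-self : ∀ i → toℕ (i ⊖ i) ≡ 0
    ⊖-self i = ≡.trans (Fin.toℕ-fromℕ< _) (≡.trans (≡.cong (_% n) (ℕ.m+[n∸m]≡n (ℕ.<⇒≤ (Fin.toℕ<n i)))) (n%n≡0 n))

    -- The powers in the entries of F are given by a sequence `p` that agrees with those of ζ up to
    -- `≈`, so that another implementation of powers fits.
    module _ {F G : Matrix n} {p : ℕ → Carrier} (p≈ : ∀ m → p m ≈ ζ ^ m)
             (F≈p : ∀ i j → F i j ≈ r * p (toℕ i ℕ.* toℕ j)) (G≈ : ∀ i j → conj (F i j) ≈ G i j) where

      F≈ : ∀ i j → F i j ≈ r * ζ ^ (toℕ i ℕ.* toℕ j)
      F≈ i j = trans (F≈p i j) (*-congˡ (p≈ (toℕ i ℕ.* toℕ j)))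

      root-difference : ∀ i j a → F i a * G j a ≈ r * G (j ⊖ i) a
      root-difference i j a = begin
        F i a * G j a                                      ≈⟨ *-cong (F≈ i a) (sym (G≈ j a)) ⟩
        r * ζ ^ (toℕ i ℕ.* toℕ a) * conj (F j a)           ≈⟨ *-congˡ (conj-F j a) ⟩
        r * ζ ^ (toℕ i ℕ.* toℕ a) * (r * conj (ζ ^ (toℕ j ℕ.* toℕ a)))
          ≈⟨ *-assoc r _ _ ⟩
        r * (ζ ^ (toℕ i ℕ.* toℕ a) * (r * conj (ζ ^ (toℕ j ℕ.* toℕ a))))
          ≈⟨ *-congˡ (x∙yz≈y∙xz _ r _) ⟩
        r * (r * (ζ ^ (toℕ i ℕ.* toℕ a) * conj (ζ ^ (toℕ j ℕ.* toℕ a))))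
          ≈⟨ *-congˡ (*-congˡ (trans (*-comm _ _) (trans (*-congˡ (sym (conj-conj _))) (trans (sym (conj-* _ _)) (conj-cong powers))))) ⟩
        r * (r * conj (ζ ^ (toℕ (j ⊖ i) ℕ.* toℕ a)))       ≈⟨ *-congˡ (conj-F (j ⊖ i) a) ⟨
        r * conj (F (j ⊖ i) a)                             ≈⟨ *-congˡ (G≈ (j ⊖ i) a) ⟩
        r * G (j ⊖ i) a                                    ∎
        where
        conj-F : ∀ j a → conj (F j a) ≈ r * conj (ζ ^ (toℕ j ℕ.* toℕ a))
        conj-F j a = trans (conj-cong (F≈ j a)) (trans (conj-* r _) (*-congʳ r-real))
        m = toℕ a
        powers : ζ ^ (toℕ j ℕ.* m) * conj (ζ ^ (toℕ i ℕ.* m)) ≈ ζ ^ (toℕ (j ⊖ i) ℕ.* m)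
        powers = begin
          ζ ^ (toℕ j ℕ.* m) * conj (ζ ^ (toℕ i ℕ.* m))  ≈⟨ *-cong (sym (^-assocʳ ζ (toℕ j) m)) (trans (conj-cong (sym (^-assocʳ ζ (toℕ i) m))) (conj-^ (ζ ^ toℕ i) m)) ⟩
          (ζ ^ toℕ j) ^ m * conj (ζ ^ toℕ i) ^ m        ≈⟨ ^-distrib-* (ζ ^ toℕ j) (conj (ζ ^ toℕ i)) m ⟨
          (ζ ^ toℕ j * conj (ζ ^ toℕ i)) ^ m            ≈⟨ ^-congˡ m (root^⊖ i j) ⟨
          (ζ ^ toℕ (j ⊖ i)) ^ m                         ≈⟨ ^-assocʳ ζ (toℕ (j ⊖ i)) m ⟩
          ζ ^ (toℕ (j ⊖ i) ℕ.* m)                       ∎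

      row-sum : ∀ d → sum (λ k → F d k) ≈ r * sum {n} (λ k → (ζ ^ toℕ d) ^ toℕ k)
      row-sum d = trans
        (sum-cong {n} λ k → trans (F≈ d k) (*-congˡ (sym (^-assocʳ ζ (toℕ d) (toℕ k)))))
        (sym (*-distribˡ-sum {n} r (λ k → (ζ ^ toℕ d) ^ toℕ k)))

      -- By `root-difference` the inner product of two rows is r times the conjugate of the sum of
      -- the single row j ⊖ i. That sum is r n = s for the row 0 and vanishes for the others.
      row-orthogonality : F *ᴹ adjoint F ≈ᴹ identity
      row-orthogonality i j = begin
        sum (λ k → F i k * conj (F j k))    ≈⟨ sum-cong (λ k → *-congˡ (G≈ j k)) ⟩
        sum (λ k → F i k * G j k)           ≈⟨ sum-cong (root-difference i j) ⟩
        sum (λ k → r * G (j ⊖ i) k)         ≈⟨ *-distribˡ-sum r (G (j ⊖ i)) ⟨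
        r * sum (λ k → G (j ⊖ i) k)         ≈⟨ *-congˡ (sum-cong (λ k → G≈ (j ⊖ i) k)) ⟨
        r * sum (λ k → conj (F (j ⊖ i) k))  ≈⟨ *-congˡ (conj-sum (F (j ⊖ i))) ⟨
        r * conj (sum (F (j ⊖ i)))          ≈⟨ *-congˡ (conj-cong (row-sum (j ⊖ i))) ⟩
        r * conj (r * S (toℕ (j ⊖ i)))      ≈⟨ value ⟩
        identity i j                        ∎
        where
        S : ℕ → Carrier
        S d = sum {n} (λ k → (ζ ^ d) ^ toℕ k)
        r*s≈1 : r * s ≈ 1#
        r*s≈1 = trans (*-comm r s) s*r≈1
        S0≈n : S 0 ≈ n · 1#
        S0≈n = trans (sum-cong {n} (λ k → 1^m≈1 (toℕ k))) (sum-replicate n)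
        value : r * conj (r * S (toℕ (j ⊖ i))) ≈ identity i j
        value with i Fin.≟ j
        ... | yes ≡.refl = begin
          r * conj (r * S (toℕ (i ⊖ i)))    ≈⟨ *-congˡ (conj-cong (*-congˡ (trans (reflexive (≡.cong S (⊖-self i))) (trans S0≈n (sym s*s≈n))))) ⟩
          r * conj (r * (s * s))            ≈⟨ *-congˡ (conj-cong (trans (sym (*-assoc r s s)) (trans (*-congʳ r*s≈1) (*-identityˡ s)))) ⟩
          r * conj s                        ≈⟨ *-congʳ r-real ⟨
          conj r * conj s                   ≈⟨ conj-* r s ⟨
          conj (r * s)                      ≈⟨ trans (conj-cong r*s≈1) conj-1# ⟩
          1#                                ∎
        ... | no i≢j = trans (*-congˡ (trans (conj-cong (trans (*-congˡ (root-sum d 0<d (Fin.toℕ<n (j ⊖ i)))) (zeroʳ r))) conj-0#)) (zeroʳ r)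
          where
          d = toℕ (j ⊖ i)
          0<d : 0 ℕ.< d
          0<d = ℕ.n≢0⇒n>0 λ d≡0 → i≢j (⊖-zero i j d≡0)

      root-table : IsCharacterTable n s r F G
      root-table = record
        { s*r≈1      = s*r≈1
        ; symmetric  = λ i j → trans (F≈ i j) (trans (*-congˡ (reflexive (≡.cong (ζ ^_) (ℕ.*-comm (toℕ i) (toℕ j))))) (sym (F≈ j i)))
        ; conjugate  = G≈
        ; unitary    = row-orthogonality
        ; difference = root-difference
        }

-- The Cauchy product and its error

module CauchyProduct {c ℓ} (R : CommutativeRing c ℓ) where
  open CommutativeRing R hiding (zero)
  open SetoidReasoning setoid
  open SemiringSolver commutativeSemiring using (solve; _:=_; _:+_; _:*_)

  -- Terms are added at the end, as in `expSum`.
  partial : (ℕ → Carrier) → ℕ → Carrier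
  partial f zero    = 0#
  partial f (suc n) = partial f n + f n

  -- The n-th coefficient Σ f i · g (n - i) of a product of power series. Shifting f avoids
  -- subtraction of indices.
  convolution : (ℕ → Carrier) → (ℕ → Carrier) → ℕ → Carrier
  convolution f g zero    = f 0 * g 0
  convolution f g (suc n) = f 0 * g (suc n) + convolution (f ∘ suc) g n

  partial-cong : ∀ {f g} → (∀ n → f n ≈ g n) → ∀ n → partial f n ≈ partial g n
  partial-cong h zero    = refl
  partial-cong h (suc n) = +-cong (partial-cong h n) (h n)

  partial-suc : ∀ f n → partial f (suc n) ≈ f 0 + partial (f ∘ suc) n
  partial-suc f zero    = +-comm 0# (f 0)
  partial-suc f (suc n) = trans (+-congʳ (partial-suc f n)) (+-assoc (f 0) _ _)

  partial-+ : ∀ f g n → partial (λ i → f i + g i) n ≈ partial f n + partial g n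
  partial-+ f g zero    = sym (+-identityˡ 0#)
  partial-+ f g (suc n) = trans (+-congʳ (partial-+ f g n))
    (solve 4 (λ a b c d → (a :+ b) :+ (c :+ d) := (a :+ c) :+ (b :+ d)) refl (partial f n) (partial g n) (f n) (g n))

  partial-* : ∀ x f n → partial (λ i → x * f i) n ≈ x * partial f n
  partial-* x f zero    = sym (zeroʳ x)
  partial-* x f (suc n) = trans (+-congʳ (partial-* x f n)) (sym (distribˡ x (partial f n) (f n)))

  convolution-cong : ∀ {f f′ g g′} → (∀ i → f i ≈ f′ i) → (∀ i → g i ≈ g′ i) →
                     ∀ n → convolution f g n ≈ convolution f′ g′ n
  convolution-cong p q zero    = *-cong (p 0) (q 0)
  convolution-cong p q (suc n) = +-cong (*-cong (p 0) (q (suc n))) (convolution-cong (p ∘ suc) q n)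

  convolution-+ : ∀ f g h n → convolution (λ i → f i + g i) h n ≈ convolution f h n + convolution g h n
  convolution-+ f g h zero    = distribʳ (h 0) (f 0) (g 0)
  convolution-+ f g h (suc n) = trans (+-congˡ (convolution-+ (f ∘ suc) (g ∘ suc) h n))
    (solve 5 (λ a b c x y → (a :+ b) :* c :+ (x :+ y) := (a :* c :+ x) :+ (b :* c :+ y)) refl
      (f 0) (g 0) (h (suc n)) (convolution (f ∘ suc) h n) (convolution (g ∘ suc) h n))

  convolution-*ˡ : ∀ x f g n → convolution (λ i → x * f i) g n ≈ x * convolution f g n
  convolution-*ˡ x f g zero    = *-assoc x (f 0) (g 0)
  convolution-*ˡ x f g (suc n) = trans (+-congˡ (convolution-*ˡ x (f ∘ suc) g n))
    (solve 4 (λ x a b c → x :* a :* b :+ x :* c := x :* (a :* b :+ c)) refl x (f 0) (g (suc n)) (convolution (f ∘ suc) g n))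

  convolution-*ʳ : ∀ x f g n → convolution f (λ i → x * g i) n ≈ x * convolution f g n
  convolution-*ʳ x f g zero    = solve 3 (λ x a b → a :* (x :* b) := x :* (a :* b)) refl x (f 0) (g 0)
  convolution-*ʳ x f g (suc n) = trans (+-congˡ (convolution-*ʳ x (f ∘ suc) g n))
    (solve 4 (λ x a b c → a :* (x :* b) :+ x :* c := x :* (a :* b :+ c)) refl x (f 0) (g (suc n)) (convolution (f ∘ suc) g n))

  -- The mirror image of the defining recursion, for use where g is to be shifted.
  convolution-suc : ∀ f g n → convolution f g (suc n) ≈ convolution f (g ∘ suc) n + f (suc n) * g 0
  convolution-suc f g zero    = refl
  convolution-suc f g (suc n) = trans (+-congˡ (convolution-suc (f ∘ suc) g n)) (sym (+-assoc _ _ _))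

  -- The triangle i + j ≤ n is cut into the column i = 0 and a smaller triangle for the shifted f.
  triangle-suc : ∀ f g n → partial (convolution f g) (suc n) ≈
                           f 0 * partial g (suc n) + partial (convolution (f ∘ suc) g) n
  triangle-suc f g n = begin
    partial (convolution f g) (suc n)
      ≈⟨ partial-suc (convolution f g) n ⟩
    f 0 * g 0 + partial (λ m → f 0 * g (suc m) + convolution (f ∘ suc) g m) n
      ≈⟨ +-congˡ (partial-+ (λ m → f 0 * g (suc m)) (convolution (f ∘ suc) g) n) ⟩
    f 0 * g 0 + (partial (λ m → f 0 * g (suc m)) n + T)
      ≈⟨ +-congˡ (+-congʳ (partial-* (f 0) (g ∘ suc) n)) ⟩
    f 0 * g 0 + (f 0 * partial (g ∘ suc) n + T)
      ≈⟨ solve 4 (λ a b c d → a :* b :+ (a :* c :+ d) := a :* (b :+ c) :+ d) refl (f 0) (g 0) (partial (g ∘ suc) n) T ⟩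
    f 0 * (g 0 + partial (g ∘ suc) n) + T
      ≈⟨ +-congʳ (*-congˡ (partial-suc g n)) ⟨
    f 0 * partial g (suc n) + T ∎
    where T = partial (convolution (f ∘ suc) g) n

  -- `ν` embeds ℕ, and `ν⁻¹ n` is the inverse of n + 1. The terms in ℚ[i] and their majorants in ℚ
  -- are both instances.
  module Exponential (ν ν⁻¹ : ℕ → Carrier) (ν-zero : ν 0 ≈ 0#) (ν-suc : ∀ n → ν (suc n) ≈ 1# + ν n)
           (ν⁻¹*ν≈1 : ∀ n → ν⁻¹ n * ν (suc n) ≈ 1#) where

    -- The sequence zⁱ / i!.
    record IsExponential (z : Carrier) (f : ℕ → Carrier) : Set ℓ where
      field
        at-zero : f 0 ≈ 1#
        at-suc  : ∀ i → ν (suc i) * f (suc i) ≈ z * f i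

    open IsExponential

    -- The recursion determines the sequence since n + 1 is invertible. This takes the place of the
    -- binomial theorem: a Cauchy product of exponential series is identified by its recursion.
    exponential-unique : ∀ {z f g} → IsExponential z f → IsExponential z g → ∀ n → f n ≈ g n
    exponential-unique F G zero    = trans (at-zero F) (sym (at-zero G))
    exponential-unique {z} {f} {g} F G (suc n) = begin
      f (suc n)                          ≈⟨ ν-cancel (f (suc n)) ⟨
      ν⁻¹ n * (ν (suc n) * f (suc n))    ≈⟨ *-congˡ (trans (at-suc F n) (trans (*-congˡ (exponential-unique F G n)) (sym (at-suc G n)))) ⟩
      ν⁻¹ n * (ν (suc n) * g (suc n))    ≈⟨ ν-cancel (g (suc n)) ⟩
      g (suc n)                          ∎
      where
      ν-cancel : ∀ x → ν⁻¹ n * (ν (suc n) * x) ≈ x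
      ν-cancel x = trans (sym (*-assoc _ _ x)) (trans (*-congʳ (ν⁻¹*ν≈1 n)) (*-identityˡ x))

    -- The Leibniz rule for the derivation f ↦ (i · f i) of power series.
    leibniz : ∀ f g n → convolution (λ i → ν i * f i) g n + convolution f (λ i → ν i * g i) n ≈ ν n * convolution f g n
    leibniz f g zero = begin
      ν 0 * f 0 * g 0 + f 0 * (ν 0 * g 0)   ≈⟨ +-cong (*-congʳ (*-congʳ ν-zero)) (*-congˡ (*-congʳ ν-zero)) ⟩
      0# * f 0 * g 0 + f 0 * (0# * g 0)     ≈⟨ +-cong (trans (*-congʳ (zeroˡ (f 0))) (zeroˡ (g 0))) (trans (*-congˡ (zeroˡ (g 0))) (zeroʳ (f 0))) ⟩
      0# + 0#                               ≈⟨ +-identityˡ 0# ⟩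
      0#                                    ≈⟨ zeroˡ (f 0 * g 0) ⟨
      0# * (f 0 * g 0)                      ≈⟨ *-congʳ ν-zero ⟨
      ν 0 * (f 0 * g 0)                     ∎
    leibniz f g (suc n) = begin
      ν 0 * f 0 * b + convolution (λ i → ν (suc i) * f′ i) g n + (f 0 * (ν (suc n) * b) + Y)
        ≈⟨ +-congʳ (+-cong (trans (*-congʳ (trans (*-congʳ ν-zero) (zeroˡ (f 0)))) (zeroˡ b)) (convolution-cong {g = g} split (λ _ → refl) n)) ⟩
      0# + convolution (λ i → f′ i + ν i * f′ i) g n + (f 0 * (ν (suc n) * b) + Y)
        ≈⟨ +-congʳ (trans (+-identityˡ _) (convolution-+ f′ (λ i → ν i * f′ i) g n)) ⟩
      C + X + (f 0 * (ν (suc n) * b) + Y)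
        ≈⟨ solve 6 (λ C X a v b Y → C :+ X :+ (a :* (v :* b) :+ Y) := v :* (a :* b) :+ (C :+ (X :+ Y))) refl C X (f 0) (ν (suc n)) b Y ⟩
      ν (suc n) * (f 0 * b) + (C + (X + Y))
        ≈⟨ +-congˡ (+-cong (sym (*-identityˡ C)) (leibniz f′ g n)) ⟩
      ν (suc n) * (f 0 * b) + (1# * C + ν n * C)
        ≈⟨ +-congˡ (trans (sym (distribʳ C 1# (ν n))) (*-congʳ (sym (ν-suc n)))) ⟩
      ν (suc n) * (f 0 * b) + ν (suc n) * C
        ≈⟨ distribˡ (ν (suc n)) (f 0 * b) C ⟨
      ν (suc n) * (f 0 * b + C) ∎
      where
      f′ = f ∘ suc
      b = g (suc n)
      C = convolution f′ g n
      X = convolution (λ i → ν i * f′ i) g n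
      Y = convolution f′ (λ i → ν i * g i) n
      split : ∀ i → ν (suc i) * f′ i ≈ f′ i + ν i * f′ i
      split i = trans (*-congʳ (ν-suc i)) (trans (distribʳ (f′ i) 1# (ν i)) (+-congʳ (*-identityˡ (f′ i))))

    -- In `leibniz` at n + 1 the terms with factor `ν 0` vanish; after the shift by one, the
    -- recursions of f and g pull out z and w.
    exponential-convolution : ∀ {z w f g} → IsExponential z f → IsExponential w g →
                              IsExponential (z + w) (convolution f g)
    exponential-convolution {z} {w} {f} {g} F G = record
      { at-zero = trans (*-cong (at-zero F) (at-zero G)) (*-identityˡ 1#)
      ; at-suc  = λ n → begin
          ν (suc n) * convolution f g (suc n)
            ≈⟨ leibniz f g (suc n) ⟨
          (νf 0 * g (suc n) + convolution (νf ∘ suc) g n) + convolution f νg (suc n)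
            ≈⟨ +-congˡ (convolution-suc f νg n) ⟩
          (νf 0 * g (suc n) + convolution (νf ∘ suc) g n) + (convolution f (νg ∘ suc) n + f (suc n) * νg 0)
            ≈⟨ +-cong (+-cong (trans (*-congʳ (ν0* (f 0))) (zeroˡ _)) (trans (convolution-cong {g = g} (at-suc F) (λ _ → refl) n) (convolution-*ˡ z f g n)))
                      (+-cong (trans (convolution-cong {f = f} (λ _ → refl) (at-suc G) n) (convolution-*ʳ w f g n)) (trans (*-congˡ (ν0* (g 0))) (zeroʳ _))) ⟩
          (0# + z * C n) + (w * C n + 0#)
            ≈⟨ +-cong (+-identityˡ _) (+-identityʳ _) ⟩
          z * C n + w * C n
            ≈⟨ distribʳ (C n) z w ⟨
          (z + w) * C n ∎
      }
      where
      C = convolution f g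
      νf νg : ℕ → Carrier
      νf i = ν i * f i
      νg i = ν i * g i
      ν0* : ∀ x → ν 0 * x ≈ 0#
      ν0* x = trans (*-congʳ ν-zero) (zeroˡ x)

-- Majorants and the error of the Cauchy product

module Majorant {c ℓ} (R : CommutativeRing c ℓ) (norm : CommutativeRing.Carrier R → ℚ)
  (norm-cong : ∀ {x y} → CommutativeRing._≈_ R x y → norm x ≡ norm y)
  (norm-0 : norm (CommutativeRing.0# R) ≡ 0ℚ)
  (norm-+ : ∀ x y → norm (CommutativeRing._+_ R x y) ℚ.≤ norm x ℚ.+ norm y)
  (norm-* : ∀ x y → norm (CommutativeRing._*_ R x y) ℚ.≤ norm x ℚ.* norm y)
  (0≤norm : ∀ x → 0ℚ ℚ.≤ norm x) where

  open CommutativeRing R hiding (zero)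
  open RingProperties ring using (-‿distribʳ-*; -‿+-comm)
  open SemiringSolver commutativeSemiring using (solve; _:=_; _:+_; _:*_)
  open CauchyProduct R
  open +-*-Solver using () renaming (solve to ℚsolve; _:=_ to _⊜_; _:+_ to _⊕_; _:*_ to _⊗_; _:-_ to _⊝_)
  module M = CauchyProduct ℚ.+-*-commutativeRing

  -- A tail is bounded by the tail of the majorant. The initial sum of G stands on the left, so that
  -- the induction only adds.
  partial-difference : ∀ {g G} → (∀ i → norm (g i) ℚ.≤ G i) → ∀ {m n} → m ℕ.≤ n →
    norm (partial g n - partial g m) ℚ.+ M.partial G m ℚ.≤ M.partial G n
  partial-difference {g} {G} g≤G {m} {n} m≤n =
    ≡.subst (λ n → norm (partial g n - partial g m) ℚ.+ M.partial G m ℚ.≤ M.partial G n) (ℕ.m∸n+n≡m m≤n) (go (n ℕ.∸ m))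
    where
    open ℚ.≤-Reasoning
    go : ∀ d → norm (partial g (d ℕ.+ m) - partial g m) ℚ.+ M.partial G m ℚ.≤ M.partial G (d ℕ.+ m)
    go zero = ℚ.≤-reflexive (≡.trans
      (≡.cong (ℚ._+ M.partial G m) (≡.trans (norm-cong (-‿inverseʳ (partial g m))) norm-0))
      (ℚ.+-identityˡ (M.partial G m)))
    go (suc d) = begin
      norm (a + x - b) ℚ.+ B              ≡⟨ ≡.cong (ℚ._+ B) (norm-cong (trans (+-assoc a x (- b)) (trans (+-congˡ (+-comm x (- b))) (sym (+-assoc a (- b) x))))) ⟩
      norm (a - b + x) ℚ.+ B              ≤⟨ ℚ.+-monoˡ-≤ B (ℚ.≤-trans (norm-+ (a - b) x) (ℚ.+-monoʳ-≤ (norm (a - b)) (g≤G (d ℕ.+ m)))) ⟩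
      norm (a - b) ℚ.+ X ℚ.+ B            ≡⟨ ℚsolve 3 (λ n x b → n ⊕ x ⊕ b ⊜ n ⊕ b ⊕ x) ≡.refl (norm (a - b)) X B ⟩
      norm (a - b) ℚ.+ B ℚ.+ X            ≤⟨ ℚ.+-monoˡ-≤ X (go d) ⟩
      M.partial G (suc d ℕ.+ m)           ∎
      where
      a = partial g (d ℕ.+ m)
      b = partial g m
      x = g (d ℕ.+ m)
      B = M.partial G m
      X = G (d ℕ.+ m)

  -- The products of terms in the square that lie outside of the triangle are
  -- bounded by those of the majorants.
  square-triangle : ∀ {f g F G} → (∀ i → norm (f i) ℚ.≤ F i) → (∀ i → norm (g i) ℚ.≤ G i) → ∀ {m n} → m ℕ.≤ n →
    norm (partial f m * partial g n - partial (convolution f g) m) ℚ.+ M.partial (M.convolution F G) m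
      ℚ.≤ M.partial F m ℚ.* M.partial G n
  square-triangle {f} {g} {F} {G} f≤F g≤G {zero} {n} _ = ℚ.≤-reflexive (≡.trans
    (≡.cong (ℚ._+ 0ℚ) (≡.trans (norm-cong (trans (+-congʳ (zeroˡ (partial g n))) (-‿inverseʳ 0#))) norm-0))
    (≡.sym (ℚ.*-zeroˡ (M.partial G n))))
  square-triangle {f} {g} {F} {G} f≤F g≤G {suc m} {n} m<n = begin
    norm (partial f (suc m) * Sg n - partial (convolution f g) (suc m)) ℚ.+ M.partial (M.convolution F G) (suc m)
      ≡⟨ ≡.cong₂ ℚ._+_ (norm-cong split) (M.triangle-suc F G m) ⟩
    norm (f 0 * Δ + D) ℚ.+ (F 0 ℚ.* SG (suc m) ℚ.+ T′)
      ≤⟨ ℚ.+-monoˡ-≤ (F 0 ℚ.* SG (suc m) ℚ.+ T′) (ℚ.≤-trans (norm-+ (f 0 * Δ) D) (ℚ.+-monoˡ-≤ (norm D)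
          (ℚ.≤-trans (norm-* (f 0) Δ) (ℚ.*-monoʳ-≤-nonNeg (norm Δ) {{ℚ.nonNegative (0≤norm Δ)}} (f≤F 0))))) ⟩
    F 0 ℚ.* norm Δ ℚ.+ norm D ℚ.+ (F 0 ℚ.* SG (suc m) ℚ.+ T′)
      ≡⟨ ℚsolve 5 (λ a b c d e → a ⊗ b ⊕ c ⊕ (a ⊗ d ⊕ e) ⊜ a ⊗ (b ⊕ d) ⊕ (c ⊕ e)) ≡.refl (F 0) (norm Δ) (norm D) (SG (suc m)) T′ ⟩
    F 0 ℚ.* (norm Δ ℚ.+ SG (suc m)) ℚ.+ (norm D ℚ.+ T′)
      ≤⟨ ℚ.+-mono-≤ (ℚ.*-monoˡ-≤-nonNeg (F 0) {{ℚ.nonNegative (ℚ.≤-trans (0≤norm (f 0)) (f≤F 0))}} (partial-difference g≤G m<n))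
                    (square-triangle (λ i → f≤F (suc i)) g≤G (ℕ.<⇒≤ m<n)) ⟩
    F 0 ℚ.* SG n ℚ.+ M.partial F′ m ℚ.* SG n
      ≡⟨ ℚ.*-distribʳ-+ (SG n) (F 0) (M.partial F′ m) ⟨
    (F 0 ℚ.+ M.partial F′ m) ℚ.* SG n
      ≡⟨ ≡.cong (ℚ._* SG n) (M.partial-suc F m) ⟨
    M.partial F (suc m) ℚ.* SG n ∎
    where
    open ℚ.≤-Reasoning
    f′ = f ∘ suc
    F′ = F ∘ suc
    Sg = partial g
    SG = M.partial G
    Δ = Sg n - Sg (suc m)
    T = partial (convolution f′ g) m
    T′ = M.partial (M.convolution F′ G) m
    D = partial f′ m * Sg n - T
    -- In the column i = 0 the square exceeds the triangle by f 0 · Δ; what remains is the same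
    -- difference for the shifted f.
    split : partial f (suc m) * Sg n - partial (convolution f g) (suc m) ≈ f 0 * Δ + D
    split = trans
      (+-cong (*-congʳ (partial-suc f m)) (trans (-‿cong (triangle-suc f g m))
        (trans (sym (-‿+-comm (f 0 * Sg (suc m)) T)) (+-congʳ (-‿distribʳ-* (f 0) (Sg (suc m)))))))
      (solve 5 (λ a b c d e → (a :+ b) :* c :+ (a :* d :+ e) := a :* (c :+ d) :+ (b :* c :+ e)) refl
        (f 0) (partial f′ m) (Sg n) (- Sg (suc m)) (- T))

  module _ {G : ℕ → ℚ} (0≤G : ∀ i → 0ℚ ℚ.≤ G i) where

    0≤partial : ∀ n → 0ℚ ℚ.≤ M.partial G n
    0≤partial zero    = ℚ.≤-refl
    0≤partial (suc n) = ℚ.+-mono-≤ (0≤partial n) (0≤G n)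

    partial-mono : ∀ {m n} → m ℕ.≤ n → M.partial G m ℚ.≤ M.partial G n
    partial-mono {m} {n} m≤n = ≡.subst (λ n → M.partial G m ℚ.≤ M.partial G n) (ℕ.m∸n+n≡m m≤n) (go (n ℕ.∸ m))
      where
      go : ∀ d → M.partial G m ℚ.≤ M.partial G (d ℕ.+ m)
      go zero    = ℚ.≤-refl
      go (suc d) = ℚ.≤-trans (go d) (p≤p+q (0≤G (d ℕ.+ m)))

    0≤convolution : ∀ {F} → (∀ i → 0ℚ ℚ.≤ F i) → ∀ n → 0ℚ ℚ.≤ M.convolution F G n
    0≤convolution 0≤F zero    = 0≤* (0≤F 0) (0≤G 0)
    0≤convolution 0≤F (suc n) = ℚ.+-mono-≤ (0≤* (0≤F 0) (0≤G (suc n))) (0≤convolution (λ i → 0≤F (suc i)) n)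

  -- The rectangle i < m, j < n lies in the triangle i + j < m + n, and all products are
  -- nonnegative.
  square≤triangle : ∀ {F G} → (∀ i → 0ℚ ℚ.≤ F i) → (∀ i → 0ℚ ℚ.≤ G i) → ∀ m n →
    M.partial F m ℚ.* M.partial G n ℚ.≤ M.partial (M.convolution F G) (m ℕ.+ n)
  square≤triangle {F} {G} 0≤F 0≤G zero n = ℚ.≤-trans (ℚ.≤-reflexive (ℚ.*-zeroˡ (M.partial G n))) (0≤partial (0≤convolution 0≤G 0≤F) n)
  square≤triangle {F} {G} 0≤F 0≤G (suc m) n = begin
    M.partial F (suc m) ℚ.* SG n
      ≡⟨ ≡.cong (ℚ._* SG n) (M.partial-suc F m) ⟩
    (F 0 ℚ.+ M.partial F′ m) ℚ.* SG n
      ≡⟨ ℚ.*-distribʳ-+ (SG n) (F 0) (M.partial F′ m) ⟩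
    F 0 ℚ.* SG n ℚ.+ M.partial F′ m ℚ.* SG n
      ≤⟨ ℚ.+-mono-≤ (ℚ.*-monoˡ-≤-nonNeg (F 0) {{ℚ.nonNegative (0≤F 0)}} (partial-mono 0≤G (ℕ.m≤n+m n (suc m))))
                    (square≤triangle (λ i → 0≤F (suc i)) 0≤G m n) ⟩
    F 0 ℚ.* SG (suc m ℕ.+ n) ℚ.+ M.partial (M.convolution F′ G) (m ℕ.+ n)
      ≡⟨ M.triangle-suc F G (m ℕ.+ n) ⟨
    M.partial (M.convolution F G) (suc m ℕ.+ n) ∎
    where
    open ℚ.≤-Reasoning
    F′ = F ∘ suc
    SG = M.partial G

  -- The products outside the triangle of size n still lie in that of size 2n, so the error is at
  -- most a section of the product series of the majorants, which is small once that series
  -- converges.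
  product-error : ∀ {f g F G} → (∀ i → norm (f i) ℚ.≤ F i) → (∀ i → norm (g i) ℚ.≤ G i) → ∀ n →
    norm (partial f n * partial g n - partial (convolution f g) n) ℚ.≤
      M.partial (M.convolution F G) (n ℕ.+ n) ℚ.- M.partial (M.convolution F G) n
  product-error {f} {g} {F} {G} f≤F g≤G n = begin
    e              ≡⟨ ℚsolve 2 (λ e t → e ⊜ e ⊕ t ⊝ t) ≡.refl e T ⟩
    e ℚ.+ T ℚ.- T  ≤⟨ ℚ.+-monoˡ-≤ (ℚ.- T) (ℚ.≤-trans (square-triangle f≤F g≤G {n} ℕ.≤-refl) (square≤triangle (0≤ f≤F) (0≤ g≤G) n n)) ⟩
    M.partial (M.convolution F G) (n ℕ.+ n) ℚ.- T ∎
    where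
    open ℚ.≤-Reasoning
    e = norm (partial f n * partial g n - partial (convolution f g) n)
    T = M.partial (M.convolution F G) n
    0≤ : ∀ {h : ℕ → Carrier} {H : ℕ → ℚ} → (∀ i → norm (h i) ℚ.≤ H i) → ∀ i → 0ℚ ℚ.≤ H i
    0≤ {h} h≤H i = ℚ.≤-trans (0≤norm (h i)) (h≤H i)

open import Defs

-- Complex limits

module _ {c ℓ} {C : Set c} {_≈_ : Rel C ℓ} {_+_ _*_ : C → C → C} { -_ : C → C} {0# 1# : C}
  (isEquivalence : IsEquivalence _≈_)
  (+-cong : ∀ {x y u v} → x ≈ y → u ≈ v → (x + u) ≈ (y + v))
  (*-cong : ∀ {x y u v} → x ≈ y → u ≈ v → (x * u) ≈ (y * v))
  (-‿cong : ∀ {x y} → x ≈ y → (- x) ≈ (- y))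
  (+-assoc : ∀ x y z → ((x + y) + z) ≈ (x + (y + z)))
  (+-comm : ∀ x y → (x + y) ≈ (y + x))
  (+-identityˡ : ∀ x → (0# + x) ≈ x)
  (-‿inverseˡ : ∀ x → ((- x) + x) ≈ 0#)
  (*-assoc : ∀ x y z → ((x * y) * z) ≈ (x * (y * z)))
  (*-comm : ∀ x y → (x * y) ≈ (y * x))
  (*-identityˡ : ∀ x → (1# * x) ≈ x)
  (distribˡ : ∀ x y z → (x * (y + z)) ≈ ((x * y) + (x * z))) where

  private module E = IsEquivalence isEquivalence

  -- Commutativity supplies the right-handed laws, so that the constructions of ℚ[i] and ℂ check one
  -- side only.
  isCommutativeRingˡ : IsCommutativeRing _≈_ _+_ _*_ -_ 0# 1#
  isCommutativeRingˡ = record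
    { isRing = record
      { +-isAbelianGroup = record
        { isGroup = record
          { isMonoid = record
            { isSemigroup = record
              { isMagma = record { isEquivalence = isEquivalence ; ∙-cong = +-cong }
              ; assoc = +-assoc
              }
            ; identity = +-identityˡ , λ x → E.trans (+-comm x 0#) (+-identityˡ x)
            }
          ; inverse = -‿inverseˡ , λ x → E.trans (+-comm x (- x)) (-‿inverseˡ x)
          ; ⁻¹-cong = -‿cong
          }
        ; comm = +-comm
        }
      ; *-cong = *-cong
      ; *-assoc = *-assoc
      ; *-identity = *-identityˡ , λ x → E.trans (*-comm x 1#) (*-identityˡ x)
      ; distrib = distribˡ , λ x y z → E.trans (*-comm (y + z) x)
          (E.trans (distribˡ x y z) (+-cong (*-comm x y) (*-comm x z)))
      }
    ; *-comm = *-comm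
    }

-- The ring ℚ[i] and its norm

module ComplexRationals where
  open import Data.Rational.Base
  open import Data.Rational.Properties
  open +-*-Solver using (solve; _:=_; _:+_; _:*_; _:-_; :-_; con)

  ℚ[i] : Set
  ℚ[i] = ℚ × ℚ

  infixl 6 _⊕_ _⊖_
  infixl 7 _⊗_
  infix 8 ⊝_

  _⊕_ _⊗_ _⊖_ : ℚ[i] → ℚ[i] → ℚ[i]
  (a , b) ⊕ (c , d) = a + c , b + d
  (a , b) ⊗ (c , d) = a * c - b * d , a * d + b * c

  ⊝_ : ℚ[i] → ℚ[i]
  ⊝ (a , b) = - a , - b

  u ⊖ v = u ⊕ ⊝ v

  ℚ[i]-commutativeRing : CommutativeRing 0ℓ 0ℓ
  ℚ[i]-commutativeRing = record
    { Carrier = ℚ[i] ; _≈_ = _≡_ ; _+_ = _⊕_ ; _*_ = _⊗_ ; -_ = ⊝_ ; 0# = 0ℚ , 0ℚ ; 1# = 1ℚ , 0ℚ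
    ; isCommutativeRing = isCommutativeRingˡ ≡.isEquivalence (≡.cong₂ _⊕_) (≡.cong₂ _⊗_) (≡.cong ⊝_)
        (λ (a , b) (c , d) (e , f) → ≡.cong₂ _,_ (+-assoc a c e) (+-assoc b d f))
        (λ (a , b) (c , d) → ≡.cong₂ _,_ (+-comm a c) (+-comm b d))
        (λ (a , b) → ≡.cong₂ _,_ (+-identityˡ a) (+-identityˡ b))
        (λ (a , b) → ≡.cong₂ _,_ (+-inverseˡ a) (+-inverseˡ b))
        (λ (a , b) (c , d) (e , f) → ≡.cong₂ _,_
          (solve 6 (λ a b c d e f → (a :* c :- b :* d) :* e :- (a :* d :+ b :* c) :* f := a :* (c :* e :- d :* f) :- b :* (c :* f :+ d :* e)) ≡.refl a b c d e f)
          (solve 6 (λ a b c d e f → (a :* c :- b :* d) :* f :+ (a :* d :+ b :* c) :* e := a :* (c :* f :+ d :* e) :+ b :* (c :* e :- d :* f)) ≡.refl a b c d e f))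
        (λ (a , b) (c , d) → ≡.cong₂ _,_
          (solve 4 (λ a b c d → a :* c :- b :* d := c :* a :- d :* b) ≡.refl a b c d)
          (solve 4 (λ a b c d → a :* d :+ b :* c := c :* b :+ d :* a) ≡.refl a b c d))
        (λ (a , b) → ≡.cong₂ _,_
          (solve 2 (λ a b → con 1ℚ :* a :- con 0ℚ :* b := a) ≡.refl a b)
          (solve 2 (λ a b → con 1ℚ :* b :+ con 0ℚ :* a := b) ≡.refl a b))
        (λ (a , b) (c , d) (e , f) → ≡.cong₂ _,_
          (solve 6 (λ a b c d e f → a :* (c :+ e) :- b :* (d :+ f) := (a :* c :- b :* d) :+ (a :* e :- b :* f)) ≡.refl a b c d e f)
          (solve 6 (λ a b c d e f → a :* (d :+ f) :+ b :* (c :+ e) := (a :* d :+ b :* c) :+ (a :* f :+ b :* e)) ≡.refl a b c d e f))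
    }

  -- The ℓ¹ norm is submultiplicative and, unlike the Euclidean one, has rational values.
  norm : ℚ[i] → ℚ
  norm (a , b) = ∣ a ∣ + ∣ b ∣

  0≤norm : ∀ u → 0ℚ ≤ norm u
  0≤norm (a , b) = +-mono-≤ (0≤∣p∣ a) (0≤∣p∣ b)

  norm-⊕ : ∀ u v → norm (u ⊕ v) ≤ norm u + norm v
  norm-⊕ (a , b) (c , d) = ≤-trans (+-mono-≤ (∣p+q∣≤∣p∣+∣q∣ a c) (∣p+q∣≤∣p∣+∣q∣ b d))
    (≤-reflexive (solve 4 (λ a b c d → (a :+ c) :+ (b :+ d) := (a :+ b) :+ (c :+ d)) ≡.refl (∣ a ∣) (∣ b ∣) (∣ c ∣) (∣ d ∣)))

  norm-⊝ : ∀ u → norm (⊝ u) ≡ norm u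
  norm-⊝ (a , b) = ≡.cong₂ _+_ (∣-p∣≡∣p∣ a) (∣-p∣≡∣p∣ b)

  norm-⊗ : ∀ u v → norm (u ⊗ v) ≤ norm u * norm v
  norm-⊗ (a , b) (c , d) = begin
    ∣ a * c - b * d ∣ + ∣ a * d + b * c ∣
      ≤⟨ +-mono-≤ (∣p-q∣≤∣p∣+∣q∣ (a * c) (b * d)) (∣p+q∣≤∣p∣+∣q∣ (a * d) (b * c)) ⟩
    ∣ a * c ∣ + ∣ b * d ∣ + (∣ a * d ∣ + ∣ b * c ∣)
      ≡⟨ ≡.cong₂ _+_ (≡.cong₂ _+_ (∣p*q∣≡∣p∣*∣q∣ a c) (∣p*q∣≡∣p∣*∣q∣ b d)) (≡.cong₂ _+_ (∣p*q∣≡∣p∣*∣q∣ a d) (∣p*q∣≡∣p∣*∣q∣ b c)) ⟩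
    ∣ a ∣ * ∣ c ∣ + ∣ b ∣ * ∣ d ∣ + (∣ a ∣ * ∣ d ∣ + ∣ b ∣ * ∣ c ∣)
      ≡⟨ solve 4 (λ a b c d → a :* c :+ b :* d :+ (a :* d :+ b :* c) := (a :+ b) :* (c :+ d)) ≡.refl (∣ a ∣) (∣ b ∣) (∣ c ∣) (∣ d ∣) ⟩
    (∣ a ∣ + ∣ b ∣) * (∣ c ∣ + ∣ d ∣) ∎
    where open ≤-Reasoning

  dist : ℚ[i] → ℚ[i] → ℚ
  dist u v = norm (u ⊖ v)

  dist-refl : ∀ u → dist u u ≡ 0ℚ
  dist-refl (a , b) = ≡.cong norm (≡.cong₂ _,_ (+-inverseʳ a) (+-inverseʳ b))

  dist-sym : ∀ u v → dist u v ≡ dist v u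
  dist-sym (a , b) (c , d) = ≡.cong₂ _+_ (∣-∣-sym a c) (∣-∣-sym b d)

  dist-triangle : ∀ u v w → dist u w ≤ dist u v + dist v w
  dist-triangle (a , b) (c , d) (e , f) = ≤-trans (+-mono-≤ (∣-∣-triangle a c e) (∣-∣-triangle b d f))
    (≤-reflexive (solve 4 (λ a b c d → (a :+ c) :+ (b :+ d) := (a :+ b) :+ (c :+ d)) ≡.refl (∣ a - c ∣) (∣ b - d ∣) (∣ c - e ∣) (∣ d - f ∣)))

  dist-⊕ : ∀ u u′ v v′ → dist (u ⊕ u′) (v ⊕ v′) ≤ dist u v + dist u′ v′
  dist-⊕ (a , b) (a′ , b′) (c , d) (c′ , d′) = ≤-trans
    (≤-reflexive (≡.cong norm (≡.cong₂ _,_ (regroup a a′ c c′) (regroup b b′ d d′))))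
    (norm-⊕ ((a , b) ⊖ (c , d)) ((a′ , b′) ⊖ (c′ , d′)))
    where
    regroup : ∀ a b c d → a + b - (c + d) ≡ (a - c) + (b - d)
    regroup = solve 4 (λ a b c d → a :+ b :- (c :+ d) := (a :- c) :+ (b :- d)) ≡.refl

  dist-⊝ : ∀ u v → dist (⊝ u) (⊝ v) ≡ dist u v
  dist-⊝ (a , b) (c , d) = ≡.trans
    (≡.cong norm (≡.cong₂ _,_ (≡.sym (neg-distrib-+ a (- c))) (≡.sym (neg-distrib-+ b (- d)))))
    (norm-⊝ (a - c , b - d))

  -- From u u′ - v v′ = (u - v) u′ + v (u′ - v′).
  dist-⊗ : ∀ u u′ v v′ → dist (u ⊗ u′) (v ⊗ v′) ≤ dist u v * norm u′ + norm v * dist u′ v′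
  dist-⊗ u@(a , b) u′@(a′ , b′) v@(c , d) v′@(c′ , d′) = begin
    dist (u ⊗ u′) (v ⊗ v′)                        ≡⟨ ≡.cong norm (≡.cong₂ _,_
      (solve 8 (λ a b a′ b′ c d c′ d′ → a :* a′ :- b :* b′ :- (c :* c′ :- d :* d′) :=
        ((a :- c) :* a′ :- (b :- d) :* b′) :+ (c :* (a′ :- c′) :- d :* (b′ :- d′))) ≡.refl a b a′ b′ c d c′ d′)
      (solve 8 (λ a b a′ b′ c d c′ d′ → a :* b′ :+ b :* a′ :- (c :* d′ :+ d :* c′) :=
        ((a :- c) :* b′ :+ (b :- d) :* a′) :+ (c :* (b′ :- d′) :+ d :* (a′ :- c′))) ≡.refl a b a′ b′ c d c′ d′)) ⟩
    norm ((u ⊖ v) ⊗ u′ ⊕ v ⊗ (u′ ⊖ v′))           ≤⟨ norm-⊕ ((u ⊖ v) ⊗ u′) (v ⊗ (u′ ⊖ v′)) ⟩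
    norm ((u ⊖ v) ⊗ u′) + norm (v ⊗ (u′ ⊖ v′))    ≤⟨ +-mono-≤ (norm-⊗ (u ⊖ v) u′) (norm-⊗ v (u′ ⊖ v′)) ⟩
    dist u v * norm u′ + norm v * dist u′ v′      ∎
    where open ≤-Reasoning

  norm≤norm+dist : ∀ u v → norm u ≤ norm v + dist u v
  norm≤norm+dist u@(a , b) v@(c , d) = ≤-trans
    (≤-reflexive (≡.cong norm (≡.cong₂ _,_ (add-sub a c) (add-sub b d))))
    (norm-⊕ v (u ⊖ v))
    where
    add-sub : ∀ a c → a ≡ c + (a - c)
    add-sub = solve 2 (λ a c → a := c :+ (a :- c)) ≡.refl

-- Convergence in ℂ and the ring of complex numbers

module ComplexLimits where
  open ComplexRationals
  open import Data.Rational.Base hiding (_⊔_; NonZero)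
  open import Data.Rational.Properties
  open +-*-Solver using (solve; _:=_; _:+_; _:*_; _:-_; :-_; con)

  Eventually : (ℕ → Set) → Set
  Eventually P = ∃ λ N → ∀ n → N ℕ.≤ n → P n

  always : ∀ {P : ℕ → Set} → (∀ n → P n) → Eventually P
  always p = 0 , λ n _ → p n

  eventually-map : ∀ {P Q : ℕ → Set} → (∀ n → P n → Q n) → Eventually P → Eventually Q
  eventually-map f (N , p) = N , λ n N≤n → f n (p n N≤n)

  eventually-map₂ : ∀ {P Q R : ℕ → Set} → (∀ n → P n → Q n → R n) → Eventually P → Eventually Q → Eventually R
  eventually-map₂ f (N , p) (M , q) = N ℕ.⊔ M , λ n lt →
    f n (p n (ℕ.m⊔n≤o⇒m≤o N M lt)) (q n (ℕ.m⊔n≤o⇒n≤o N M lt))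

  eventually-witness : ∀ {P : ℕ → Set} → Eventually P → ∃ P
  eventually-witness (N , p) = N , p N ℕ.≤-refl

  infix 9 _at_
  _at_ : ℂ → ℕ → ℚ[i]
  z at k = seq (re z) k , seq (im z) k

  infix 4 _≈at[_]_ _⟶_

  _≈at[_]_ : ℂ → ℚ → ℂ → Set
  z ≈at[ ε ] w = Eventually λ k → dist (z at k) (w at k) ≤ ε

  -- The threshold for the approximations may depend on n. Being a record, the relation lets a and z
  -- be inferred from a proof of it.
  record _⟶_ (a : ℕ → ℂ) (z : ℂ) : Set where
    constructor converges
    field close : ∀ ε → 0ℚ < ε → Eventually λ n → a n ≈at[ ε ] z
  open _⟶_

  ≈at⇒≈ : ∀ z w → (∀ ε → 0ℚ < ε → z ≈at[ ε ] w) → z ≈ℂ w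
  ≈at⇒≈ z w h = (λ ε 0<ε → eventually-map (λ k → ≤-trans (p≤p+q (0≤∣p∣ _))) (h ε 0<ε)) ,
                (λ ε 0<ε → eventually-map (λ k → ≤-trans (≤-trans (p≤p+q (0≤∣p∣ _)) (≤-reflexive (+-comm _ (∣ seq (re z) k - seq (re w) k ∣))))) (h ε 0<ε))

  ≈⇒≈at : ∀ z w → z ≈ℂ w → ∀ ε → 0ℚ < ε → z ≈at[ ε ] w
  ≈⇒≈at z w (p , q) ε 0<ε = eventually-map₂ (λ k x y → ≤-trans (+-mono-≤ x y) (≤-reflexive (½+½ ε)))
    (p (½ * ε) (0<½* 0<ε)) (q (½ * ε) (0<½* 0<ε))

  eventually-≡⇒≈ : ∀ z w → Eventually (λ k → z at k ≡ w at k) → z ≈ℂ w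
  eventually-≡⇒≈ z w h = ≈at⇒≈ z w λ ε 0<ε → eventually-map
    (λ k eq → ≤-trans (≤-reflexive (≡.trans (≡.cong (dist (z at k)) (≡.sym eq)) (dist-refl (z at k)))) (<⇒≤ 0<ε)) h

  -- The way in which identities of ℚ[i] become identities of ℂ.
  pointwise : ∀ z w → (∀ k → z at k ≡ w at k) → z ≈ℂ w
  pointwise z w h = eventually-≡⇒≈ z w (always h)

  ≈at-triangle : ∀ ε x y z → x ≈at[ ½ * ε ] y → y ≈at[ ½ * ε ] z → x ≈at[ ε ] z
  ≈at-triangle ε x y z = eventually-map₂ λ k p q →
    ≤-trans (dist-triangle (x at k) (y at k) (z at k)) (≤-trans (+-mono-≤ p q) (≤-reflexive (½+½ ε)))

  ≈at-sym : ∀ ε x y → x ≈at[ ε ] y → y ≈at[ ε ] x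
  ≈at-sym ε x y = eventually-map λ k → ≡.subst (_≤ ε) (dist-sym (x at k) (y at k))

  bounded-at : ∀ z → ∃ λ c → Eventually λ k → norm (z at k) ≤ fromℕ (suc c)
  bounded-at z =
    let (b , K , p) = bounded (re z)
        (d , L , q) = bounded (im z)
        B = fromℕ (suc b) + fromℕ (suc d)
    in ℤ.∣ ↥ B ∣ , eventually-map₂ (λ k x y → ≤-trans (+-mono-≤ x y) (p≤fromℕ-suc B)) (K , p) (L , q)

  constant : ∀ z w → z ≈ℂ w → (λ _ → z) ⟶ w
  constant z w p .close ε 0<ε = always λ _ → ≈⇒≈at z w p ε 0<ε

  -- Together with `constant` it derives the congruence of an operation on ℂ from its continuity,
  -- applied to constant sequences.
  constant-⟶ : ∀ {z w} → (λ _ → z) ⟶ w → z ≈ℂ w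
  constant-⟶ {z} {w} h = ≈at⇒≈ z w λ ε 0<ε → proj₂ (eventually-witness (close h ε 0<ε))

  ⟶-unique : ∀ {a z w} → a ⟶ z → a ⟶ w → z ≈ℂ w
  ⟶-unique {a} {z} {w} p q = ≈at⇒≈ z w λ ε 0<ε →
    let (n , x , y) = eventually-witness (eventually-map₂ (λ _ → _,_) (close p (½ * ε) (0<½* 0<ε)) (close q (½ * ε) (0<½* 0<ε)))
    in ≈at-triangle ε z (a n) w (≈at-sym (½ * ε) (a n) z x) y

  ⟶-close : ∀ {a b z} → (∀ ε → 0ℚ < ε → Eventually λ n → b n ≈at[ ε ] a n) → a ⟶ z → b ⟶ z
  ⟶-close {a} {b} {z} p q .close ε 0<ε = eventually-map₂ (λ n → ≈at-triangle ε (b n) (a n) z)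
    (p (½ * ε) (0<½* 0<ε)) (close q (½ * ε) (0<½* 0<ε))

  ⟶-cong : ∀ {a b z} → (∀ n → b n ≈ℂ a n) → a ⟶ z → b ⟶ z
  ⟶-cong {a} {b} p = ⟶-close λ ε 0<ε → always λ n → ≈⇒≈at (b n) (a n) (p n) ε 0<ε

  ⟶-+ : ∀ {a b z w} → a ⟶ z → b ⟶ w → (λ n → a n +ℂ b n) ⟶ (z +ℂ w)
  ⟶-+ {a} {b} {z} {w} p q .close ε 0<ε = eventually-map₂
    (λ n → eventually-map₂ λ k x y → ≤-trans (dist-⊕ (a n at k) (b n at k) (z at k) (w at k))
      (≤-trans (+-mono-≤ x y) (≤-reflexive (½+½ ε))))
    (close p (½ * ε) (0<½* 0<ε)) (close q (½ * ε) (0<½* 0<ε))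

  ⟶-neg : ∀ {a z} → a ⟶ z → (λ n → -ℂ a n) ⟶ (-ℂ z)
  ⟶-neg {a} {z} p .close ε 0<ε = eventually-map
    (λ n → eventually-map λ k → ≡.subst (_≤ ε) (≡.sym (dist-⊝ (a n at k) (z at k)))) (close p ε 0<ε)

  ⟶-conj : ∀ {a z} → a ⟶ z → (λ n → conj (a n)) ⟶ conj z
  ⟶-conj {a} {z} p .close ε 0<ε = eventually-map
    (λ n → eventually-map λ k → ≡.subst (_≤ ε) (≡.sym (dist-conj (a n at k) (z at k)))) (close p ε 0<ε)
    where
    dist-conj : ∀ u v → dist (proj₁ u , - proj₂ u) (proj₁ v , - proj₂ v) ≡ dist u v
    dist-conj (a , b) (c , d) = ≡.cong (∣ a - c ∣ +_)
      (≡.trans (≡.cong ∣_∣ (≡.sym (neg-distrib-+ b (- d)))) (∣-p∣≡∣p∣ (b - d)))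

  ⟶-* : ∀ {a b z w} → a ⟶ z → b ⟶ w → (λ n → a n *ℂ b n) ⟶ (z *ℂ w)
  ⟶-* {a} {b} {z} {w} p q .close ε 0<ε =
    let (c , z≤c) = bounded-at z
        (d , w≤d) = bounded-at w
        h = ½ * ε
        D = fromℕ (suc d)
        -- Late b n are within 1 of w, so their norm is at most (d + 1) + 1 = d + 2, and
        -- `recip (suc d)` is 1/(d + 2).
        δ = recip (suc d) * h
        γ = recip c * h
    in eventually-map₂ (λ n a≈z (b≈w , b≈₁w) →
         eventually-map₂ (λ k (x , y) (y′ , z≤c , w≤d) → let u = a n at k ; u′ = b n at k ; v = z at k ; v′ = w at k in begin
           dist (u ⊗ u′) (v ⊗ v′)                       ≤⟨ dist-⊗ u u′ v v′ ⟩
           dist u v * norm u′ + norm v * dist u′ v′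
             ≤⟨ +-mono-≤
                  (*-mono-≤-0≤ (0≤norm (u ⊖ v)) x (0≤norm u′)
                    (≤-trans (norm≤norm+dist u′ v′) (≤-trans (+-mono-≤ w≤d y′)
                      (≤-reflexive (≡.trans (+-comm D 1ℚ) (≡.sym (fromℕ-suc (suc d))))))))
                  (*-mono-≤-0≤ (0≤norm v) z≤c (0≤norm (u′ ⊖ v′)) y) ⟩
           δ * fromℕ (suc (suc d)) + fromℕ (suc c) * γ  ≡⟨ ≡.cong₂ _+_ (≡.trans (*-comm δ (fromℕ (suc (suc d)))) (recip-scale (suc d) h)) (recip-scale c h) ⟩
           h + h                                        ≡⟨ ½+½ ε ⟩
           ε                                            ∎)
         (eventually-map₂ (λ _ → _,_) a≈z b≈w)
         (eventually-map₂ (λ _ → _,_) b≈₁w (eventually-map₂ (λ _ → _,_) z≤c w≤d)))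
       (close p δ (0<* (0<recip (suc d)) (0<½* 0<ε)))
       (eventually-map₂ (λ _ → _,_) (close q γ (0<* (0<recip c) (0<½* 0<ε))) (close q 1ℚ (positive⁻¹ 1ℚ)))
    where open ≤-Reasoning

  ≈ℂ-refl : ∀ z → z ≈ℂ z
  ≈ℂ-refl z = pointwise z z λ _ → ≡.refl

  ≈ℂ-sym : ∀ z w → z ≈ℂ w → w ≈ℂ z
  ≈ℂ-sym z w p = ≈at⇒≈ w z λ ε 0<ε → ≈at-sym ε z w (≈⇒≈at z w p ε 0<ε)

  private module K = CommutativeRing ℚ[i]-commutativeRing

  ℂ-commutativeRing : CommutativeRing 0ℓ 0ℓ
  ℂ-commutativeRing = record
    { Carrier = ℂ ; _≈_ = _≈ℂ_ ; _+_ = _+ℂ_ ; _*_ = _*ℂ_ ; -_ = -ℂ_ ; 0# = 0ℂ ; 1# = 1ℂ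
    ; isCommutativeRing = isCommutativeRingˡ
        (record
          { refl  = λ {z} → ≈ℂ-refl z
          ; sym   = λ {z} {w} → ≈ℂ-sym z w
          ; trans = λ {x} {y} {z} p q → ⟶-unique (constant y x (≈ℂ-sym x y p)) (constant y z q)
          })
        (λ {x} {y} {u} {v} p q → constant-⟶ (⟶-+ (constant x y p) (constant u v q)))
        (λ {x} {y} {u} {v} p q → constant-⟶ (⟶-* (constant x y p) (constant u v q)))
        (λ {x} {y} p → constant-⟶ (⟶-neg (constant x y p)))
        (λ x y z → pointwise (x +ℂ y +ℂ z) (x +ℂ (y +ℂ z)) λ k → K.+-assoc (x at k) (y at k) (z at k))
        (λ x y → pointwise (x +ℂ y) (y +ℂ x) λ k → K.+-comm (x at k) (y at k))
        (λ x → pointwise (0ℂ +ℂ x) x λ k → K.+-identityˡ (x at k))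
        (λ x → pointwise (-ℂ x +ℂ x) 0ℂ λ k → K.-‿inverseˡ (x at k))
        (λ x y z → pointwise (x *ℂ y *ℂ z) (x *ℂ (y *ℂ z)) λ k → K.*-assoc (x at k) (y at k) (z at k))
        (λ x y → pointwise (x *ℂ y) (y *ℂ x) λ k → K.*-comm (x at k) (y at k))
        (λ x → pointwise (1ℂ *ℂ x) x λ k → K.*-identityˡ (x at k))
        (λ x y z → pointwise (x *ℂ (y +ℂ z)) (x *ℂ y +ℂ x *ℂ z) λ k → K.distribˡ (x at k) (y at k) (z at k))
    }

  ℂ-starRing : StarRing 0ℓ 0ℓ
  ℂ-starRing = record
    { commutativeRing = ℂ-commutativeRing
    ; conj      = conj
    ; conj-cong = λ {x} {y} p → constant-⟶ (⟶-conj (constant x y p))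
    ; conj-+    = λ x y → pointwise (conj (x +ℂ y)) (conj x +ℂ conj y) λ k →
        ≡.cong (seq (re x) k + seq (re y) k ,_) (neg-distrib-+ (seq (im x) k) (seq (im y) k))
    ; conj-*    = λ x y → pointwise (conj (x *ℂ y)) (conj x *ℂ conj y) λ k →
        let a = seq (re x) k ; b = seq (im x) k ; c = seq (re y) k ; d = seq (im y) k in
        ≡.cong₂ _,_ (solve 4 (λ a b c d → a :* c :- b :* d := a :* c :- (:- b) :* (:- d)) ≡.refl a b c d)
                    (solve 4 (λ a b c d → :- (a :* d :+ b :* c) := a :* (:- d) :+ (:- b) :* c) ≡.refl a b c d)
    ; conj-conj = λ x → pointwise (conj (conj x)) x λ k →
        ≡.cong (seq (re x) k ,_) (solve 1 (λ b → :- (:- b) := b) ≡.refl (seq (im x) k))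
    }

-- The exponential function

module ComplexExponential where
  open ComplexRationals
  open ComplexLimits
  open import Data.Rational.Base hiding (_⊔_; NonZero)
  open import Data.Rational.Properties
  open +-*-Solver using (solve; _:=_; _:+_; _:*_; _:-_; :-_; con)
  private
    module K = CommutativeRing ℚ[i]-commutativeRing
    module P = CauchyProduct ℚ[i]-commutativeRing
    module Q = CauchyProduct +-*-commutativeRing
    module N = Majorant ℚ[i]-commutativeRing norm (≡.cong norm) ≡.refl norm-⊕ norm-⊗ 0≤norm

  -- The k-th entry of the limit is an entry of a k and not of a n. Both are compared at a common
  -- late index i: one step within a n, one from a n to a k, one within a k.
  lim-close : ∀ a (c : CauchySeq a) ε → 0ℚ < ε →
              Eventually λ n → Eventually λ k → ∣ seq (a n) k - seq (lim a c) k ∣ ≤ ε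
  lim-close a c ε 0<ε =
    let h = ½ * ε ; g = ½ * h
        0<h = 0<½* 0<ε ; 0<g = 0<½* 0<h
        (N , p) = c h 0<h
        (K , q) = archimedean-lb 0<g
    in N , λ n N≤n →
      let (J , r) = cauchy (a n) g 0<g
          B = N ℕ.⊔ K ℕ.⊔ J
      in B , λ k B≤k →
        let N⊔K≤k = ℕ.m⊔n≤o⇒m≤o (N ℕ.⊔ K) J B≤k
            (M , s) = cauchy (a k) (recip k) (0<recip k)
            (L , t) = p n k N≤n (ℕ.m⊔n≤o⇒m≤o N K N⊔K≤k)
            i = k ℕ.⊔ M ℕ.⊔ L
            k≤i = ℕ.≤-trans (ℕ.m≤m⊔n k M) (ℕ.m≤m⊔n (k ℕ.⊔ M) L)
            M≤i = ℕ.≤-trans (ℕ.m≤n⊔m k M) (ℕ.m≤m⊔n (k ℕ.⊔ M) L)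
            J≤k = ℕ.m⊔n≤o⇒n≤o (N ℕ.⊔ K) J B≤k
            x = seq (a n) k ; x′ = seq (a n) i ; y′ = seq (a k) i ; y = seq (a k) M
        in begin
          ∣ x - y ∣                               ≤⟨ ∣-∣-triangle x x′ y ⟩
          ∣ x - x′ ∣ + ∣ x′ - y ∣                 ≤⟨ +-monoʳ-≤ ∣ x - x′ ∣ (∣-∣-triangle x′ y′ y) ⟩
          ∣ x - x′ ∣ + (∣ x′ - y′ ∣ + ∣ y′ - y ∣)
            ≤⟨ +-mono-≤ (r k i J≤k (ℕ.≤-trans J≤k k≤i))
                 (+-mono-≤ (t i (ℕ.m≤n⊔m (k ℕ.⊔ M) L))
                   (≤-trans (s i M M≤i ℕ.≤-refl) (≤-trans (recip-antitone (ℕ.m⊔n≤o⇒n≤o N K N⊔K≤k)) q))) ⟩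
          g + (h + g)                             ≡⟨ solve 2 (λ g h → g :+ (h :+ g) := (g :+ g) :+ h) ≡.refl g h ⟩
          (g + g) + h                             ≡⟨ ≡.cong (_+ h) (½+½ h) ⟩
          h + h                                   ≡⟨ ½+½ ε ⟩
          ε                                       ∎
    where open ≤-Reasoning

  expSum⟶exp : ∀ z → expSum z ⟶ exp z
  expSum⟶exp z = converges λ ε 0<ε → eventually-map₂
    (λ n → eventually-map₂ λ k x y → ≤-trans (+-mono-≤ x y) (≤-reflexive (½+½ ε)))
    (lim-close (λ n → re (expSum z n)) (re-expSum-cauchy z) (½ * ε) (0<½* 0<ε))
    (lim-close (λ n → im (expSum z n)) (im-expSum-cauchy z) (½ * ε) (0<½* 0<ε))

  power : ℚ[i] → ℕ → ℚ[i]
  power u zero    = 1ℚ , 0ℚ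
  power u (suc i) = u ⊗ power u i

  term : ℚ[i] → ℕ → ℚ[i]
  term u i = (invFactorial i , 0ℚ) ⊗ power u i

  ^ℂ-at : ∀ z n k → (z ^ℂ n) at k ≡ power (z at k) n
  ^ℂ-at z zero    k = ≡.refl
  ^ℂ-at z (suc n) k = ≡.cong (z at k ⊗_) (^ℂ-at z n k)

  -- The k-th approximation of the sum is the exponential sum of the k-th approximation of z. This
  -- moves the addition theorem to ℚ[i].
  expSum-at : ∀ z n k → expSum z n at k ≡ P.partial (term (z at k)) n
  expSum-at z zero    k = ≡.refl
  expSum-at z (suc n) k = ≡.cong₂ _⊕_ (expSum-at z n k)
    (≡.trans (scale ((z ^ℂ n) at k)) (≡.cong ((invFactorial n , 0ℚ) ⊗_) (^ℂ-at z n k)))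
    where
    scale : ∀ u → (invFactorial n * proj₁ u , invFactorial n * proj₂ u) ≡ (invFactorial n , 0ℚ) ⊗ u
    scale (a , b) = ≡.cong₂ _,_
      (solve 3 (λ q a b → q :* a := q :* a :- con 0ℚ :* b) ≡.refl (invFactorial n) a b)
      (solve 3 (λ q a b → q :* b := q :* b :+ con 0ℚ :* a) ≡.refl (invFactorial n) a b)

  suc*invFactorial : ∀ i → fromℕ (suc i) * invFactorial (suc i) ≡ invFactorial i
  suc*invFactorial i = ≡.trans (≡.cong (fromℕ (suc i) *_) (invFactorial-suc i)) (recip-scale i (invFactorial i))

  real-⊗ : ∀ p q → (p , 0ℚ) ⊗ (q , 0ℚ) ≡ (p * q , 0ℚ)
  real-⊗ p q = ≡.cong₂ _,_ (solve 2 (λ p q → p :* q :- con 0ℚ :* con 0ℚ := p :* q) ≡.refl p q)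
    (solve 2 (λ p q → p :* con 0ℚ :+ con 0ℚ :* q := con 0ℚ) ≡.refl p q)

  module ℚ[i]Exponential = P.Exponential (λ i → fromℕ i , 0ℚ) (λ i → recip i , 0ℚ) ≡.refl
    (λ i → ≡.cong (_, 0ℚ) (fromℕ-suc i))
    (λ i → ≡.trans (real-⊗ (recip i) (fromℕ (suc i))) (≡.cong (_, 0ℚ) (≡.trans (*-comm (recip i) (fromℕ (suc i))) (fromℕ*recip i))))

  module ℚExponential = Q.Exponential fromℕ recip ≡.refl fromℕ-suc
    (λ i → ≡.trans (*-comm (recip i) (fromℕ (suc i))) (fromℕ*recip i))

  term-exponential : ∀ u → ℚ[i]Exponential.IsExponential u (term u)
  term-exponential u = record
    { at-zero = ≡.refl
    ; at-suc  = λ i → let ν = (fromℕ (suc i) , 0ℚ) ; q = (invFactorial (suc i) , 0ℚ) ; p = power u i in begin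
        ν ⊗ (q ⊗ (u ⊗ p))               ≡⟨ K.*-assoc ν q (u ⊗ p) ⟨
        ν ⊗ q ⊗ (u ⊗ p)                 ≡⟨ ≡.cong (_⊗ (u ⊗ p)) (≡.trans (real-⊗ (fromℕ (suc i)) (invFactorial (suc i))) (≡.cong (_, 0ℚ) (suc*invFactorial i))) ⟩
        (invFactorial i , 0ℚ) ⊗ (u ⊗ p) ≡⟨ K.*-assoc (invFactorial i , 0ℚ) u p ⟨
        (invFactorial i , 0ℚ) ⊗ u ⊗ p   ≡⟨ ≡.cong (_⊗ p) (K.*-comm (invFactorial i , 0ℚ) u) ⟩
        u ⊗ (invFactorial i , 0ℚ) ⊗ p   ≡⟨ K.*-assoc u (invFactorial i , 0ℚ) p ⟩
        u ⊗ term u i                    ∎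
    }
    where open ≡.≡-Reasoning

  expTerm-exponential : ∀ c → ℚExponential.IsExponential (fromℕ c) (expTerm c)
  expTerm-exponential c = record
    { at-zero = ≡.refl
    ; at-suc  = λ i → ≡.trans
        (solve 4 (λ n q c p → n :* (q :* (c :* p)) := c :* ((n :* q) :* p)) ≡.refl (fromℕ (suc i)) (invFactorial (suc i)) (fromℕ c) (pow (fromℕ c) i))
        (≡.cong (λ t → fromℕ c * (t * pow (fromℕ c) i)) (suc*invFactorial i))
    }

  norm-power : ∀ u c → norm u ≤ fromℕ c → ∀ i → norm (power u i) ≤ pow (fromℕ c) i
  norm-power u c h zero    = ≤-refl
  norm-power u c h (suc i) = ≤-trans (norm-⊗ u (power u i))
    (*-mono-≤-0≤ (0≤norm u) h (0≤norm (power u i)) (norm-power u c h i))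

  norm-term : ∀ u c → norm u ≤ fromℕ c → ∀ i → norm (term u i) ≤ expTerm c i
  norm-term u c h i = ≤-trans (norm-⊗ (invFactorial i , 0ℚ) (power u i))
    (*-mono-≤-0≤ (0≤norm (invFactorial i , 0ℚ))
      (≤-reflexive (≡.trans (+-identityʳ (∣ invFactorial i ∣)) (0≤p⇒∣p∣≡p (0≤invFactorial i))))
      (0≤norm (power u i)) (norm-power u c h i))

  -- The product of the majorants is again of the form `expTerm`, so its terms eventually halve and
  -- its sections become small.
  expTerm-convolution : ∀ c n → Q.convolution (expTerm c) (expTerm c) n ≡ expTerm (2 ℕ.* c) n
  expTerm-convolution c = ℚExponential.exponential-unique
    (ℚExponential.exponential-convolution (expTerm-exponential c) (expTerm-exponential c))
    (≡.subst (λ x → ℚExponential.IsExponential x (expTerm (2 ℕ.* c)))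
      (≡.trans (fromℕ-* 2 c) (solve 1 (λ c → (con 1ℚ :+ con 1ℚ) :* c := c :+ c) ≡.refl (fromℕ c)))
      (expTerm-exponential (2 ℕ.* c)))

  expSum-product-error : ∀ u v c → norm u ≤ fromℕ c → norm v ≤ fromℕ c → ∀ n →
    dist (P.partial (term u) n ⊗ P.partial (term v) n) (P.partial (term (u ⊕ v)) n) ≤
      Q.partial (expTerm (2 ℕ.* c)) (n ℕ.+ n) - Q.partial (expTerm (2 ℕ.* c)) n
  expSum-product-error u v c hu hv n = ≡.subst₂ _≤_
    (≡.cong (λ s → dist (P.partial (term u) n ⊗ P.partial (term v) n) s)
      (P.partial-cong (ℚ[i]Exponential.exponential-unique
        (ℚ[i]Exponential.exponential-convolution (term-exponential u) (term-exponential v))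
        (term-exponential (u ⊕ v))) n))
    (≡.cong₂ _-_ (Q.partial-cong (expTerm-convolution c) (n ℕ.+ n)) (Q.partial-cong (expTerm-convolution c) n))
    (N.product-error (norm-term u c hu) (norm-term v c hv) n)

  -- The threshold for n depends only on ε and on a common bound c for all late approximations of z
  -- and w, hence not on k.
  expSum-product-close : ∀ z w ε → 0ℚ < ε →
    Eventually λ n → expSum (z +ℂ w) n ≈at[ ε ] (expSum z n *ℂ expSum w n)
  expSum-product-close z w ε 0<ε =
    let (b , z≤b) = bounded-at z
        (d , w≤d) = bounded-at w
        c = suc b ℕ.⊔ suc d
        C = 2 ℕ.* c
        (N , tail) = halving-cauchy (expTerm C) (0≤expTerm C) (2 ℕ.* C) (expTerm-halves C) ε 0<ε
        S = Q.partial (expTerm C)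
        increment : ∀ n → ∣ S (suc n) - S n ∣ ≤ expTerm C n
        increment n = ≤-reflexive (≡.trans
          (≡.cong ∣_∣ (solve 2 (λ s t → s :+ t :- s := t) ≡.refl (S n) (expTerm C n)))
          (0≤p⇒∣p∣≡p (0≤expTerm C n)))
    in N , λ n N≤n → eventually-map₂
      (λ k hz hw → let u = z at k ; v = w at k in begin
        dist (expSum (z +ℂ w) n at k) (expSum z n at k ⊗ expSum w n at k)
          ≡⟨ ≡.cong₂ dist (expSum-at (z +ℂ w) n k) (≡.cong₂ _⊗_ (expSum-at z n k) (expSum-at w n k)) ⟩
        dist (P.partial (term (u ⊕ v)) n) (P.partial (term u) n ⊗ P.partial (term v) n)
          ≡⟨ dist-sym (P.partial (term (u ⊕ v)) n) _ ⟩
        dist (P.partial (term u) n ⊗ P.partial (term v) n) (P.partial (term (u ⊕ v)) n)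
          ≤⟨ expSum-product-error u v c (≤-trans hz (fromℕ-mono (ℕ.m≤m⊔n (suc b) (suc d)))) (≤-trans hw (fromℕ-mono (ℕ.m≤n⊔m (suc b) (suc d)))) n ⟩
        S (n ℕ.+ n) - S n      ≤⟨ p≤∣p∣ (S (n ℕ.+ n) - S n) ⟩
        ∣ S (n ℕ.+ n) - S n ∣  ≤⟨ tail (n ℕ.+ n) n (ℕ.≤-trans N≤n (ℕ.m≤m+n n n)) N≤n S increment ⟩
        ε                      ∎)
      z≤b w≤d
    where open ≤-Reasoning

  exp-+ : ∀ z w → exp (z +ℂ w) ≈ℂ exp z *ℂ exp w
  exp-+ z w = ⟶-unique (expSum⟶exp (z +ℂ w))
    (⟶-close (expSum-product-close z w) (⟶-* (expSum⟶exp z) (expSum⟶exp w)))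

  ·ℂ≈*ℂ : ∀ r z → r ·ℂ z ≈ℂ (r +i 0ℝ) *ℂ z
  ·ℂ≈*ℂ r z = pointwise (r ·ℂ z) ((r +i 0ℝ) *ℂ z) λ k → let q = seq r k ; a = seq (re z) k ; b = seq (im z) k in
    ≡.cong₂ _,_ (solve 3 (λ q a b → q :* a := q :* a :- con 0ℚ :* b) ≡.refl q a b)
                (solve 3 (λ q a b → q :* b := q :* b :+ con 0ℚ :* a) ≡.refl q a b)

  private
    module S = StarRing ℂ-starRing
    q/ : ℕ → ℂ
    q/ n = fromℚ (invFactorial n) +i 0ℝ

  expSum-suc : ∀ z n → expSum z (suc n) ≈ℂ expSum z n +ℂ q/ n *ℂ z ^ℂ n
  expSum-suc z n = S.+-congˡ {expSum z n} {fromℚ (invFactorial n) ·ℂ z ^ℂ n} {q/ n *ℂ z ^ℂ n}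
    (·ℂ≈*ℂ (fromℚ (invFactorial n)) (z ^ℂ n))

  conj-real : ∀ r → conj (r +i 0ℝ) ≈ℂ r +i 0ℝ
  conj-real r = pointwise (conj (r +i 0ℝ)) (r +i 0ℝ) λ k → ≡.refl

  module _ {z w : ℂ} (z≈w : z ≈ℂ w) where

    ^ℂ-cong : ∀ n → z ^ℂ n ≈ℂ w ^ℂ n
    ^ℂ-cong zero    = ≈ℂ-refl 1ℂ
    ^ℂ-cong (suc n) = S.*-cong {z} {w} {z ^ℂ n} {w ^ℂ n} z≈w (^ℂ-cong n)

    expSum-cong : ∀ n → expSum z n ≈ℂ expSum w n
    expSum-cong zero    = ≈ℂ-refl 0ℂ
    expSum-cong (suc n) = begin
      expSum z (suc n)              ≈⟨ expSum-suc z n ⟩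
      expSum z n +ℂ q/ n *ℂ z ^ℂ n  ≈⟨ S.+-cong {expSum z n} {expSum w n} {q/ n *ℂ z ^ℂ n} {q/ n *ℂ w ^ℂ n} (expSum-cong n)
                                        (S.*-congˡ {q/ n} {z ^ℂ n} {w ^ℂ n} (^ℂ-cong n)) ⟩
      expSum w n +ℂ q/ n *ℂ w ^ℂ n  ≈⟨ expSum-suc w n ⟨
      expSum w (suc n)              ∎
      where open SetoidReasoning S.setoid

    exp-cong : exp z ≈ℂ exp w
    exp-cong = ⟶-unique (expSum⟶exp z) (⟶-cong expSum-cong (expSum⟶exp w))

  conj-^ℂ : ∀ z n → conj z ^ℂ n ≈ℂ conj (z ^ℂ n)
  conj-^ℂ z zero    = S.sym {conj 1ℂ} {1ℂ} S.conj-1#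
  conj-^ℂ z (suc n) = S.trans {conj z *ℂ conj z ^ℂ n} {conj z *ℂ conj (z ^ℂ n)} {conj (z *ℂ z ^ℂ n)}
    (S.*-congˡ {conj z} {conj z ^ℂ n} {conj (z ^ℂ n)} (conj-^ℂ z n))
    (S.sym {conj (z *ℂ z ^ℂ n)} {conj z *ℂ conj (z ^ℂ n)} (S.conj-* z (z ^ℂ n)))

  expSum-conj : ∀ z n → expSum (conj z) n ≈ℂ conj (expSum z n)
  expSum-conj z zero    = S.sym {conj 0ℂ} {0ℂ} S.conj-0#
  expSum-conj z (suc n) = begin
    expSum (conj z) (suc n)
      ≈⟨ expSum-suc (conj z) n ⟩
    expSum (conj z) n +ℂ q/ n *ℂ conj z ^ℂ n
      ≈⟨ S.+-cong {expSum (conj z) n} {conj (expSum z n)} {q/ n *ℂ conj z ^ℂ n} {conj (q/ n) *ℂ conj (z ^ℂ n)} (expSum-conj z n)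
          (S.*-cong {q/ n} {conj (q/ n)} {conj z ^ℂ n} {conj (z ^ℂ n)}
            (S.sym {conj (q/ n)} {q/ n} (conj-real (fromℚ (invFactorial n)))) (conj-^ℂ z n)) ⟩
    conj (expSum z n) +ℂ conj (q/ n) *ℂ conj (z ^ℂ n)
      ≈⟨ S.+-congˡ {conj (expSum z n)} {conj (q/ n *ℂ z ^ℂ n)} {conj (q/ n) *ℂ conj (z ^ℂ n)} (S.conj-* (q/ n) (z ^ℂ n)) ⟨
    conj (expSum z n) +ℂ conj (q/ n *ℂ z ^ℂ n)
      ≈⟨ S.conj-+ (expSum z n) (q/ n *ℂ z ^ℂ n) ⟨
    conj (expSum z n +ℂ q/ n *ℂ z ^ℂ n)
      ≈⟨ S.conj-cong {expSum z (suc n)} {expSum z n +ℂ q/ n *ℂ z ^ℂ n} (expSum-suc z n) ⟨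
    conj (expSum z (suc n)) ∎
    where open SetoidReasoning S.setoid

  exp-conj : ∀ z → exp (conj z) ≈ℂ conj (exp z)
  exp-conj z = ⟶-unique (expSum⟶exp (conj z)) (⟶-cong (expSum-conj z) (⟶-conj (expSum⟶exp z)))

  -- The empty sum is 0, hence the successor.
  expSum-0 : ∀ n → expSum 0ℂ (suc n) ≈ℂ 1ℂ
  expSum-0 zero    = pointwise (expSum 0ℂ 1) 1ℂ λ k → ≡.refl
  expSum-0 (suc n) = begin
    expSum 0ℂ (suc (suc n))                              ≈⟨ expSum-suc 0ℂ (suc n) ⟩
    expSum 0ℂ (suc n) +ℂ q/ (suc n) *ℂ (0ℂ *ℂ 0ℂ ^ℂ n)   ≈⟨ S.+-cong {expSum 0ℂ (suc n)} {1ℂ} {q/ (suc n) *ℂ (0ℂ *ℂ 0ℂ ^ℂ n)} {0ℂ} (expSum-0 n) vanish ⟩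
    1ℂ +ℂ 0ℂ                                             ≈⟨ S.+-identityʳ 1ℂ ⟩
    1ℂ                                                   ∎
    where
    open SetoidReasoning S.setoid
    vanish : q/ (suc n) *ℂ (0ℂ *ℂ 0ℂ ^ℂ n) ≈ℂ 0ℂ
    vanish = begin
      q/ (suc n) *ℂ (0ℂ *ℂ 0ℂ ^ℂ n)  ≈⟨ S.*-congˡ {q/ (suc n)} {0ℂ *ℂ 0ℂ ^ℂ n} {0ℂ} (S.zeroˡ (0ℂ ^ℂ n)) ⟩
      q/ (suc n) *ℂ 0ℂ               ≈⟨ S.zeroʳ (q/ (suc n)) ⟩
      0ℂ                             ∎

  expSum-0⟶1 : expSum 0ℂ ⟶ 1ℂ
  expSum-0⟶1 = converges λ ε 0<ε → 1 , λ { (suc n) _ → ≈⇒≈at (expSum 0ℂ (suc n)) 1ℂ (expSum-0 n) ε 0<ε }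

  exp-0 : exp 0ℂ ≈ℂ 1ℂ
  exp-0 = ⟶-unique (expSum⟶exp 0ℂ) expSum-0⟶1

  -- Opaque, as unfolding exp in conversion checks is expensive.
  opaque

    cis : ℝ → ℂ
    cis t = exp (0ℝ +i t)

    exp≈cis : ∀ t → exp (0ℝ +i t) ≈ℂ cis t
    exp≈cis t = ≈ℂ-refl (exp (0ℝ +i t))

    sin≈0⇒im-cis≈0 : ∀ t → sin t ≈ℝ 0ℝ → im (cis t) ≈ℝ 0ℝ
    sin≈0⇒im-cis≈0 t h = h

    im-cis≈0⇒sin≈0 : ∀ t → im (cis t) ≈ℝ 0ℝ → sin t ≈ℝ 0ℝ
    im-cis≈0⇒sin≈0 t h = h

    cis-cong : ∀ s t → (∀ k → seq s k ≡ seq t k) → cis s ≈ℂ cis t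
    cis-cong s t h = exp-cong {0ℝ +i s} {0ℝ +i t} (pointwise (0ℝ +i s) (0ℝ +i t) λ k → ≡.cong (0ℚ ,_) (h k))

    cis-+ : ∀ s t → cis (s +ℝ t) ≈ℂ cis s *ℂ cis t
    cis-+ s t = S.trans {cis (s +ℝ t)} {exp ((0ℝ +i s) +ℂ (0ℝ +i t))} {cis s *ℂ cis t}
      (exp-cong {0ℝ +i (s +ℝ t)} {(0ℝ +i s) +ℂ (0ℝ +i t)} (pointwise (0ℝ +i (s +ℝ t)) ((0ℝ +i s) +ℂ (0ℝ +i t)) λ k → ≡.refl))
      (exp-+ (0ℝ +i s) (0ℝ +i t))

    cis-0 : cis 0ℝ ≈ℂ 1ℂ
    cis-0 = exp-0

    conj-cis : ∀ t → conj (cis t) ≈ℂ cis (-ℝ t)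
    conj-cis t = S.sym {exp (conj (0ℝ +i t))} {conj (exp (0ℝ +i t))} (exp-conj (0ℝ +i t))

  cis-unimodular : ∀ t → cis t *ℂ conj (cis t) ≈ℂ 1ℂ
  cis-unimodular t = begin
    cis t *ℂ conj (cis t)    ≈⟨ S.*-congˡ {cis t} {conj (cis t)} {cis (-ℝ t)} (conj-cis t) ⟩
    cis t *ℂ cis (-ℝ t)      ≈⟨ cis-+ t (-ℝ t) ⟨
    cis (t +ℝ -ℝ t)          ≈⟨ cis-cong (t +ℝ -ℝ t) 0ℝ (λ k → +-inverseʳ (seq t k)) ⟩
    cis 0ℝ                   ≈⟨ cis-0 ⟩
    1ℂ                       ∎
    where open SetoidReasoning S.setoid

  suc-scale : ∀ m q → q + fromℕ m * q ≡ fromℕ (suc m) * q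
  suc-scale m q = begin
    q + fromℕ m * q        ≡⟨ ≡.cong (_+ fromℕ m * q) (*-identityˡ q) ⟨
    1ℚ * q + fromℕ m * q   ≡⟨ *-distribʳ-+ q 1ℚ (fromℕ m) ⟨
    (1ℚ + fromℕ m) * q     ≡⟨ ≡.cong (_* q) (fromℕ-suc m) ⟨
    fromℕ (suc m) * q      ∎
    where open ≡.≡-Reasoning

  cis-step : ∀ t s s′ {z} → (∀ k → seq t k + seq s k ≡ seq s′ k) → z ≈ℂ cis s → cis t *ℂ z ≈ℂ cis s′
  cis-step t s s′ {z} t+s≡s′ z≈ = S.trans {cis t *ℂ z} {cis t *ℂ cis s} {cis s′}
    (S.*-congˡ {cis t} {z} {cis s} z≈)
    (S.trans {cis t *ℂ cis s} {cis (t +ℝ s)} {cis s′} (S.sym {cis (t +ℝ s)} {cis t *ℂ cis s} (cis-+ t s))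
      (cis-cong (t +ℝ s) s′ t+s≡s′))

  cis-multiple : ∀ t m → cis t ^ℂ m ≈ℂ cis (fromℚ (fromℕ m) *ℝ t)
  cis-multiple t zero    = S.trans {1ℂ} {cis 0ℝ} {cis (fromℚ (fromℕ zero) *ℝ t)} (S.sym {cis 0ℝ} {1ℂ} cis-0)
    (cis-cong 0ℝ (fromℚ (fromℕ zero) *ℝ t) (λ k → ≡.sym (*-zeroˡ (seq t k))))
  cis-multiple t (suc m) = cis-step t (fromℚ (fromℕ m) *ℝ t) (fromℚ (fromℕ (suc m)) *ℝ t) {cis t ^ℂ m}
    (λ k → suc-scale m (seq t k)) (cis-multiple t m)

-- Square roots and cancellation

module RealRoots where
  open ComplexRationals
  open ComplexLimits
  open import Data.Rational.Base hiding (_⊔_; NonZero)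
  open import Data.Rational.Properties
  open +-*-Solver using (solve; _:=_; _:+_; _:*_; _:-_; :-_; con)
  open RawSemiringDefinitions (Semiring.rawSemiring (CommutativeRing.semiring ℂ-commutativeRing)) using () renaming (_×_ to _·_)
  private
    module R = Setoid ≈ℝ-setoid
    module S = StarRing ℂ-starRing

  infix 9 _+i0
  _+i0 : ℝ → ℂ
  x +i0 = x +i 0ℝ

  +i0-cong : ∀ x y → x ≈ℝ y → x +i0 ≈ℂ y +i0
  +i0-cong x y p = p , R.refl {0ℝ}

  +i0-* : ∀ x y → x +i0 *ℂ y +i0 ≈ℂ (x *ℝ y) +i0
  +i0-* x y = pointwise (x +i0 *ℂ y +i0) ((x *ℝ y) +i0) λ k →
    ≡.cong₂ _,_ (solve 2 (λ p q → p :* q :- con 0ℚ :* con 0ℚ := p :* q) ≡.refl (seq x k) (seq y k))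
                (solve 2 (λ p q → p :* con 0ℚ :+ con 0ℚ :* q := con 0ℚ) ≡.refl (seq x k) (seq y k))

  -- With r = 1/(k + 1), the defect x - s² is below (s + r)² - s² = (2s + r) r, which tends to 0
  -- because s is bounded.
  sqrt-estimate : ∀ s x → (∀ k → 0ℚ ≤ seq s k) → (∀ k → seq s k * seq s k ≤ seq x k) →
    (∀ k → seq x k < (seq s k + recip k) * (seq s k + recip k)) → s *ℝ s ≈ℝ x
  sqrt-estimate s x 0≤s lower upper ε 0<ε =
    let (b , s≤b) = bounded s
        B = fromℕ (suc b)
        -- c + 1 bounds 2s + r: eventually s ≤ B, and r ≤ `recip 0`, which is 1.
        c = ℤ.∣ ↥ (B + B + recip 0) ∣
        (j , r≤) = archimedean-lb (0<* (0<recip c) 0<ε)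
    in eventually-map₂ (λ k ∣s∣≤B j≤k → ≤+⇒∣-∣≤ (≤-trans (lower k) (p≤p+q (<⇒≤ 0<ε))) (estimate b c j r≤ k ∣s∣≤B j≤k (p≤fromℕ-suc (B + B + recip 0))))
      s≤b (j , λ k j≤k → j≤k)
    where
    open ≤-Reasoning
    estimate : ∀ b c j → recip j ≤ recip c * ε → ∀ k → ∣ seq s k ∣ ≤ fromℕ (suc b) → j ℕ.≤ k →
      fromℕ (suc b) + fromℕ (suc b) + recip 0 ≤ fromℕ (suc c) → seq x k ≤ seq s k * seq s k + ε
    estimate b c j r≤ k ∣s∣≤B j≤k B≤c = let t = seq s k ; r = recip k ; t≤B = ≤-trans (p≤∣p∣ t) ∣s∣≤B in begin
      seq x k                        ≤⟨ <⇒≤ (upper k) ⟩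
      (t + r) * (t + r)              ≡⟨ solve 2 (λ t r → (t :+ r) :* (t :+ r) := t :* t :+ (t :+ t :+ r) :* r) ≡.refl t r ⟩
      t * t + (t + t + r) * r        ≤⟨ +-monoʳ-≤ (t * t) (*-mono-≤-0≤ (+-mono-≤ (+-mono-≤ (0≤s k) (0≤s k)) (<⇒≤ (0<recip k)))
                                          (≤-trans (+-mono-≤ (+-mono-≤ t≤B t≤B) (recip-antitone {0} {k} ℕ.z≤n)) B≤c)
                                          (<⇒≤ (0<recip k)) (≤-trans (recip-antitone j≤k) r≤)) ⟩
      t * t + fromℕ (suc c) * (recip c * ε)  ≡⟨ ≡.cong (t * t +_) (recip-scale c ε) ⟩
      t * t + ε                      ∎

  seq-sqrt : ∀ x k → sqrtApprox (seq x k) k ≡ seq (sqrt x) k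
  seq-sqrt x k = ≡.refl

  0≤sqrt : ∀ x k → 0ℚ ≤ seq (sqrt x) k
  0≤sqrt x k = ≡.subst (0ℚ ≤_) (seq-sqrt x k) (0≤sqrtApprox (seq x k) k)

  sqrt-* : ∀ x → (∀ k → 0ℚ ≤ seq x k) → sqrt x *ℝ sqrt x ≈ℝ x
  sqrt-* x 0≤x = sqrt-estimate (sqrt x) x (0≤sqrt x)
    (λ k → ≡.subst (λ s → s * s ≤ seq x k) (seq-sqrt x k) (lower (sqrtApprox (seq x k) k) (0≤x k) (sqrtApprox-lower (seq x k) k)))
    (λ k → ≡.subst (λ s → seq x k < (s + recip k) * (s + recip k)) (seq-sqrt x k) (sqrtApprox-upper (seq x k) k))
    where
    -- The search for a root falls back on 0 when it finds nothing; there nonnegativity of q gives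
    -- the bound.
    lower : ∀ s {q} → 0ℚ ≤ q → s ≡ 0ℚ ⊎ s * s ≤ q → s * s ≤ q
    lower s 0≤q (inj₁ s≡0)  = ≤-trans (≤-reflexive (≡.trans (≡.cong (λ s → s * s) s≡0) (*-zeroˡ 0ℚ))) 0≤q
    lower s 0≤q (inj₂ s²≤q) = s²≤q

  0≤square : ∀ p → 0ℚ ≤ p * p
  0≤square p = ≤-trans (0≤* (0≤∣p∣ p) (0≤∣p∣ p)) (≤-reflexive (∣p∣*∣p∣≡p*p p))
    where
    ∣p∣*∣p∣≡p*p : ∀ p → ∣ p ∣ * ∣ p ∣ ≡ p * p
    ∣p∣*∣p∣≡p*p p with ∣p∣≡p∨∣p∣≡-p p
    ... | inj₁ eq = ≡.cong (λ t → t * t) eq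
    ... | inj₂ eq = ≡.trans (≡.cong (λ t → t * t) eq) (solve 1 (λ p → (:- p) :* (:- p) := p :* p) ≡.refl p)

  ½≤q⇒∣p∣≤ε : ∀ p q {ε} → ½ ≤ q → ∣ p * q ∣ ≤ ½ * ε → ∣ p ∣ ≤ ε
  ½≤q⇒∣p∣≤ε p q {ε} ½≤q h = *-cancelˡ-≤-pos ½ (begin
    ½ * ∣ p ∣      ≤⟨ *-monoʳ-≤-nonNeg (∣ p ∣) {{nonNegative (0≤∣p∣ p)}} (≤-trans ½≤q (p≤∣p∣ q)) ⟩
    ∣ q ∣ * ∣ p ∣  ≡⟨ ≡.trans (*-comm (∣ q ∣) (∣ p ∣)) (≡.sym (∣p*q∣≡∣p∣*∣q∣ p q)) ⟩
    ∣ p * q ∣      ≤⟨ h ⟩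
    ½ * ε          ∎)
    where open ≤-Reasoning

  -- (x - 1)(x + 1) = x² - 1, where x + 1 or x - 1 is bounded away from 0.
  module _ (x : ℝ) (x²≈1 : x *ℝ x ≈ℝ 1ℝ) where

    near-1 : Eventually (λ k → - ½ ≤ seq x k) → x ≈ℝ 1ℝ
    near-1 lower ε 0<ε = eventually-map₂
      (λ k l h → let p = seq x k in ½≤q⇒∣p∣≤ε (p - 1ℚ) (p + 1ℚ) (+-monoˡ-≤ 1ℚ l)
        (≡.subst (λ t → ∣ t ∣ ≤ ½ * ε) (solve 1 (λ p → p :* p :- con 1ℚ := (p :- con 1ℚ) :* (p :+ con 1ℚ)) ≡.refl p) h))
      lower (x²≈1 (½ * ε) (0<½* 0<ε))

    near-[-1] : Eventually (λ k → seq x k ≤ ½) → x ≈ℝ -ℝ 1ℝ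
    near-[-1] upper ε 0<ε = eventually-map₂
      (λ k u h → let p = seq x k in ½≤q⇒∣p∣≤ε (p - - 1ℚ) (1ℚ - p) (+-monoʳ-≤ 1ℚ (neg-antimono-≤ u))
        (≡.subst (_≤ ½ * ε) (≡.trans (∣-∣-sym (p * p) 1ℚ)
          (≡.cong ∣_∣ (solve 1 (λ p → con 1ℚ :- p :* p := (p :- (:- con 1ℚ)) :* (con 1ℚ :- p)) ≡.refl p))) h))
      upper (x²≈1 (½ * ε) (0<½* 0<ε))

    -- The sign is read off a single rational entry, chosen so late that all further entries are
    -- within 1/2 of it. They then stay at distance at least 1/2 from the other root.
    square≈1⇒sign : x ≈ℝ 1ℝ ⊎ x ≈ℝ -ℝ 1ℝ
    square≈1⇒sign with cauchy x ½ (positive⁻¹ ½)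
    ... | N , h with ≤-total 0ℚ (seq x N)
    ...   | inj₁ 0≤xN = inj₁ (near-1 (N , λ k N≤k → neg-½≤ (≤-trans 0≤xN (∣-∣≤⇒≤+ (h N k ℕ.≤-refl N≤k)))))
      where
      neg-½≤ : ∀ {p} → 0ℚ ≤ p + ½ → - ½ ≤ p
      neg-½≤ {p} q = ≡.subst (- ½ ≤_) (solve 1 (λ p → p :+ con ½ :- con ½ := p) ≡.refl p) (+-monoˡ-≤ (- ½) q)
    ...   | inj₂ xN≤0 = inj₂ (near-[-1] (N , λ k N≤k → ≤-trans (∣-∣≤⇒≤+ (h k N N≤k ℕ.≤-refl)) (+-monoˡ-≤ ½ xN≤0)))

  normSq : ℂ → ℝ
  normSq z = re z *ℝ re z +ℝ im z *ℝ im z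

  0≤normSq : ∀ z k → 0ℚ ≤ seq (normSq z) k
  0≤normSq z k = +-mono-≤ (0≤square (seq (re z) k)) (0≤square (seq (im z) k))

  *-conj : ∀ z → z *ℂ conj z ≈ℂ normSq z +i0
  *-conj z = pointwise (z *ℂ conj z) (normSq z +i0) λ k → let a = seq (re z) k ; b = seq (im z) k in
    ≡.cong₂ _,_ (solve 2 (λ a b → a :* a :- b :* (:- b) := a :* a :+ b :* b) ≡.refl a b)
                (solve 2 (λ a b → a :* (:- b) :+ b :* a := con 0ℚ) ≡.refl a b)

  unimodular⇒*-conj : ∀ z → modulus z ≈ℝ 1ℝ → z *ℂ conj z ≈ℂ 1ℂ
  unimodular⇒*-conj z ∣z∣≈1 = begin
    z *ℂ conj z         ≈⟨ *-conj z ⟩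
    normSq z +i0        ≈⟨ +i0-cong (s *ℝ s) (normSq z) (sqrt-* (normSq z) (0≤normSq z)) ⟨
    (s *ℝ s) +i0        ≈⟨ +i0-* s s ⟨
    s +i0 *ℂ s +i0      ≈⟨ S.*-cong {s +i0} {1ℂ} {s +i0} {1ℂ} s≈1 s≈1 ⟩
    1ℂ *ℂ 1ℂ            ≈⟨ S.*-identityˡ 1ℂ ⟩
    1ℂ                  ∎
    where
    open SetoidReasoning S.setoid
    s = modulus z
    s≈1 : s +i0 ≈ℂ 1ℂ
    s≈1 = +i0-cong s 1ℝ ∣z∣≈1

  -- The modulus solves t² = 1, and its approximations are nonnegative, which leaves the root 1.
  *-conj⇒unimodular : ∀ z → z *ℂ conj z ≈ℂ 1ℂ → modulus z ≈ℝ 1ℝ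
  *-conj⇒unimodular z h = near-1 (modulus z)
    (R.trans {modulus z *ℝ modulus z} {normSq z} {1ℝ} (sqrt-* (normSq z) (0≤normSq z))
      (proj₁ (S.trans {normSq z +i0} {z *ℂ conj z} {1ℂ} (S.sym {z *ℂ conj z} {normSq z +i0} (*-conj z)) h)))
    (always λ k → ≤-trans (<⇒≤ (negative⁻¹ (- ½))) (0≤sqrt (normSq z) k))

  fromℕ-+i0 : ∀ n → fromℚ (fromℕ n) +i0 ≈ℂ n · 1ℂ
  fromℕ-+i0 n = pointwise (fromℚ (fromℕ n) +i0) (n · 1ℂ) (go n)
    where
    go : ∀ n k → (fromℚ (fromℕ n) +i0) at k ≡ (n · 1ℂ) at k
    go zero    k = ≡.refl
    go (suc n) k = ≡.trans (≡.cong (_, 0ℚ) (fromℕ-suc n)) (≡.cong ((1ℚ , 0ℚ) ⊕_) (go n k))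

  √ℕ-* : ∀ n → √ℕ n +i0 *ℂ √ℕ n +i0 ≈ℂ n · 1ℂ
  √ℕ-* n = begin
    √ℕ n +i0 *ℂ √ℕ n +i0      ≈⟨ +i0-* (√ℕ n) (√ℕ n) ⟩
    (√ℕ n *ℝ √ℕ n) +i0        ≈⟨ +i0-cong (√ℕ n *ℝ √ℕ n) (fromℚ (fromℕ n)) (sqrt-* (fromℚ (fromℕ n)) λ _ → 0≤fromℕ n) ⟩
    fromℚ (fromℕ n) +i0       ≈⟨ fromℕ-+i0 n ⟩
    n · 1ℂ                    ∎
    where open SetoidReasoning S.setoid

  -- The product is exactly 1 from the index K on. An earlier entry of x may be 0, where `1/₀_` has
  -- the default value 0.
  *-inverse : ∀ x (0<x : 0ℝ <ℝ x) → x +i0 *ℂ inverse x 0<x +i0 ≈ℂ 1ℂ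
  *-inverse x 0<x@(δ , 0<δ , K , δ≤x) = S.trans {x +i0 *ℂ inverse x 0<x +i0} {(x *ℝ inverse x 0<x) +i0} {1ℂ}
    (+i0-* x (inverse x 0<x))
    (eventually-≡⇒≈ ((x *ℝ inverse x 0<x) +i0) 1ℂ (K , λ k K≤k → ≡.cong (_, 0ℚ)
      (1/₀-inverse (seq x k) (<-≤-trans (≡.subst (0ℚ <_) (≡.sym (+-identityˡ δ)) 0<δ) (δ≤x k K≤k)))))

  ^≈^ℂ : ∀ z m → RawSemiringDefinitions._^_ (RawRing.rawSemiring ℂ-rawRing) z m ≈ℂ z ^ℂ m
  ^≈^ℂ z zero    = ≈ℂ-refl 1ℂ
  ^≈^ℂ z (suc m) = S.*-congˡ {z} {RawSemiringDefinitions._^_ (RawRing.rawSemiring ℂ-rawRing) z m} {z ^ℂ m} (^≈^ℂ z m)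

  -- A late entry of x is compared with ε/2 in ℚ. If it is larger, all later entries are at least
  -- ε/4, so x would be positive; otherwise they are at most ε.
  ¬positive⇒≈0 : ∀ x → (∀ k → 0ℚ ≤ seq x k) → ¬ 0ℝ <ℝ x → x ≈ℝ 0ℝ
  ¬positive⇒≈0 x 0≤x ¬0<x ε 0<ε with cauchy x (½ * (½ * ε)) (0<½* (0<½* 0<ε))
  ... | N , near with seq x N ≤? ½ * ε
  ...   | yes xN≤h = N , λ k N≤k → ≤+⇒∣-∣≤
    (begin
      seq x k               ≤⟨ ∣-∣≤⇒≤+ (near k N N≤k ℕ.≤-refl) ⟩
      seq x N + ½ * h       ≤⟨ +-mono-≤ xN≤h (≤-trans (p≤p+q (<⇒≤ (0<½* (0<½* 0<ε)))) (≤-reflexive (½+½ h))) ⟩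
      h + h                 ≡⟨ ≡.trans (½+½ ε) (≡.sym (+-identityˡ ε)) ⟩
      0ℚ + ε                ∎)
    (≤-trans (0≤x k) (p≤p+q (<⇒≤ 0<ε)))
    where
    open ≤-Reasoning
    h = ½ * ε
  ...   | no xN≰h = contradiction (g , 0<½* (0<½* 0<ε) , N , λ k N≤k → begin
      0ℚ + g                ≡⟨ solve 1 (λ g → con 0ℚ :+ g := g :+ g :- g) ≡.refl g ⟩
      g + g - g             ≡⟨ ≡.cong (_- g) (½+½ (½ * ε)) ⟩
      ½ * ε - g             ≤⟨ +-monoˡ-≤ (- g) (≤-trans (<⇒≤ (≰⇒> xN≰h)) (∣-∣≤⇒≤+ (near N k ℕ.≤-refl N≤k))) ⟩
      seq x k + g - g       ≡⟨ solve 2 (λ x g → x :+ g :- g := x) ≡.refl (seq x k) g ⟩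
      seq x k               ∎) ¬0<x
    where
    open ≤-Reasoning
    g = ½ * (½ * ε)

  square≤⇒≈0 : ∀ x y → (∀ k → seq x k * seq x k ≤ seq y k) → y ≈ℝ 0ℝ → x ≈ℝ 0ℝ
  square≤⇒≈0 x y x²≤y y≈0 ε 0<ε = eventually-map (λ k h → ≮⇒≥ λ ε<p → <-irrefl ≡.refl (begin-strict
      ε * ε                      <⟨ *-monoʳ-<-pos ε {{positive 0<ε}} ε<p ⟩
      ε * P k                    ≤⟨ *-monoʳ-≤-nonNeg (P k) {{nonNegative (0≤∣p∣ (seq x k - 0ℚ))}} (<⇒≤ ε<p) ⟩
      P k * P k                  ≡⟨ ∣p*q∣≡∣p∣*∣q∣ (seq x k - 0ℚ) (seq x k - 0ℚ) ⟨
      ∣ (seq x k - 0ℚ) * (seq x k - 0ℚ) ∣ ≡⟨ ≡.cong ∣_∣ (solve 1 (λ p → (p :- con 0ℚ) :* (p :- con 0ℚ) := p :* p) ≡.refl (seq x k)) ⟩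
      ∣ seq x k * seq x k ∣      ≡⟨ 0≤p⇒∣p∣≡p (0≤square (seq x k)) ⟩
      seq x k * seq x k          ≤⟨ x²≤y k ⟩
      seq y k                    ≡⟨ +-identityʳ (seq y k) ⟨
      seq y k - 0ℚ               ≤⟨ p≤∣p∣ (seq y k - 0ℚ) ⟩
      ∣ seq y k - 0ℚ ∣           ≤⟨ h ⟩
      ε * ε                      ∎))
    (y≈0 (ε * ε) (0<* 0<ε 0<ε))
    where
    open ≤-Reasoning
    P : ℕ → ℚ
    P k = ∣ seq x k - 0ℚ ∣

  -- Division by x is impossible, since x ≠ 0 yields no positive lower bound for |x|. Instead, if
  -- |z|² were positive, z would be invertible and x would be 0. So |z|² is not positive, hence 0.
  *ℂ-cancel : ∀ {x z} → x *ℂ z ≈ℂ 0ℂ → ¬ x ≈ℂ 0ℂ → z ≈ℂ 0ℂ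
  *ℂ-cancel {x} {z} xz≈0 x≉0 =
    square≤⇒≈0 (re z) (normSq z) (λ k → p≤p+q (0≤square (seq (im z) k))) normSq≈0 ,
    square≤⇒≈0 (im z) (normSq z) (λ k → ≤-trans (p≤p+q (0≤square (seq (re z) k)))
      (≤-reflexive (+-comm (seq (im z) k * seq (im z) k) (seq (re z) k * seq (re z) k)))) normSq≈0
    where
    normSq≈0 : normSq z ≈ℝ 0ℝ
    normSq≈0 = ¬positive⇒≈0 (normSq z) (0≤normSq z) λ 0<z → let v = inverse (normSq z) 0<z +i0 in
      x≉0 (S.*-unit-cancel {x} {z} {v} xz≈0
        (S.trans {z *ℂ conj z *ℂ v} {normSq z +i0 *ℂ v} {1ℂ} (S.*-congʳ {v} {z *ℂ conj z} {normSq z +i0} (*-conj z)) (*-inverse (normSq z) 0<z)))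

  im≈0⇒real : ∀ z → im z ≈ℝ 0ℝ → conj z ≈ℂ z
  im≈0⇒real z h = R.refl {re z} ,
    λ ε 0<ε → eventually-map (λ k p → let b = seq (im z) k in begin
      ∣ - b - b ∣                        ≡⟨ ≡.cong ∣_∣ (solve 1 (λ b → :- b :- b := (:- (b :- con 0ℚ)) :- (b :- con 0ℚ)) ≡.refl b) ⟩
      ∣ - (b - 0ℚ) - (b - 0ℚ) ∣          ≤⟨ ∣p-q∣≤∣p∣+∣q∣ (- (b - 0ℚ)) (b - 0ℚ) ⟩
      ∣ - (b - 0ℚ) ∣ + ∣ b - 0ℚ ∣        ≤⟨ +-mono-≤ (≤-trans (≤-reflexive (∣-p∣≡∣p∣ (b - 0ℚ))) p) p ⟩
      ½ * ε + ½ * ε                      ≡⟨ ½+½ ε ⟩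
      ε                                  ∎) (h (½ * ε) (0<½* 0<ε))
    where open ≤-Reasoning

  real⇒im≈0 : ∀ z → conj z ≈ℂ z → im z ≈ℝ 0ℝ
  real⇒im≈0 z (_ , h) ε 0<ε = eventually-map (λ k p → let b = seq (im z) k in begin
      ∣ b - 0ℚ ∣                 ≡⟨ ≡.trans (≡.sym (∣-p∣≡∣p∣ (b - 0ℚ))) (≡.cong ∣_∣ (solve 1 (λ b → :- (b :- con 0ℚ) := con ½ :* (:- b :- b)) ≡.refl b)) ⟩
      ∣ ½ * (- b - b) ∣          ≡⟨ ∣p*q∣≡∣p∣*∣q∣ ½ (- b - b) ⟩
      ½ * ∣ - b - b ∣            ≤⟨ *-monoˡ-≤-nonNeg ½ p ⟩
      ½ * ε                      ≤⟨ p≤p+q (<⇒≤ (0<½* 0<ε)) ⟩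
      ½ * ε + ½ * ε              ≡⟨ ½+½ ε ⟩
      ε                          ∎) (h ε 0<ε)
    where open ≤-Reasoning

  real-unimodular⇒sign : ∀ z → conj z ≈ℂ z → modulus z ≈ℝ 1ℝ → z ≈ℂ 1ℂ ⊎ z ≈ℂ -ℂ 1ℂ
  real-unimodular⇒sign z real ∣z∣≈1 =
    Sum.map (λ p → p , real⇒im≈0 z real) (λ p → p , real⇒im≈0 z real) (square≈1⇒sign (re z) re²≈1)
    where
    open SetoidReasoning S.setoid
    z≈re : re z +i0 ≈ℂ z
    z≈re = R.refl {re z} , R.sym {im z} {0ℝ} (real⇒im≈0 z real)
    re²≈1 : re z *ℝ re z ≈ℝ 1ℝ
    re²≈1 = proj₁ (begin
      (re z *ℝ re z) +i0     ≈⟨ +i0-* (re z) (re z) ⟨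
      re z +i0 *ℂ re z +i0   ≈⟨ S.*-cong {re z +i0} {z} {re z +i0} {conj z} z≈re
                                  (S.trans {re z +i0} {z} {conj z} z≈re (S.sym {conj z} {z} real)) ⟩
      z *ℂ conj z            ≈⟨ unimodular⇒*-conj z ∣z∣≈1 ⟩
      1ℂ                     ∎)

  sign⇒real : ∀ z → z ≈ℂ 1ℂ ⊎ z ≈ℂ -ℂ 1ℂ → conj z ≈ℂ z
  sign⇒real z (inj₁ (_ , q)) = im≈0⇒real z q
  sign⇒real z (inj₂ (_ , q)) = im≈0⇒real z q

-- The Fourier matrix and the transform

-- t and u stand for π / n and 2π / n.
module Roots (π : ℝ) (isPi : IsPi π) (n : ℕ) .{{_ : NonZero n}} (t u : ℝ)
             (t≡ : ∀ k → seq t k ≡ 1/ℕ n ℚ.* seq π k) (u≡ : ∀ k → seq u k ≡ fromℕ 2 ℚ.* 1/ℕ n ℚ.* seq π k) where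
  open ComplexLimits
  open ComplexExponential
  open RealRoots
  open import Data.Rational.Base hiding (_⊔_; NonZero)
  open import Data.Rational.Properties
  open +-*-Solver using (solve; _:=_; _:+_; _:*_; _:-_; :-_; con)
  private module S = StarRing ℂ-starRing

  0<fromℕ : ∀ {d} → 0 ℕ.< d → 0ℚ < fromℕ d
  0<fromℕ {suc d} _ = positive⁻¹ (fromℕ (suc d))

  0<1/ℕ : 0ℚ < 1/ℕ n
  0<1/ℕ = positive⁻¹ (1/ℕ n) {{normalize-pos 1 n}}

  fromℕ-+ : ∀ m k → fromℕ (m ℕ.+ k) ≡ fromℕ m + fromℕ k
  fromℕ-+ zero    k = ≡.sym (+-identityˡ (fromℕ k))
  fromℕ-+ (suc m) k = ≡.trans (fromℕ-suc (m ℕ.+ k)) (≡.trans (≡.cong (1ℚ +_) (fromℕ-+ m k))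
    (≡.trans (≡.sym (+-assoc 1ℚ (fromℕ m) (fromℕ k))) (≡.cong (_+ fromℕ k) (≡.sym (fromℕ-suc m)))))

  n*t≡π : ∀ k → fromℕ n * seq t k ≡ seq π k
  n*t≡π k = ≡.trans (≡.cong (fromℕ n *_) (t≡ k)) (≡.trans (≡.sym (*-assoc (fromℕ n) (1/ℕ n) (seq π k)))
    (≡.trans (≡.cong (_* seq π k) (fromℕ*1/ℕ n)) (*-identityˡ (seq π k))))

  0ℝ<t : 0ℝ <ℝ t
  0ℝ<t = let (δ , 0<δ , N , δ≤π) = proj₁ isPi in
    1/ℕ n * δ , 0<* 0<1/ℕ 0<δ , N , λ k N≤k → begin
      0ℚ + 1/ℕ n * δ      ≡⟨ +-identityˡ (1/ℕ n * δ) ⟩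
      1/ℕ n * δ           ≡⟨ ≡.cong (1/ℕ n *_) (+-identityˡ δ) ⟨
      1/ℕ n * (0ℚ + δ)    ≤⟨ *-monoˡ-≤-nonNeg (1/ℕ n) {{nonNegative (<⇒≤ 0<1/ℕ)}} (δ≤π k N≤k) ⟩
      1/ℕ n * seq π k     ≡⟨ t≡ k ⟨
      seq t k             ∎
    where open ≤-Reasoning

  multiple-lower : ∀ d δ k → 0ℚ + δ ≤ seq t k → fromℕ d * δ ≤ fromℕ d * seq t k
  multiple-lower d δ k h = *-monoˡ-≤-nonNeg (fromℕ d) {{nonNegative (0≤fromℕ d)}}
    (≤-trans (≤-reflexive (≡.sym (+-identityˡ δ))) h)

  0<multiple : 0ℝ <ℝ t → ∀ d → 0 ℕ.< d → 0ℝ <ℝ fromℚ (fromℕ d) *ℝ t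
  0<multiple (δ , 0<δ , N , δ≤t) d 0<d = fromℕ d * δ , 0<* (0<fromℕ 0<d) 0<δ , N , λ k N≤k →
    ≤-trans (≤-reflexive (+-identityˡ (fromℕ d * δ))) (multiple-lower d δ k (δ≤t k N≤k))

  -- As π = n t, the gap is (n - d) t, at least (n - d) δ.
  multiple<π : 0ℝ <ℝ t → ∀ d → d ℕ.< n → fromℚ (fromℕ d) *ℝ t <ℝ π
  multiple<π (δ , 0<δ , N , δ≤t) d d<n = let p = fromℕ d ; r = fromℕ (n ℕ.∸ d) in
    r * δ , 0<* (0<fromℕ (ℕ.m<n⇒0<n∸m d<n)) 0<δ , N , λ k N≤k → let x = seq t k in begin
      p * x + r * δ         ≤⟨ +-monoʳ-≤ (p * x) (multiple-lower (n ℕ.∸ d) δ k (δ≤t k N≤k)) ⟩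
      p * x + r * x         ≡⟨ *-distribʳ-+ x p r ⟨
      (p + r) * x           ≡⟨ ≡.cong (_* x) (≡.trans (≡.sym (fromℕ-+ d (n ℕ.∸ d))) (≡.cong fromℕ (ℕ.m+[n∸m]≡n (ℕ.<⇒≤ d<n)))) ⟩
      fromℕ n * x           ≡⟨ n*t≡π k ⟩
      seq π k               ∎
    where open ≤-Reasoning

  conj-fixed-cong : ∀ x y → x ≈ℂ y → conj y ≈ℂ y → conj x ≈ℂ x
  conj-fixed-cong x y x≈y real = S.trans {conj x} {conj y} {x} (S.conj-cong {x} {y} x≈y)
    (S.trans {conj y} {y} {x} real (S.sym {x} {y} x≈y))

  eⁿ-real : conj (cis t ^ℂ n) ≈ℂ cis t ^ℂ n
  eⁿ-real = conj-fixed-cong (cis t ^ℂ n) (cis π)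
    (S.trans {cis t ^ℂ n} {cis (fromℚ (fromℕ n) *ℝ t)} {cis π} (cis-multiple t n) (cis-cong (fromℚ (fromℕ n) *ℝ t) π n*t≡π))
    (im≈0⇒real (cis π) (sin≈0⇒im-cis≈0 π (proj₁ (proj₂ isPi))))

  eᵈ-nonreal : ∀ d → 0 ℕ.< d → d ℕ.< n → ¬ conj (cis t ^ℂ d) ≈ℂ cis t ^ℂ d
  eᵈ-nonreal d 0<d d<n real = proj₂ (proj₂ isPi) (fromℚ (fromℕ d) *ℝ t) (0<multiple 0ℝ<t d 0<d) (multiple<π 0ℝ<t d d<n)
    (im-cis≈0⇒sin≈0 (fromℚ (fromℕ d) *ℝ t) (real⇒im≈0 (cis (fromℚ (fromℕ d) *ℝ t))
      (conj-fixed-cong (cis (fromℚ (fromℕ d) *ℝ t)) (cis t ^ℂ d)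
        (S.sym {cis t ^ℂ d} {cis (fromℚ (fromℕ d) *ℝ t)} (cis-multiple t d)) real)))

  t+t≡u : ∀ k → seq t k + seq t k ≡ seq u k
  t+t≡u k = begin
    seq t k + seq t k              ≡⟨ ≡.cong₂ _+_ (t≡ k) (t≡ k) ⟩
    p * q + p * q                  ≡⟨ solve 2 (λ p q → p :* q :+ p :* q := (con 1ℚ :+ con 1ℚ) :* p :* q) ≡.refl p q ⟩
    fromℕ 2 * p * q                ≡⟨ u≡ k ⟨
    seq u k                        ∎
    where
    open ≡.≡-Reasoning
    p = 1/ℕ n
    q = seq π k

  root≈e² : exp (0ℝ +i u) ≈ℂ cis t *ℂ cis t
  root≈e² = S.trans {exp (0ℝ +i u)} {cis u} {cis t *ℂ cis t} (exp≈cis u)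
    (S.sym {cis t *ℂ cis t} {cis u} (cis-step t t u {cis t} t+t≡u (≈ℂ-refl (cis t))))

  ≡·⇒≈* : ∀ x a z → a ≡ x ·ℂ z → a ≈ℂ x +i0 *ℂ z
  ≡·⇒≈* x a z ≡.refl = ·ℂ≈*ℂ x z

  open RawSemiringDefinitions (Semiring.rawSemiring (CommutativeRing.semiring ℂ-commutativeRing)) using () renaming (_×_ to _·_)

  module _ (ζ : ℂ) (ζ≡exp : ζ ≡ exp (0ℝ +i u)) where

    ζ≈e² : ζ ≈ℂ cis t *ℂ cis t
    ζ≈e² = ≡.subst (λ z → z ≈ℂ cis t *ℂ cis t) (≡.sym ζ≡exp) root≈e²

    -- `x`, `y`, `E` and `A` stand for 1/√n, √n, the powers of w and F. As variables with equations
    -- they keep the exponential from being unfolded.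
    module _ (x y : ℝ) (y*x≈1 : y +i0 *ℂ x +i0 ≈ℂ 1ℂ) (y*y≈n : y +i0 *ℂ y +i0 ≈ℂ n · 1ℂ)
             (E : ℕ → ℂ) (E≈ : ∀ m → E m ≈ℂ ζ ^ℂ m) (A : Matrix n)
             (A≡ : ∀ i j → A i j ≡ x ·ℂ E (toℕ i ℕ.* toℕ j)) where

      A≈ : ∀ i j → A i j ≈ℂ x +i0 *ℂ E (toℕ i ℕ.* toℕ j)
      A≈ i j = ≡·⇒≈* x (A i j) (E (toℕ i ℕ.* toℕ j)) (A≡ i j)

      fourier-table : Matrices.IsCharacterTable ℂ-starRing n (y +i0) (x +i0) A (λ i j → conj (A i j))
      fourier-table = Matrices.root-table ℂ-starRing n {e = cis t} {ζ = ζ}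
        y*x≈1 y*y≈n (conj-real x) (cis-unimodular t) eⁿ-real eᵈ-nonreal
        (λ {x} {z} → *ℂ-cancel {x} {z}) ζ≈e² {p = E} E≈ A≈ (λ i j → ≈ℂ-refl (conj (A i j)))

-- The transform on circulant complex matrices

module CirculantTransform (n : ℕ) .{{_ : NonZero n}} (x y : ℝ) where
  open ComplexLimits
  open ComplexExponential
  open RealRoots
  private
    module S = StarRing ℂ-starRing
    module M = Matrices ℂ-starRing
    module ≈ᴹ = Setoid (≈ᴹ-setoid n)

  -- Agda cannot compare the matrices of Defs with the instance of Matrices by
  -- conversion in reasonable time, so entries are related by sum-bridge.
  sum-bridge : ∀ {m} (f g : Fin m → ℂ) → (∀ k → f k ≈ℂ g k) → ∑ f ≈ℂ Matrices.sum ℂ-starRing g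
  sum-bridge {zero}  f g f≈g = ≈ℂ-refl 0ℂ
  sum-bridge {suc m} f g f≈g = S.+-cong {f zero} {g zero} {∑ (λ k → f (suc k))} {Matrices.sum ℂ-starRing (λ k → g (suc k))}
    (f≈g zero) (sum-bridge (λ k → f (suc k)) (λ k → g (suc k)) (λ k → f≈g (suc k)))

  module _ (A A′ B B′ C : Matrix n) (A≈A′ : A ≈ᴹ A′) (B≈B′ : B ≈ᴹ B′) where

    *ᴹ-bridge : ∀ i j → (A *ᴹ B) i j ≈ℂ Matrices._*ᴹ_ ℂ-starRing A′ B′ i j
    *ᴹ-bridge i j = sum-bridge (λ k → A i k *ℂ B k j) _
      (λ k → S.*-cong {A i k} {A′ i k} {B k j} {B′ k j} (A≈A′ i k) (B≈B′ k j))

    *ᴹ≈⇒M : A *ᴹ B ≈ᴹ C → ∀ i j → Matrices._*ᴹ_ ℂ-starRing A′ B′ i j ≈ℂ C i j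
    *ᴹ≈⇒M h i j = S.trans {Matrices._*ᴹ_ ℂ-starRing A′ B′ i j} {(A *ᴹ B) i j} {C i j}
      (S.sym {(A *ᴹ B) i j} {Matrices._*ᴹ_ ℂ-starRing A′ B′ i j} (*ᴹ-bridge i j)) (h i j)

    M⇒*ᴹ≈ : (∀ i j → Matrices._*ᴹ_ ℂ-starRing A′ B′ i j ≈ℂ C i j) → A *ᴹ B ≈ᴹ C
    M⇒*ᴹ≈ h i j = S.trans {(A *ᴹ B) i j} {Matrices._*ᴹ_ ℂ-starRing A′ B′ i j} {C i j} (*ᴹ-bridge i j) (h i j)

  module _ (U : Matrix n) where
    private
      U≈U : U ≈ᴹ U
      U≈U i j = ≈ℂ-refl (U i j)
      U*≈U* : ∀ i j → adjoint U i j ≈ℂ Matrices.adjoint ℂ-starRing U i j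
      U*≈U* i j = ≈ℂ-refl (conj (U j i))

    IsUnitary⇒M : IsUnitary U → Matrices.IsUnitary ℂ-starRing U
    IsUnitary⇒M (p , q) =
      *ᴹ≈⇒M U U (adjoint U) (Matrices.adjoint ℂ-starRing U) identity U≈U U*≈U* p ,
      *ᴹ≈⇒M (adjoint U) (Matrices.adjoint ℂ-starRing U) U U identity U*≈U* U≈U q

    M⇒IsUnitary : Matrices.IsUnitary ℂ-starRing U → IsUnitary U
    M⇒IsUnitary (p , q) =
      M⇒*ᴹ≈ U U (adjoint U) (Matrices.adjoint ℂ-starRing U) identity U≈U U*≈U* p ,
      M⇒*ᴹ≈ (adjoint U) (Matrices.adjoint ℂ-starRing U) U U identity U*≈U* U≈U q

  IsUnitary-cong : (U V : Matrix n) → U ≈ᴹ V → IsUnitary U → IsUnitary V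
  IsUnitary-cong U V U≈V h = M⇒IsUnitary V (Matrices.IsUnitary-cong ℂ-starRing {n} {U} {V} U≈V (IsUnitary⇒M U h))

  IsUnitary-orthogonal : (U : Matrix n) → (∀ i j → conj (U i j) ≈ℂ U i j) → IsUnitary U → IsOrthogonal U
  IsUnitary-orthogonal U real (p , q) = (λ i j → real⇒im≈0 (U i j) (real i j)) ,
    M.≈ᴹ-trans {n} {U *ᴹ transpose U} {U *ᴹ adjoint U} {identity}
      (M.*ᴹ-cong {n} {U} {U} {transpose U} {adjoint U} (λ i j → ≈ℂ-refl (U i j)) Uᵗ≈U*) p ,
    M.≈ᴹ-trans {n} {transpose U *ᴹ U} {adjoint U *ᴹ U} {identity}
      (M.*ᴹ-cong {n} {transpose U} {adjoint U} {U} {U} Uᵗ≈U* (λ i j → ≈ℂ-refl (U i j))) q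
    where
    Uᵗ≈U* : transpose U ≈ᴹ adjoint U
    Uᵗ≈U* i j = S.sym {conj (U j i)} {U j i} (real j i)

  IsOrthogonal-real : (U : Matrix n) → IsOrthogonal U → ∀ i j → conj (U i j) ≈ℂ U i j
  IsOrthogonal-real U orth i j = im≈0⇒real (U i j) (proj₁ orth i j)

  IsOrthogonal-unitary : (U : Matrix n) → IsOrthogonal U → IsUnitary U
  IsOrthogonal-unitary U orth =
    M.≈ᴹ-trans {n} {U *ᴹ adjoint U} {U *ᴹ transpose U} {identity}
      (M.*ᴹ-cong {n} {U} {U} {adjoint U} {transpose U} (λ i j → ≈ℂ-refl (U i j)) U*≈Uᵗ) (proj₁ (proj₂ orth)) ,
    M.≈ᴹ-trans {n} {adjoint U *ᴹ U} {transpose U *ᴹ U} {identity}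
      (M.*ᴹ-cong {n} {adjoint U} {transpose U} {U} {U} U*≈Uᵗ (λ i j → ≈ℂ-refl (U i j))) (proj₂ (proj₂ orth))
    where
    U*≈Uᵗ : adjoint U ≈ᴹ transpose U
    U*≈Uᵗ i j = IsOrthogonal-real U orth j i

  conj-·ℂ : ∀ x z → conj z ≈ℂ z → conj (x ·ℂ z) ≈ℂ x ·ℂ z
  conj-·ℂ x z real = begin
    conj (x ·ℂ z)              ≈⟨ S.conj-cong {x ·ℂ z} {x +i0 *ℂ z} (·ℂ≈*ℂ x z) ⟩
    conj (x +i0 *ℂ z)          ≈⟨ S.conj-* (x +i0) z ⟩
    conj (x +i0) *ℂ conj z     ≈⟨ S.*-cong {conj (x +i0)} {x +i0} {conj z} {z} (conj-real x) real ⟩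
    x +i0 *ℂ z                 ≈⟨ ·ℂ≈*ℂ x z ⟨
    x ·ℂ z                     ∎
    where open SetoidReasoning S.setoid

  ·ℂ-cong : ∀ x z z′ → z ≈ℂ z′ → x ·ℂ z ≈ℂ x ·ℂ z′
  ·ℂ-cong x z z′ z≈z′ = begin
    x ·ℂ z        ≈⟨ ·ℂ≈*ℂ x z ⟩
    x +i0 *ℂ z    ≈⟨ S.*-congˡ {x +i0} {z} {z′} z≈z′ ⟩
    x +i0 *ℂ z′   ≈⟨ ·ℂ≈*ℂ x z′ ⟨
    x ·ℂ z′       ∎
    where open SetoidReasoning S.setoid

  ·ℂ-inverse : ∀ x y → x +i0 *ℂ y +i0 ≈ℂ 1ℂ → ∀ z → x ·ℂ (y ·ℂ z) ≈ℂ z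
  ·ℂ-inverse x y x*y≈1 z = begin
    x ·ℂ (y ·ℂ z)           ≈⟨ ·ℂ≈*ℂ x (y ·ℂ z) ⟩
    x +i0 *ℂ (y ·ℂ z)       ≈⟨ S.*-congˡ {x +i0} {y ·ℂ z} {y +i0 *ℂ z} (·ℂ≈*ℂ y z) ⟩
    x +i0 *ℂ (y +i0 *ℂ z)   ≈⟨ S.*-assoc (x +i0) (y +i0) z ⟨
    x +i0 *ℂ y +i0 *ℂ z     ≈⟨ S.*-congʳ {z} {x +i0 *ℂ y +i0} {1ℂ} x*y≈1 ⟩
    1ℂ *ℂ z                 ≈⟨ S.*-identityˡ z ⟩
    z                       ∎
    where open SetoidReasoning S.setoid

  *ᵛ-bridge : (A : Matrix n) (v : Fin n → ℂ) (d : Fin n) → (A *ᵛ v) d ≈ℂ Matrices._*ᵛ_ ℂ-starRing A v d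
  *ᵛ-bridge A v d = sum-bridge (λ k → A d k *ℂ v k) _ (λ k → ≈ℂ-refl (A d k *ℂ v k))

  ≡⇒≈ : (v : Fin n → ℂ) {a b : Fin n} → a ≡ b → v a ≈ℂ v b
  ≡⇒≈ v {a} ≡.refl = ≈ℂ-refl (v a)

  ≈-via : ∀ a b c d → a ≈ℂ b → b ≈ℂ c → c ≈ℂ d → a ≈ℂ d
  ≈-via a b c d p q r = S.trans {a} {b} {d} p (S.trans {b} {c} {d} q r)

  *-conj⇒ : ∀ z z′ → z ≈ℂ z′ → z *ℂ conj z ≈ℂ 1ℂ → S._*_ z′ (S.conj z′) ≈ℂ 1ℂ
  *-conj⇒ z z′ z≈z′ h = S.trans {z′ *ℂ conj z′} {z *ℂ conj z} {1ℂ}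
    (S.*-cong {z′} {z} {conj z′} {conj z} (S.sym {z} {z′} z≈z′) (S.conj-cong {z′} {z} (S.sym {z} {z′} z≈z′))) h

  *-conj⇐ : ∀ z z′ → z ≈ℂ z′ → S._*_ z′ (S.conj z′) ≈ℂ 1ℂ → z *ℂ conj z ≈ℂ 1ℂ
  *-conj⇐ z z′ z≈z′ = *-conj⇒ z′ z (S.sym {z} {z′} z≈z′)

  -- The detour through z · conj z replaces a proof that `sqrt` respects equality.
  unimodular-cong : ∀ z z′ → z ≈ℂ z′ → modulus z ≈ℝ 1ℝ → modulus z′ ≈ℝ 1ℝ
  unimodular-cong z z′ z≈z′ h = *-conj⇒unimodular z′ (*-conj⇒ z z′ z≈z′ (unimodular⇒*-conj z h))

  HasUnimodularEntries-cong : (H K : Matrix n) → H ≈ᴹ K → HasUnimodularEntries H → HasUnimodularEntries K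
  HasUnimodularEntries-cong H K H≈K h i j = unimodular-cong (H i j) (K i j) (H≈K i j) (h i j)

  -- This is `Φ` with a variable matrix in place of F: it covers the inverse transform too and hides
  -- the entries of F.
  T : Matrix n → Matrix n → Matrix n
  T A H i j = (A *ᵛ H (0 mod n)) (_-ₙ_ n j i)

  T≈transform : ∀ A H → T A H ≈ᴹ Matrices.transform ℂ-starRing n A H
  T≈transform A H i j = *ᵛ-bridge A (H (0 mod n)) (_-ₙ_ n j i)

  T-circulant : ∀ A H → IsCirculant n (T A H)
  T-circulant A H i j i′ j′ eq = ≡⇒≈ (A *ᵛ H (0 mod n)) eq

  T-via : ∀ A H K L → H ≈ᴹ K → Matrices.transform ℂ-starRing n A K ≈ᴹ L → T A H ≈ᴹ L
  T-via A H K L H≈K h i j = ≈-via (T A H i j) (Matrices.transform ℂ-starRing n A H i j) (Matrices.transform ℂ-starRing n A K i j) (L i j)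
    (T≈transform A H i j) (Matrices.transform-cong ℂ-starRing n {A} {A} {H} {K} (λ i j → ≈ℂ-refl (A i j)) H≈K i j) (h i j)

  T-cong : ∀ A H K → H ≈ᴹ K → T A H ≈ᴹ T A K
  T-cong A H K H≈K = T-via A H K (T A K) H≈K
    (λ i j → S.sym {T A K i j} {Matrices.transform ℂ-starRing n A K i j} (T≈transform A K i j))

  module _ (A B : Matrix n) (table : Matrices.IsCharacterTable ℂ-starRing n (y +i0) (x +i0) A B)
           (H : Matrix n) (circ : IsCirculant n H) where

    T-inverse : T B (T A H) ≈ᴹ H
    T-inverse = T-via B (T A H) (Matrices.transform ℂ-starRing n A H) H (T≈transform A H)
      (Matrices.transform-inverse ℂ-starRing n (conj-real x) table {H} circ)

    unitary⇒T-unimodular : IsUnitary (x ·ᴹ H) → HasUnimodularEntries (T A H)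
    unitary⇒T-unimodular h i j = *-conj⇒unimodular (T A H i j)
      (*-conj⇐ (T A H i j) (Matrices.transform ℂ-starRing n A H i j) (T≈transform A H i j)
        (Matrices.unitary⇒unimodular ℂ-starRing n (conj-real x) table {H} circ {x ·ᴹ H}
          (λ i j → ·ℂ≈*ℂ x (H i j)) (IsUnitary⇒M (x ·ᴹ H) h) (_-ₙ_ n j i)))

    T-unimodular⇒unitary : HasUnimodularEntries (T A H) → IsUnitary (x ·ᴹ H)
    T-unimodular⇒unitary h = M⇒IsUnitary (x ·ᴹ H)
      (Matrices.unimodular⇒unitary ℂ-starRing n (conj-real x) table {H} circ {x ·ᴹ H} (λ i j → ·ℂ≈*ℂ x (H i j))
        λ a → *-conj⇒ (T A H (0 mod n) a) (Matrices._*ᵛ_ ℂ-starRing A (H (0 mod n)) a)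
          (S.trans {T A H (0 mod n) a} {Matrices.transform ℂ-starRing n A H (0 mod n) a} {Matrices._*ᵛ_ ℂ-starRing A (H (0 mod n)) a}
            (T≈transform A H (0 mod n) a) (Matrices.transform-firstRow ℂ-starRing n A H a))
          (unimodular⇒*-conj (T A H (0 mod n) a) (h (0 mod n) a)))

    T-real : (∀ i j → conj (H i j) ≈ℂ H i j) → IsSelfAdjoint (T A H)
    T-real real i j = ≈-via (conj (T A H j i)) (conj (Matrices.transform ℂ-starRing n A H j i))
      (Matrices.transform ℂ-starRing n A H i j) (T A H i j)
      (S.conj-cong {T A H j i} {Matrices.transform ℂ-starRing n A H j i} (T≈transform A H j i))
      (Matrices.real⇒transform-selfAdjoint ℂ-starRing n (conj-real x) table {H} circ real i j)
      (S.sym {T A H i j} {Matrices.transform ℂ-starRing n A H i j} (T≈transform A H i j))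

    T-selfAdjoint⇒real : IsSelfAdjoint (T A H) → ∀ i j → conj (H i j) ≈ℂ H i j
    T-selfAdjoint⇒real sa = Matrices.transform-selfAdjoint⇒real ℂ-starRing n (conj-real x) table {H} circ
      λ i j → ≈-via (conj (Matrices.transform ℂ-starRing n A H j i)) (conj (T A H j i)) (T A H i j) (Matrices.transform ℂ-starRing n A H i j)
        (S.conj-cong {Matrices.transform ℂ-starRing n A H j i} {T A H j i} (S.sym {T A H j i} {Matrices.transform ℂ-starRing n A H j i} (T≈transform A H j i)))
        (sa i j) (T≈transform A H i j)

  IsSelfAdjoint-≡ : {H K : Matrix n} → H ≡ K → IsSelfAdjoint K → IsSelfAdjoint H
  IsSelfAdjoint-≡ ≡.refl h = h

  -- `C[∞]` with the variable `x` in place of 1/√n.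
  Hadamard : Matrix n → Set
  Hadamard H = IsCirculant n H × HasUnimodularEntries H × IsUnitary (x ·ᴹ H)

  ScaledUnitary ScaledOrthogonal : Matrix n → Set
  ScaledUnitary H = ∃ λ U → IsUnitary U × H ≈ᴹ y ·ᴹ U
  ScaledOrthogonal H = ∃ λ U → IsOrthogonal U × H ≈ᴹ y ·ᴹ U

  module _ (A B : Matrix n) (table : Matrices.IsCharacterTable ℂ-starRing n (y +i0) (x +i0) A B) where
    private
      y*x≈1 : y +i0 *ℂ x +i0 ≈ℂ 1ℂ
      y*x≈1 = Matrices.IsCharacterTable.s*r≈1 table

      x*y≈1 : x +i0 *ℂ y +i0 ≈ℂ 1ℂ
      x*y≈1 = S.trans {x +i0 *ℂ y +i0} {y +i0 *ℂ x +i0} {1ℂ} (S.*-comm (x +i0) (y +i0)) y*x≈1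

    -- The transform exchanges the two conditions. Unitarity of H makes the entries of the image
    -- unimodular; the unimodular entries of H, which is the inverse transform of the image, make
    -- the image unitary.
    T-hadamard : (H : Matrix n) → Hadamard H → Hadamard (T A H)
    T-hadamard H (circ , unimodular , unitary) = T-circulant A H , unitary⇒T-unimodular A B table H circ unitary ,
      T-unimodular⇒unitary B A (Matrices.swap ℂ-starRing n (conj-real x) table) (T A H) (T-circulant A H)
        (HasUnimodularEntries-cong H (T B (T A H)) (≈ᴹ.sym {T B (T A H)} {H} (T-inverse A B table H circ)) unimodular)

    scaledUnitary⇒unitary : (H : Matrix n) → ScaledUnitary H → IsUnitary (x ·ᴹ H)
    scaledUnitary⇒unitary H (U , U-unitary , H≈yU) = IsUnitary-cong U (x ·ᴹ H)
      (λ i j → S.sym {x ·ℂ H i j} {U i j} (S.trans {x ·ℂ H i j} {x ·ℂ (y ·ℂ U i j)} {U i j}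
        (·ℂ-cong x (H i j) (y ·ℂ U i j) (H≈yU i j)) (·ℂ-inverse x y x*y≈1 (U i j)))) U-unitary

    ≈y·x· : (H : Matrix n) → H ≈ᴹ y ·ᴹ (x ·ᴹ H)
    ≈y·x· H i j = S.sym {y ·ℂ (x ·ℂ H i j)} {H i j} (·ℂ-inverse y x y*x≈1 (H i j))

    scaledOrthogonal⇒real : (H : Matrix n) → ScaledOrthogonal H → ∀ i j → conj (H i j) ≈ℂ H i j
    scaledOrthogonal⇒real H (U , orth , H≈yU) i j = ≈-via (conj (H i j)) (conj (y ·ℂ U i j)) (y ·ℂ U i j) (H i j)
      (S.conj-cong {H i j} {y ·ℂ U i j} (H≈yU i j)) (conj-·ℂ y (U i j) (IsOrthogonal-real U orth i j))
      (S.sym {H i j} {y ·ℂ U i j} (H≈yU i j))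

    scaledOrthogonal⇒scaledUnitary : (H : Matrix n) → ScaledOrthogonal H → ScaledUnitary H
    scaledOrthogonal⇒scaledUnitary H (U , orth , H≈yU) = U , IsOrthogonal-unitary U orth , H≈yU

    module _ (H : Matrix n) (circ : IsCirculant n H) where

      scaledUnitary⇔ : ScaledUnitary H ⇔ HasUnimodularEntries (T A H)
      scaledUnitary⇔ = mk⇔
        (λ h → unitary⇒T-unimodular A B table H circ (scaledUnitary⇒unitary H h))
        (λ h → x ·ᴹ H , T-unimodular⇒unitary A B table H circ h , ≈y·x· H)

      scaledOrthogonal⇔ : ScaledOrthogonal H ⇔ (IsSelfAdjoint (T A H) × HasUnimodularEntries (T A H))
      scaledOrthogonal⇔ = mk⇔
        (λ h → T-real A B table H circ (scaledOrthogonal⇒real H h) ,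
               unitary⇒T-unimodular A B table H circ (scaledUnitary⇒unitary H (scaledOrthogonal⇒scaledUnitary H h)))
        (λ (sa , h) → x ·ᴹ H ,
          IsUnitary-orthogonal (x ·ᴹ H) (λ i j → conj-·ℂ x (H i j) (T-selfAdjoint⇒real A B table H circ sa i j))
            (T-unimodular⇒unitary A B table H circ h) ,
          ≈y·x· H)

  module _ (A B : Matrix n) (table : Matrices.IsCharacterTable ℂ-starRing n (y +i0) (x +i0) A B) where
    private
      table⁻¹ : Matrices.IsCharacterTable ℂ-starRing n (y +i0) (x +i0) B A
      table⁻¹ = Matrices.swap ℂ-starRing n (conj-real x) table

    T-injective : (H K : Matrix n) → IsCirculant n H → IsCirculant n K → T A H ≈ᴹ T A K → H ≈ᴹ K
    T-injective H K circH circK TH≈TK = ≈ᴹ.trans {H} {T B (T A H)} {K} (≈ᴹ.sym {T B (T A H)} {H} (T-inverse A B table H circH))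
      (≈ᴹ.trans {T B (T A H)} {T B (T A K)} {K} (T-cong B (T A H) (T A K) TH≈TK) (T-inverse A B table K circK))

    -- The preimage is real because its transform K is self-adjoint, and its entries are unimodular
    -- because K is unitary up to scaling. A real number of modulus 1 is a sign.
    selfAdjoint-preimage : (K : Matrix n) → Hadamard K → IsSelfAdjoint K →
      HasSignEntries (T B K)
    selfAdjoint-preimage K k sa i j = real-unimodular⇒sign (T B K i j)
      (T-selfAdjoint⇒real A B table (T B K) (T-circulant B K) TBK-selfAdjoint i j)
      (unitary⇒T-unimodular B A table⁻¹ K (proj₁ k) (proj₂ (proj₂ k)) i j)
      where
      T-T⁻¹ : T A (T B K) ≈ᴹ K
      T-T⁻¹ = T-inverse B A table⁻¹ K (proj₁ k)
      TBK-selfAdjoint : IsSelfAdjoint (T A (T B K))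
      TBK-selfAdjoint i j = ≈-via (conj (T A (T B K) j i)) (conj (K j i)) (K i j) (T A (T B K) i j)
        (S.conj-cong {T A (T B K) j i} {K j i} (T-T⁻¹ j i)) (sa i j) (S.sym {T A (T B K) i j} {K i j} (T-T⁻¹ i j))

    sign⇒T-selfAdjoint : (H : Matrix n) → IsCirculant n H → HasSignEntries H → IsSelfAdjoint (T A H)
    sign⇒T-selfAdjoint H circ signs = T-real A B table H circ λ i j → sign⇒real (H i j) (signs i j)

    -- `P` becomes `C[∞] n`, with the identity for both conversions. As a variable it stays folded
    -- in the types below.
    module _ (P : Matrix n → Set) (P⇒ : ∀ H → P H → Hadamard H) (⇒P : ∀ H → Hadamard H → P H) where

      T-P : ∀ H → P H → P (T A H)
      T-P H p = ⇒P (T A H) (T-hadamard A B table H (P⇒ H p))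

      T⁻¹-P : ∀ H → P H → P (T B H)
      T⁻¹-P H p = ⇒P (T B H) (T-hadamard B A table⁻¹ H (P⇒ H p))

      P-circulant : (H : ∃ P) → IsCirculant n (proj₁ H)
      P-circulant H = proj₁ (P⇒ (proj₁ H) (proj₂ H))

      transformBijection : Bijection (On.setoid {B = ∃ P} (≈ᴹ-setoid n) proj₁) (On.setoid {B = ∃ P} (≈ᴹ-setoid n) proj₁)
      transformBijection = record
        { to        = λ H → T A (proj₁ H) , T-P (proj₁ H) (proj₂ H)
        ; cong      = λ {H} {K} → T-cong A (proj₁ H) (proj₁ K)
        ; bijective = (λ {H} {K} → T-injective (proj₁ H) (proj₁ K) (P-circulant H) (P-circulant K)) ,
            λ K → (T B (proj₁ K) , T⁻¹-P (proj₁ K) (proj₂ K)) ,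
              λ {Z} Z≈ → ≈ᴹ.trans {T A (proj₁ Z)} {T A (T B (proj₁ K))} {proj₁ K}
                (T-cong A (proj₁ Z) (T B (proj₁ K)) Z≈) (T-inverse B A table⁻¹ (proj₁ K) (P-circulant K))
        }

      to-selfAdjoint : (H : ∃ P) → HasSignEntries (proj₁ H) → IsSelfAdjoint (proj₁ (to transformBijection H))
      to-selfAdjoint H signs = IsSelfAdjoint-≡ {proj₁ (to transformBijection H)} {T A (proj₁ H)} ≡.refl
        (sign⇒T-selfAdjoint (proj₁ H) (P-circulant H) signs)

      transform-theorem :
        (Σ[ φ ∈ Bijection (On.setoid {B = ∃ P} (≈ᴹ-setoid n) proj₁) (On.setoid {B = ∃ P} (≈ᴹ-setoid n) proj₁) ]
          (∀ (H : ∃ P) → proj₁ (to φ H) ≈ᴹ T A (proj₁ H))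
          × (∀ (H : ∃ P) → P (proj₁ H) × HasSignEntries (proj₁ H) → P (proj₁ (to φ H)) × IsSelfAdjoint (proj₁ (to φ H)))
          × (∀ (K : ∃ P) → P (proj₁ K) × IsSelfAdjoint (proj₁ K) →
               Σ[ H ∈ ∃ P ] ((P (proj₁ H) × HasSignEntries (proj₁ H)) × proj₁ (to φ H) ≈ᴹ proj₁ K)))
        × (∀ (H : Matrix n) → IsCirculant n H →
             (ScaledUnitary H ⇔ HasUnimodularEntries (T A H))
           × (ScaledOrthogonal H ⇔ (IsSelfAdjoint (T A H) × HasUnimodularEntries (T A H))))
      transform-theorem =
        ( transformBijection
        , (λ H → ≈ᴹ.refl {T A (proj₁ H)})
        , (λ H h → proj₂ (to transformBijection H) , to-selfAdjoint H (proj₂ h))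
        , (λ K k → (T B (proj₁ K) , T⁻¹-P (proj₁ K) (proj₂ K)) ,
            (T⁻¹-P (proj₁ K) (proj₂ K) , selfAdjoint-preimage (proj₁ K) (P⇒ (proj₁ K) (proj₂ K)) (proj₂ k)) ,
            T-inverse B A table⁻¹ (proj₁ K) (P-circulant K))
        ) ,
        (λ H circ → scaledUnitary⇔ A B table H circ , scaledOrthogonal⇔ A B table H circ)

-- Specialisation to the Fourier matrix

open ComplexLimits using (ℂ-starRing)
open RealRoots using (_+i0; *-inverse; √ℕ-*; ^≈^ℂ)

seq-fromℚ-* : ∀ q x k → seq (fromℚ q *ℝ x) k ≡ q ℚ.* seq x k
seq-fromℚ-* q x k = ≡.refl

w-unfold : ∀ π n → .{{_ : NonZero n}} → w n π ≡ exp (0ℝ +i (fromℚ (fromℕ 2 ℚ.* 1/ℕ n) *ℝ π))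
w-unfold π n = ≡.refl

-- The operator _^ℂ_ of Defs is unfolded, as it is in the reduct of F.
F-unfold : ∀ π n → .{{_ : NonZero n}} → ∀ i j →
  F n π i j ≡ 1/√ n ·ℂ RawSemiringDefinitions._^_ (RawRing.rawSemiring ℂ-rawRing) (w n π) (toℕ i ℕ.* toℕ j)
F-unfold π n i j = ≡.refl

-- Explicit instances make both sides of the conversion checks syntactically
-- equal; otherwise the Cauchy moduli of the real numbers are compared.
fourierTable : ∀ π → IsPi π → ∀ n → .{{q : NonZero n}} →
  Matrices.IsCharacterTable ℂ-starRing n (√ℕ n +i0) (1/√ n +i0) (F n {{q}} π) (λ i j → conj (F n {{q}} π i j))
fourierTable π isPi n {{q}} = Roots.fourier-table π isPi n {{q}}
  (fromℚ ((1/ℕ n) {{q}}) *ℝ π) (fromℚ (fromℕ 2 ℚ.* (1/ℕ n) {{q}}) *ℝ π)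
  (seq-fromℚ-* ((1/ℕ n) {{q}}) π) (seq-fromℚ-* (fromℕ 2 ℚ.* (1/ℕ n) {{q}}) π)
  (w n {{q}} π) (w-unfold π n {{q}}) (1/√ n {{q}}) (√ℕ n) (*-inverse (√ℕ n) (0<√ℕ n {{q}})) (√ℕ-* n)
  (RawSemiringDefinitions._^_ (RawRing.rawSemiring ℂ-rawRing) (w n {{q}} π)) (^≈^ℂ (w n {{q}} π))
  (F n {{q}} π) (F-unfold π n {{q}})

theorem3p2 : (π : ℝ) → IsPi π → (n : ℕ) → .{{_ : NonZero n}} →
    (Σ[ φ ∈ Bijection (C[∞]-setoid n) (C[∞]-setoid n) ]
    (∀ (H : ∃ (C[∞] n)) → proj₁ (to φ H) ≈ᴹ Φ n π (proj₁ H))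
    × (∀ (H : ∃ (C[∞] n)) → proj₁ H ∈ C[2] n → proj₁ (to φ H) ∈ C[∞,sa] n)
    × (∀ (K : ∃ (C[∞] n)) → proj₁ K ∈ C[∞,sa] n →
    Σ[ H ∈ ∃ (C[∞] n) ] (proj₁ H ∈ C[2] n × proj₁ (to φ H) ≈ᴹ proj₁ K)))
    × (∀ (H : Matrix n) → IsCirculant n H →
    (H ∈ √nU n ⇔ HasUnimodularEntries (Φ n π H))
    × (H ∈ √nO n ⇔ (IsSelfAdjoint (Φ n π H) × HasUnimodularEntries (Φ n π H))))
theorem3p2 π isPi n {{q}} = CirculantTransform.transform-theorem n {{q}} (1/√ n {{q}}) (√ℕ n)
  (F n {{q}} π) (λ i j → conj (F n {{q}} π i j)) (fourierTable π isPi n {{q}}) (C[∞] n {{q}}) (λ H h → h) (λ H h → h)
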